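{- Let $n\ge 3$ and consider the affine Weyl group $W_{\mathrm{aff}}$ of type $A_{n-1}^{(1)}$. Let $\mathbf d=(d_0,\dots,d_{n-1})$ be a degree such that $d_i=0$ for some $i$. Then there are positive real roots $\gamma_1,\dots,\gamma_r$ (with $r\ge0$) such that $z_{\mathbf d}=s_{\gamma_1}s_{\gamma_2}\cdots s_{\gamma_r}$ and such that, for all $1\le i,j\le r$ with $i\ne j$, either $\operatorname{supp}(\gamma_i)$ and $\operatorname{supp}(\gamma_j)$ are disconnected, or both $\gamma_i\perp\gamma_j$ and $\gamma_i,\gamma_j$ are comparable. Moreover, the product $s_{\gamma_1}s_{\gamma_2}\cdots s_{\gamma_r}$ is reduced (i.e. $\ell(z_{\mathbf d})=\sum_{i=1}^r\ell(s_{\gamma_i})$), and $\ell(z_{\mathbf d})=\sum_{i=1}^r\bigl(2|\operatorname{supp}(\gamma_i)|-1\bigr)$.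
   Context: Roots. Let $n\ge 3$. Let $\alpha_0,\dots,\alpha_{n-1}$ (indices mod $n$) be the affine simple roots of type $A_{n-1}^{(1)}$, $Q_{\mathrm{aff}}=\bigoplus_{i=0}^{n-1}\mathbb Z\alpha_i$, with symmetric form $\langle\alpha_i,\alpha_i\rangle=2$, $\langle\alpha_i,\alpha_{i\pm1}\rangle=-1$, all other $\langle\alpha_i,\alpha_j\rangle=0$; $\perp$ refers to this form. For $a,b\in Q_{\mathrm{aff}}$, $a\le b$ means $b-a$ has non-negative coefficients; comparable means $a\le b$ or $b\le a$. Put $c=\sum_{i=0}^{n-1}\alpha_i$. Let $\Pi=\Pi^+\sqcup\Pi^-$ be the finite root system of type $A_{n-1}$ with simple roots $\alpha_1,\dots,\alpha_{n-1}$. The affine real roots are $\alpha+mc$ with $\alpha\in\Pi$, $m\in\mathbb Z$; such a root is positive if $m>0$, or $m=0$ and $\alpha\in\Pi^+$. For $\alpha=\sum a_i\alpha_i$, $\operatorname{supp}(\alpha)=\{\alpha_i:a_i\ne0\}$. Two supports are disconnected if they are disjoint and no simple root in one is adjacent (in the cyclic Dynkin diagram) to a simple root in the other. Weyl group. For a real root $\alpha$, $s_\alpha(\mu)=\mu-\langle\mu,\alpha\rangle\alpha$. $W_{\mathrm{aff}}$ is the group generated by $s_i=s_{\alpha_i}$, $0\le i\le n-1$ (a Coxeter group with these generators), with length $\ell$. Hecke product: $u\cdot s_i=us_i$ if $\ell(us_i)>\ell(u)$ and $u\cdot s_i=u$ otherwise; $u\cdot v=u\cdot s_{i_1}\cdots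 s_{i_k}$ (applied left to right) for any reduced expression $v=s_{i_1}\cdots s_{i_k}$. This is a well-defined associative product. Degrees and $z_{\mathbf d}$. A degree is a tuple $\mathbf d=(d_0,\dots,d_{n-1})\in\mathbb Z_{\ge0}^n$, identified with $\sum d_i\alpha_i$. For a degree $\mathbf d$ with $d_i=0$ for some $i$: $z_{\mathbf 0}=id$, and for $\mathbf d\ne0$, $z_{\mathbf d}=s_\alpha\cdot z_{\mathbf d-\alpha}$ (Hecke product) where $\alpha$ is any maximal element of the set of positive real roots $\le\mathbf d$; this is independent of choices. -}

module Defs where

import Algebra.Definitions.RawMonoid as RawMonoidDefinitions
import Algebra.Properties.Semiring.Sum as SemiringSum
open import Data.Bool using (if_then_else_; _∧_; not)
open import Data.Fin as Fin using (Fin; zero; suc; toℕ; fromℕ<)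
import Data.Fin.Properties as Finₚ
open import Data.Fin.Subset using (Subset; _∈_; ∣_∣)
open import Data.Integer as ℤ using (ℤ; +_; 0ℤ; 1ℤ; -1ℤ)
import Data.Integer.Properties as ℤₚ
open import Data.Integer.Tactic.RingSolver using (solve-∀)
open import Data.List as List using (List; []; _∷_; length)
open import Data.Nat as ℕ using (ℕ; zero; suc; z≤n; s≤s)
import Data.Nat.Induction as ℕᵢ
import Data.Nat.Properties as ℕₚ
open import Data.Product using (Σ; Σ-syntax; ∃; ∃₂; _×_; _,_; proj₁; proj₂)
open import Data.Sum using (_⊎_; inj₁; inj₂; [_,_]′)
open import Data.Vec as Vec using (Vec; []; _∷_; lookup; tabulate; replicate; zipWith; toList; fromList)
import Data.Vec.Functional as Functional
import Data.Vec.Properties as Vecₚ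
open import Function using (_∘_; id)
open import Induction.WellFounded using (Acc; acc)
open import Relation.Binary.PropositionalEquality
open import Relation.Nullary using (¬_; Dec; yes; no; does; contradiction)
open import Relation.Nullary.Decidable using (map′; _×-dec_; _⊎-dec_; ¬?; dec-true; dec-false)
open import Relation.Unary using (Decidable)

open SemiringSum ℤₚ.+-*-semiring using (sum; sum-cong-≗; ∑-distrib-+; ∑-comm; *-distribˡ-sum; sum-replicate-zero)
open RawMonoidDefinitions ℕ.+-0-rawMonoid public using () renaming (sum to sumℕ)

δ : ∀ {m} → Fin m → Fin m → ℤ
δ i j = if does (i Fin.≟ j) then 1ℤ else 0ℤ

-- The hypothesis 3 ≤ n is used to see that the reflections in affine real
-- roots lie in the group generated by the simple reflections.
module Affine (n : ℕ) (3≤n : 3 ℕ.≤ n) where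

  -- The vector of coefficients with respect to α 0, …, α (n - 1).
  Q : Set
  Q = Vec ℤ n

  infixl 6 _⊕_ _⊖_
  infixl 7 _•_
  infix 4 _≤Q_

  _⊕_ _⊖_ : Q → Q → Q
  _⊕_ = zipWith ℤ._+_
  _⊖_ = zipWith ℤ._-_

  ⊝_ : Q → Q
  ⊝_ = Vec.map (ℤ.-_)

  _•_ : ℤ → Q → Q
  k • x = Vec.map (k ℤ.*_) x

  _≤Q_ : Q → Q → Set
  x ≤Q y = ∀ i → lookup x i ℤ.≤ lookup y i

  Comparable : Q → Q → Set
  Comparable x y = x ≤Q y ⊎ y ≤Q x

  α : Fin n → Q
  α i = tabulate (δ i)

  c : Q
  c = replicate n 1ℤ

  -- j = i + 1 modulo n.
  Next : Fin n → Fin n → Set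
  Next i j = toℕ j ≡ suc (toℕ i) ⊎ (suc (toℕ i) ≡ n × toℕ j ≡ 0)

  Adjacent : Fin n → Fin n → Set
  Adjacent i j = Next i j ⊎ Next j i

  next? : ∀ i j → Dec (Next i j)
  next? i j = (toℕ j ℕ.≟ suc (toℕ i)) ⊎-dec ((suc (toℕ i) ℕ.≟ n) ×-dec (toℕ j ℕ.≟ 0))

  adjacent? : ∀ i j → Dec (Adjacent i j)
  adjacent? i j = next? i j ⊎-dec next? j i

  cartan : Fin n → Fin n → ℤ
  cartan i j = if does (i Fin.≟ j) then + 2 else (if does (adjacent? i j) then -1ℤ else 0ℤ)

  ⟨_,_⟩ : Q → Q → ℤ
  ⟨ x , y ⟩ = sum λ i → sum λ j → lookup x i ℤ.* cartan i j ℤ.* lookup y j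

  _⊥_ : Q → Q → Set
  x ⊥ y = ⟨ x , y ⟩ ≡ 0ℤ

  supp : Q → Subset n
  supp = Vec.map λ a → not (does (a ℤ.≟ 0ℤ))

  Disconnected : Subset n → Subset n → Set
  Disconnected S T = ∀ i j → i ∈ S → j ∈ T → i ≢ j × ¬ Adjacent i j

  -- α a + α (a + 1) + … + α b; those with 1 ≤ a ≤ b ≤ n - 1 are the positive
  -- roots of type A with simple roots α 1, …, α (n - 1).
  interval : ℕ → ℕ → Q
  interval a b = tabulate λ k → if does (a ℕ.≤? toℕ k) ∧ does (toℕ k ℕ.≤? b) then 1ℤ else 0ℤ

  IsFinitePositiveRoot : Q → Set
  IsFinitePositiveRoot x = ∃₂ λ a b → 1 ℕ.≤ a × a ℕ.≤ b × b ℕ.< n × x ≡ interval a b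

  IsFiniteRoot : Q → Set
  IsFiniteRoot x = IsFinitePositiveRoot x ⊎ IsFinitePositiveRoot (⊝ x)

  IsRealRoot : Q → Set
  IsRealRoot γ = ∃₂ λ x m → IsFiniteRoot x × γ ≡ x ⊕ m • c

  IsPositiveRealRoot : Q → Set
  IsPositiveRealRoot γ =
    Σ[ (x , m , _) ∈ IsRealRoot γ ] (0ℤ ℤ.< m ⊎ (m ≡ 0ℤ × IsFinitePositiveRoot x))

  reflect : Q → Q → Q
  reflect γ μ = μ ⊖ ⟨ μ , γ ⟩ • γ

  ⟦_⟧ : List (Fin n) → Q → Q
  ⟦ is ⟧ μ = List.foldr (λ i → reflect (α i)) μ is

  ext : ∀ {x y : Q} → (∀ i → lookup x i ≡ lookup y i) → x ≡ y
  ext {x} {y} h = trans (sym (Vecₚ.tabulate∘lookup x)) (trans (Vecₚ.tabulate-cong h) (Vecₚ.tabulate∘lookup y))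

  lookup-⊕ : ∀ x y i → lookup (x ⊕ y) i ≡ lookup x i ℤ.+ lookup y i
  lookup-⊕ x y i = Vecₚ.lookup-zipWith ℤ._+_ i x y

  lookup-⊖ : ∀ x y i → lookup (x ⊖ y) i ≡ lookup x i ℤ.- lookup y i
  lookup-⊖ x y i = Vecₚ.lookup-zipWith ℤ._-_ i x y

  lookup-⊝ : ∀ x i → lookup (⊝ x) i ≡ ℤ.- lookup x i
  lookup-⊝ x i = Vecₚ.lookup-map i ℤ.-_ x

  lookup-• : ∀ k x i → lookup (k • x) i ≡ k ℤ.* lookup x i
  lookup-• k x i = Vecₚ.lookup-map i (k ℤ.*_) x

  lookup-c : ∀ i → lookup c i ≡ 1ℤ
  lookup-c i = Vecₚ.lookup-replicate i 1ℤ

  lookup-α : ∀ i k → lookup (α i) k ≡ δ i k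
  lookup-α i k = Vecₚ.lookup∘tabulate (δ i) k

  lookup-reflect : ∀ γ μ i → lookup (reflect γ μ) i ≡ lookup μ i ℤ.- ⟨ μ , γ ⟩ ℤ.* lookup γ i
  lookup-reflect γ μ i = trans (lookup-⊖ μ (⟨ μ , γ ⟩ • γ) i) (cong (λ t → lookup μ i ℤ.- t) (lookup-• ⟨ μ , γ ⟩ γ i))

  sum-δ : ∀ {m} (i : Fin m) (f : Fin m → ℤ) → sum (λ k → δ i k ℤ.* f k) ≡ f i
  sum-δ {suc m} zero f = begin
      1ℤ ℤ.* f zero ℤ.+ sum (λ k → 0ℤ ℤ.* f (suc k)) ≡⟨ cong₂ ℤ._+_ (ℤₚ.*-identityˡ (f zero)) (sum-cong-≗ (λ k → ℤₚ.*-zeroˡ (f (suc k)))) ⟩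
      f zero ℤ.+ sum {m} (λ k → 0ℤ) ≡⟨ cong (λ t → f zero ℤ.+ t) (sum-replicate-zero m) ⟩
      f zero ℤ.+ 0ℤ ≡⟨ ℤₚ.+-identityʳ (f zero) ⟩
      f zero ∎
    where open ≡-Reasoning
  sum-δ {suc m} (suc i) f = begin
      0ℤ ℤ.* f zero ℤ.+ sum (λ k → δ i k ℤ.* f (suc k)) ≡⟨ cong₂ ℤ._+_ (ℤₚ.*-zeroˡ (f zero)) (sum-δ i (f ∘ suc)) ⟩
      0ℤ ℤ.+ f (suc i) ≡⟨ ℤₚ.+-identityˡ (f (suc i)) ⟩
      f (suc i) ∎
    where open ≡-Reasoning

  Adjacent-sym : ∀ {i j} → Adjacent i j → Adjacent j i
  Adjacent-sym (inj₁ p) = inj₂ p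
  Adjacent-sym (inj₂ p) = inj₁ p

  cartan-refl : ∀ i → cartan i i ≡ + 2
  cartan-refl i = cong (λ b → if b then + 2 else (if does (adjacent? i i) then -1ℤ else 0ℤ)) (dec-true (i Fin.≟ i) refl)

  cartan-adjacent : ∀ {i j} → i ≢ j → Adjacent i j → cartan i j ≡ -1ℤ
  cartan-adjacent {i} {j} ne adj =
    trans (cong (λ b → if b then + 2 else (if does (adjacent? i j) then -1ℤ else 0ℤ)) (dec-false (i Fin.≟ j) ne))
          (cong (λ b → if b then -1ℤ else 0ℤ) (dec-true (adjacent? i j) adj))

  cartan-far : ∀ {i j} → i ≢ j → ¬ Adjacent i j → cartan i j ≡ 0ℤ
  cartan-far {i} {j} ne far =
    trans (cong (λ b → if b then + 2 else (if does (adjacent? i j) then -1ℤ else 0ℤ)) (dec-false (i Fin.≟ j) ne))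
          (cong (λ b → if b then -1ℤ else 0ℤ) (dec-false (adjacent? i j) far))

  cartan-sym : ∀ i j → cartan i j ≡ cartan j i
  cartan-sym i j = cases (i Fin.≟ j) (adjacent? i j)
    where
      cases : Dec (i ≡ j) → Dec (Adjacent i j) → cartan i j ≡ cartan j i
      cases (yes p) _         = cong₂ cartan p (sym p)
      cases (no ne) (yes adj) = trans (cartan-adjacent ne adj) (sym (cartan-adjacent (ne ∘ sym) (Adjacent-sym adj)))
      cases (no ne) (no far)  = trans (cartan-far ne far) (sym (cartan-far (ne ∘ sym) (far ∘ Adjacent-sym)))

  form-sym : ∀ x y → ⟨ x , y ⟩ ≡ ⟨ y , x ⟩
  form-sym x y = trans (∑-comm (λ i j → lookup x i ℤ.* cartan i j ℤ.* lookup y j))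
    (sum-cong-≗ λ j → sum-cong-≗ λ i →
      trans (cong (λ t → lookup x i ℤ.* t ℤ.* lookup y j) (cartan-sym i j)) (swap (lookup x i) (cartan j i) (lookup y j)))
    where
      swap : ∀ a b e → a ℤ.* b ℤ.* e ≡ e ℤ.* b ℤ.* a
      swap = solve-∀

  form-⊕ˡ : ∀ x y z → ⟨ x ⊕ y , z ⟩ ≡ ⟨ x , z ⟩ ℤ.+ ⟨ y , z ⟩
  form-⊕ˡ x y z = trans
    (sum-cong-≗ λ i → trans
      (sum-cong-≗ λ j → trans (cong (λ t → t ℤ.* cartan i j ℤ.* lookup z j) (lookup-⊕ x y i))
                              (expand (lookup x i) (lookup y i) (cartan i j) (lookup z j)))
      (∑-distrib-+ (λ j → lookup x i ℤ.* cartan i j ℤ.* lookup z j) (λ j → lookup y i ℤ.* cartan i j ℤ.* lookup z j)))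
    (∑-distrib-+ (λ i → sum λ j → lookup x i ℤ.* cartan i j ℤ.* lookup z j) (λ i → sum λ j → lookup y i ℤ.* cartan i j ℤ.* lookup z j))
    where
      expand : ∀ a b p q → (a ℤ.+ b) ℤ.* p ℤ.* q ≡ a ℤ.* p ℤ.* q ℤ.+ b ℤ.* p ℤ.* q
      expand = solve-∀

  form-•ˡ : ∀ k x z → ⟨ k • x , z ⟩ ≡ k ℤ.* ⟨ x , z ⟩
  form-•ˡ k x z = trans
    (sum-cong-≗ λ i → trans
      (sum-cong-≗ λ j → trans (cong (λ t → t ℤ.* cartan i j ℤ.* lookup z j) (lookup-• k x i))
                              (expand k (lookup x i) (cartan i j) (lookup z j)))
      (sym (*-distribˡ-sum k (λ j → lookup x i ℤ.* cartan i j ℤ.* lookup z j))))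
    (sym (*-distribˡ-sum k (λ i → sum λ j → lookup x i ℤ.* cartan i j ℤ.* lookup z j)))
    where
      expand : ∀ k a p q → k ℤ.* a ℤ.* p ℤ.* q ≡ k ℤ.* (a ℤ.* p ℤ.* q)
      expand = solve-∀

  ⊝-as-• : ∀ x → ⊝ x ≡ -1ℤ • x
  ⊝-as-• x = ext λ i → trans (lookup-⊝ x i) (trans (sym (ℤₚ.-1*i≡-i (lookup x i))) (sym (lookup-• -1ℤ x i)))

  ⊖-as-⊕ : ∀ x y → x ⊖ y ≡ x ⊕ -1ℤ • y
  ⊖-as-⊕ x y = ext λ i → trans (lookup-⊖ x y i)
    (trans (cong (λ t → lookup x i ℤ.+ t) (trans (sym (ℤₚ.-1*i≡-i (lookup y i))) (sym (lookup-• -1ℤ y i))))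
           (sym (lookup-⊕ x (-1ℤ • y) i)))

  form-⊝ˡ : ∀ x z → ⟨ ⊝ x , z ⟩ ≡ ℤ.- ⟨ x , z ⟩
  form-⊝ˡ x z = trans (cong (λ t → ⟨ t , z ⟩) (⊝-as-• x)) (trans (form-•ˡ -1ℤ x z) (ℤₚ.-1*i≡-i ⟨ x , z ⟩))

  form-⊖ˡ : ∀ x y z → ⟨ x ⊖ y , z ⟩ ≡ ⟨ x , z ⟩ ℤ.- ⟨ y , z ⟩
  form-⊖ˡ x y z = trans (cong (λ t → ⟨ t , z ⟩) (⊖-as-⊕ x y))
    (trans (form-⊕ˡ x (-1ℤ • y) z) (cong (λ t → ⟨ x , z ⟩ ℤ.+ t) (trans (form-•ˡ -1ℤ y z) (ℤₚ.-1*i≡-i ⟨ y , z ⟩))))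

  form-⊕ʳ : ∀ x y z → ⟨ z , x ⊕ y ⟩ ≡ ⟨ z , x ⟩ ℤ.+ ⟨ z , y ⟩
  form-⊕ʳ x y z = trans (form-sym z (x ⊕ y)) (trans (form-⊕ˡ x y z) (cong₂ ℤ._+_ (form-sym x z) (form-sym y z)))

  form-•ʳ : ∀ k x z → ⟨ z , k • x ⟩ ≡ k ℤ.* ⟨ z , x ⟩
  form-•ʳ k x z = trans (form-sym z (k • x)) (trans (form-•ˡ k x z) (cong (k ℤ.*_) (form-sym x z)))

  form-⊖ʳ : ∀ x y z → ⟨ z , x ⊖ y ⟩ ≡ ⟨ z , x ⟩ ℤ.- ⟨ z , y ⟩
  form-⊖ʳ x y z = trans (form-sym z (x ⊖ y)) (trans (form-⊖ˡ x y z) (cong₂ ℤ._-_ (form-sym x z) (form-sym y z)))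

  form-α : ∀ i j → ⟨ α i , α j ⟩ ≡ cartan i j
  form-α i j = trans (sum-cong-≗ row) (sum-δ i (λ k → cartan k j))
    where
      rearrange : ∀ a b e → a ℤ.* b ℤ.* e ≡ e ℤ.* (a ℤ.* b)
      rearrange = solve-∀
      row : ∀ k → sum (λ l → lookup (α i) k ℤ.* cartan k l ℤ.* lookup (α j) l) ≡ δ i k ℤ.* cartan k j
      row k = trans
        (sum-cong-≗ λ l → trans (cong₂ (λ s t → s ℤ.* cartan k l ℤ.* t) (lookup-α i k) (lookup-α j l))
                                (rearrange (δ i k) (cartan k l) (δ j l)))
        (sum-δ j (λ l → δ i k ℤ.* cartan k l))

  reflect-⊕ : ∀ γ x y → reflect γ (x ⊕ y) ≡ reflect γ x ⊕ reflect γ y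
  reflect-⊕ γ x y = ext λ i → begin
      lookup (reflect γ (x ⊕ y)) i ≡⟨ lookup-reflect γ (x ⊕ y) i ⟩
      lookup (x ⊕ y) i ℤ.- ⟨ x ⊕ y , γ ⟩ ℤ.* lookup γ i
        ≡⟨ cong₂ (λ s t → s ℤ.- t ℤ.* lookup γ i) (lookup-⊕ x y i) (form-⊕ˡ x y γ) ⟩
      (lookup x i ℤ.+ lookup y i) ℤ.- (⟨ x , γ ⟩ ℤ.+ ⟨ y , γ ⟩) ℤ.* lookup γ i
        ≡⟨ split (lookup x i) (lookup y i) ⟨ x , γ ⟩ ⟨ y , γ ⟩ (lookup γ i) ⟩
      (lookup x i ℤ.- ⟨ x , γ ⟩ ℤ.* lookup γ i) ℤ.+ (lookup y i ℤ.- ⟨ y , γ ⟩ ℤ.* lookup γ i)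
        ≡⟨ sym (cong₂ ℤ._+_ (lookup-reflect γ x i) (lookup-reflect γ y i)) ⟩
      lookup (reflect γ x) i ℤ.+ lookup (reflect γ y) i ≡⟨ sym (lookup-⊕ (reflect γ x) (reflect γ y) i) ⟩
      lookup (reflect γ x ⊕ reflect γ y) i ∎
    where
      open ≡-Reasoning
      split : ∀ a b p q g → (a ℤ.+ b) ℤ.- (p ℤ.+ q) ℤ.* g ≡ (a ℤ.- p ℤ.* g) ℤ.+ (b ℤ.- q ℤ.* g)
      split = solve-∀

  reflect-• : ∀ γ k x → reflect γ (k • x) ≡ k • reflect γ x
  reflect-• γ k x = ext λ i → begin
      lookup (reflect γ (k • x)) i ≡⟨ lookup-reflect γ (k • x) i ⟩
      lookup (k • x) i ℤ.- ⟨ k • x , γ ⟩ ℤ.* lookup γ i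
        ≡⟨ cong₂ (λ s t → s ℤ.- t ℤ.* lookup γ i) (lookup-• k x i) (form-•ˡ k x γ) ⟩
      k ℤ.* lookup x i ℤ.- k ℤ.* ⟨ x , γ ⟩ ℤ.* lookup γ i ≡⟨ split k (lookup x i) ⟨ x , γ ⟩ (lookup γ i) ⟩
      k ℤ.* (lookup x i ℤ.- ⟨ x , γ ⟩ ℤ.* lookup γ i) ≡⟨ sym (cong (k ℤ.*_) (lookup-reflect γ x i)) ⟩
      k ℤ.* lookup (reflect γ x) i ≡⟨ sym (lookup-• k (reflect γ x) i) ⟩
      lookup (k • reflect γ x) i ∎
    where
      open ≡-Reasoning
      split : ∀ k a p g → k ℤ.* a ℤ.- k ℤ.* p ℤ.* g ≡ k ℤ.* (a ℤ.- p ℤ.* g)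
      split = solve-∀

  ⟦⟧-⊕ : ∀ is x y → ⟦ is ⟧ (x ⊕ y) ≡ ⟦ is ⟧ x ⊕ ⟦ is ⟧ y
  ⟦⟧-⊕ []       x y = refl
  ⟦⟧-⊕ (i ∷ is) x y = trans (cong (reflect (α i)) (⟦⟧-⊕ is x y)) (reflect-⊕ (α i) (⟦ is ⟧ x) (⟦ is ⟧ y))

  ⟦⟧-• : ∀ is k x → ⟦ is ⟧ (k • x) ≡ k • ⟦ is ⟧ x
  ⟦⟧-• []       k x = refl
  ⟦⟧-• (i ∷ is) k x = trans (cong (reflect (α i)) (⟦⟧-• is k x)) (reflect-• (α i) k (⟦ is ⟧ x))

  ⟦⟧-++ : ∀ is js μ → ⟦ is List.++ js ⟧ μ ≡ ⟦ is ⟧ (⟦ js ⟧ μ)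
  ⟦⟧-++ []       js μ = refl
  ⟦⟧-++ (i ∷ is) js μ = cong (reflect (α i)) (⟦⟧-++ is js μ)

  0Q : Q
  0Q = replicate n 0ℤ

  combination : ∀ {m} → (Fin m → ℤ) → (Fin m → Q) → Q
  combination {zero}  a v = 0Q
  combination {suc m} a v = a zero • v zero ⊕ combination (a ∘ suc) (v ∘ suc)

  lookup-combination : ∀ {m} (a : Fin m → ℤ) v k → lookup (combination a v) k ≡ sum (λ i → a i ℤ.* lookup (v i) k)
  lookup-combination {zero}  a v k = Vecₚ.lookup-replicate k 0ℤ
  lookup-combination {suc m} a v k = trans (lookup-⊕ (a zero • v zero) (combination (a ∘ suc) (v ∘ suc)) k)
    (cong₂ ℤ._+_ (lookup-• (a zero) (v zero) k) (lookup-combination (a ∘ suc) (v ∘ suc) k))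

  δ-sym : ∀ {m} (i j : Fin m) → δ i j ≡ δ j i
  δ-sym i j with i Fin.≟ j | j Fin.≟ i
  ... | yes _ | yes _ = refl
  ... | no _  | no _  = refl
  ... | yes p | no q  = contradiction (sym p) q
  ... | no p  | yes q = contradiction (sym q) p

  combination-α : ∀ x → combination (lookup x) α ≡ x
  combination-α x = ext λ k → trans (lookup-combination (lookup x) α k)
    (trans (sum-cong-≗ λ i → trans (cong (lookup x i ℤ.*_) (trans (lookup-α i k) (δ-sym i k))) (ℤₚ.*-comm (lookup x i) (δ k i)))
           (sum-δ k (lookup x)))

  ⟦⟧-combination : ∀ {m} is js (a : Fin m → ℤ) v → (∀ i → ⟦ is ⟧ (v i) ≡ ⟦ js ⟧ (v i)) →
                   ⟦ is ⟧ (combination a v) ≡ ⟦ js ⟧ (combination a v)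
  ⟦⟧-combination {zero}  is js a v h = trans (vanish is) (sym (vanish js))
    where
      zero-• : 0Q ≡ 0ℤ • 0Q
      zero-• = ext λ i → trans (Vecₚ.lookup-replicate i 0ℤ) (sym (trans (lookup-• 0ℤ 0Q i) (ℤₚ.*-zeroˡ (lookup 0Q i))))
      vanish : ∀ ks → ⟦ ks ⟧ 0Q ≡ 0Q
      vanish ks = trans (cong ⟦ ks ⟧ zero-•) (trans (⟦⟧-• ks 0ℤ 0Q)
        (ext λ i → trans (lookup-• 0ℤ (⟦ ks ⟧ 0Q) i) (trans (ℤₚ.*-zeroˡ (lookup (⟦ ks ⟧ 0Q) i)) (sym (Vecₚ.lookup-replicate i 0ℤ)))))
  ⟦⟧-combination {suc m} is js a v h =
    trans (⟦⟧-⊕ is _ _) (trans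
      (cong₂ _⊕_ (trans (⟦⟧-• is (a zero) (v zero)) (trans (cong (a zero •_) (h zero)) (sym (⟦⟧-• js (a zero) (v zero)))))
                 (⟦⟧-combination is js (a ∘ suc) (v ∘ suc) (h ∘ suc)))
      (sym (⟦⟧-⊕ js _ _)))

  _≟Q_ : (x y : Q) → Dec (x ≡ y)
  _≟Q_ = Vecₚ.≡-dec ℤ._≟_

  ⟦⟧-≗? : ∀ is js → Dec (∀ μ → ⟦ is ⟧ μ ≡ ⟦ js ⟧ μ)
  ⟦⟧-≗? is js = map′
    (λ h μ → subst (λ x → ⟦ is ⟧ x ≡ ⟦ js ⟧ x) (combination-α μ) (⟦⟧-combination is js (lookup μ) α h))
    (λ h i → h (α i))
    (Finₚ.all? λ i → ⟦ is ⟧ (α i) ≟Q ⟦ js ⟧ (α i))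

  form-reflectˡ : ∀ γ x z → ⟨ reflect γ x , z ⟩ ≡ ⟨ x , z ⟩ ℤ.- ⟨ x , γ ⟩ ℤ.* ⟨ γ , z ⟩
  form-reflectˡ γ x z = trans (form-⊖ˡ x (⟨ x , γ ⟩ • γ) z) (cong (λ t → ⟨ x , z ⟩ ℤ.- t) (form-•ˡ ⟨ x , γ ⟩ γ z))

  form-reflectʳ : ∀ γ x z → ⟨ z , reflect γ x ⟩ ≡ ⟨ z , x ⟩ ℤ.- ⟨ x , γ ⟩ ℤ.* ⟨ z , γ ⟩
  form-reflectʳ γ x z = trans (form-⊖ʳ x (⟨ x , γ ⟩ • γ) z) (cong (λ t → ⟨ z , x ⟩ ℤ.- t) (form-•ʳ ⟨ x , γ ⟩ γ z))

  reflect-reflect : ∀ β γ → ⟨ β , β ⟩ ≡ + 2 → ∀ μ → reflect (reflect β γ) μ ≡ reflect β (reflect γ (reflect β μ))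
  reflect-reflect β γ norm μ = ext λ i → trans (lhs i)
    (trans (identity (lookup μ i) (lookup β i) (lookup γ i) ⟨ μ , β ⟩ ⟨ μ , γ ⟩ ⟨ γ , β ⟩) (sym (rhs i)))
    where
      identity : ∀ m b g p q r →
        m ℤ.- (q ℤ.- r ℤ.* p) ℤ.* (g ℤ.- r ℤ.* b) ≡
        (m ℤ.- p ℤ.* b ℤ.- (q ℤ.- p ℤ.* r) ℤ.* g) ℤ.- (p ℤ.- p ℤ.* + 2 ℤ.- (q ℤ.- p ℤ.* r) ℤ.* r) ℤ.* b
      identity = solve-∀
      lhs : ∀ i → lookup (reflect (reflect β γ) μ) i ≡
        lookup μ i ℤ.- (⟨ μ , γ ⟩ ℤ.- ⟨ γ , β ⟩ ℤ.* ⟨ μ , β ⟩) ℤ.* (lookup γ i ℤ.- ⟨ γ , β ⟩ ℤ.* lookup β i)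
      lhs i = trans (lookup-reflect (reflect β γ) μ i)
        (cong₂ (λ s t → lookup μ i ℤ.- s ℤ.* t) (form-reflectʳ β γ μ) (lookup-reflect β γ i))
      x y : Q
      x = reflect β μ
      y = reflect γ x
      xγ : ⟨ x , γ ⟩ ≡ ⟨ μ , γ ⟩ ℤ.- ⟨ μ , β ⟩ ℤ.* ⟨ γ , β ⟩
      xγ = trans (form-reflectˡ β μ γ) (cong (λ t → ⟨ μ , γ ⟩ ℤ.- ⟨ μ , β ⟩ ℤ.* t) (form-sym β γ))
      xβ : ⟨ x , β ⟩ ≡ ⟨ μ , β ⟩ ℤ.- ⟨ μ , β ⟩ ℤ.* + 2
      xβ = trans (form-reflectˡ β μ β) (cong (λ t → ⟨ μ , β ⟩ ℤ.- ⟨ μ , β ⟩ ℤ.* t) norm)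
      yβ : ⟨ y , β ⟩ ≡ ⟨ μ , β ⟩ ℤ.- ⟨ μ , β ⟩ ℤ.* + 2 ℤ.- (⟨ μ , γ ⟩ ℤ.- ⟨ μ , β ⟩ ℤ.* ⟨ γ , β ⟩) ℤ.* ⟨ γ , β ⟩
      yβ = trans (form-reflectˡ γ x β) (cong₂ (λ s t → s ℤ.- t ℤ.* ⟨ γ , β ⟩) xβ xγ)
      yi : ∀ i → lookup y i ≡ lookup μ i ℤ.- ⟨ μ , β ⟩ ℤ.* lookup β i ℤ.- (⟨ μ , γ ⟩ ℤ.- ⟨ μ , β ⟩ ℤ.* ⟨ γ , β ⟩) ℤ.* lookup γ i
      yi i = trans (lookup-reflect γ x i) (cong₂ (λ s t → s ℤ.- t ℤ.* lookup γ i) (lookup-reflect β μ i) xγ)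
      rhs : ∀ i → lookup (reflect β y) i ≡
        (lookup μ i ℤ.- ⟨ μ , β ⟩ ℤ.* lookup β i ℤ.- (⟨ μ , γ ⟩ ℤ.- ⟨ μ , β ⟩ ℤ.* ⟨ γ , β ⟩) ℤ.* lookup γ i) ℤ.-
        (⟨ μ , β ⟩ ℤ.- ⟨ μ , β ⟩ ℤ.* + 2 ℤ.- (⟨ μ , γ ⟩ ℤ.- ⟨ μ , β ⟩ ℤ.* ⟨ γ , β ⟩) ℤ.* ⟨ γ , β ⟩) ℤ.* lookup β i
      rhs i = trans (lookup-reflect β y i) (cong₂ (λ s t → s ℤ.- t ℤ.* lookup β i) (yi i) yβ)

  record ReflectionInW (β : Q) : Set where
    constructor mkReflectionInW
    field
      norm    : ⟨ β , β ⟩ ≡ + 2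
      word    : List (Fin n)
      correct : ∀ μ → reflect β μ ≡ ⟦ word ⟧ μ
  open ReflectionInW

  simple∈W : ∀ i → ReflectionInW (α i)
  simple∈W i = mkReflectionInW (trans (form-α i i) (cartan-refl i)) (i ∷ []) (λ _ → refl)

  reflect∈W : ∀ {β γ} → ReflectionInW β → ReflectionInW γ → ReflectionInW (reflect β γ)
  reflect∈W {β} {γ} b g = mkReflectionInW norm′ (word b List.++ word g List.++ word b) correct′
    where
      identity : ∀ r → + 2 ℤ.- r ℤ.* r ℤ.- r ℤ.* (r ℤ.- r ℤ.* + 2) ≡ + 2
      identity = solve-∀
      norm′ : ⟨ reflect β γ , reflect β γ ⟩ ≡ + 2
      norm′ = trans (form-reflectʳ β γ (reflect β γ)) (trans
        (cong₂ (λ s t → s ℤ.- ⟨ γ , β ⟩ ℤ.* t)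
          (trans (form-reflectˡ β γ γ) (cong₂ (λ s t → s ℤ.- ⟨ γ , β ⟩ ℤ.* t) (norm g) (form-sym β γ)))
          (trans (form-reflectˡ β γ β) (cong (λ t → ⟨ γ , β ⟩ ℤ.- ⟨ γ , β ⟩ ℤ.* t) (norm b))))
        (identity ⟨ γ , β ⟩))
      correct′ : ∀ μ → reflect (reflect β γ) μ ≡ ⟦ word b List.++ word g List.++ word b ⟧ μ
      correct′ μ = begin
          reflect (reflect β γ) μ ≡⟨ reflect-reflect β γ (norm b) μ ⟩
          reflect β (reflect γ (reflect β μ)) ≡⟨ correct b _ ⟩
          ⟦ word b ⟧ (reflect γ (reflect β μ)) ≡⟨ cong ⟦ word b ⟧ (correct g _) ⟩
          ⟦ word b ⟧ (⟦ word g ⟧ (reflect β μ)) ≡⟨ cong (λ t → ⟦ word b ⟧ (⟦ word g ⟧ t)) (correct b μ) ⟩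
          ⟦ word b ⟧ (⟦ word g ⟧ (⟦ word b ⟧ μ)) ≡⟨ cong ⟦ word b ⟧ (sym (⟦⟧-++ (word g) (word b) μ)) ⟩
          ⟦ word b ⟧ (⟦ word g List.++ word b ⟧ μ) ≡⟨ sym (⟦⟧-++ (word b) (word g List.++ word b) μ) ⟩
          ⟦ word b List.++ word g List.++ word b ⟧ μ ∎
        where open ≡-Reasoning

  ⊕∈W : ∀ {β γ} → ReflectionInW β → ReflectionInW γ → ⟨ γ , β ⟩ ≡ -1ℤ → ReflectionInW (γ ⊕ β)
  ⊕∈W {β} {γ} b g pair = subst ReflectionInW eq (reflect∈W b g)
    where
      identity : ∀ p q → p ℤ.- -1ℤ ℤ.* q ≡ p ℤ.+ q
      identity = solve-∀
      eq : reflect β γ ≡ γ ⊕ β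
      eq = ext λ i → trans (lookup-reflect β γ i) (trans (cong (λ t → lookup γ i ℤ.- t ℤ.* lookup β i) pair)
             (trans (identity (lookup γ i) (lookup β i)) (sym (lookup-⊕ γ β i))))

  ⊝∈W : ∀ {β} → ReflectionInW β → ReflectionInW (⊝ β)
  ⊝∈W {β} b = subst ReflectionInW eq (reflect∈W b b)
    where
      identity : ∀ p → p ℤ.- + 2 ℤ.* p ≡ ℤ.- p
      identity = solve-∀
      eq : reflect β β ≡ ⊝ β
      eq = ext λ i → trans (lookup-reflect β β i) (trans (cong (λ t → lookup β i ℤ.- t ℤ.* lookup β i) (norm b))
             (trans (identity (lookup β i)) (sym (lookup-⊝ β i))))

  next : ∀ i → ∃ (Next i)
  next i = cases (suc (toℕ i) ℕ.<? n)
    where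
      cases : Dec (suc (toℕ i) ℕ.< n) → ∃ (Next i)
      cases (yes p) = fromℕ< p , inj₁ (Finₚ.toℕ-fromℕ< p)
      cases (no ¬p) = fromℕ< 0<n , inj₂ (ℕₚ.≤-antisym (Finₚ.toℕ<n i) (ℕₚ.≮⇒≥ ¬p) , Finₚ.toℕ-fromℕ< 0<n)
        where
          0<n : 0 ℕ.< n
          0<n = ℕₚ.≤-trans (s≤s z≤n) 3≤n

  previous : ∀ i → ∃ λ j → Next j i
  previous i = cases (toℕ i) refl
    where
      cases : ∀ k → toℕ i ≡ k → ∃ λ j → Next j i
      cases zero    eq = fromℕ< last<n , inj₂ (trans (cong suc (Finₚ.toℕ-fromℕ< last<n)) suc-pred , eq)
        where
          suc-pred : suc (ℕ.pred n) ≡ n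
          suc-pred = ℕₚ.suc-pred n {{ℕ.>-nonZero (ℕₚ.≤-trans (s≤s z≤n) 3≤n)}}
          last<n : ℕ.pred n ℕ.< n
          last<n = ℕₚ.≤-reflexive suc-pred
      cases (suc k) eq = fromℕ< k<n , inj₁ (trans eq (cong suc (sym (Finₚ.toℕ-fromℕ< k<n))))
        where
          k<n : k ℕ.< n
          k<n = ℕₚ.<-trans (ℕₚ.n<1+n k) (subst (ℕ._< n) eq (Finₚ.toℕ<n i))

  Next-functional : ∀ {i j k} → Next i j → Next i k → j ≡ k
  Next-functional (inj₁ p) (inj₁ q) = Finₚ.toℕ-injective (trans p (sym q))
  Next-functional {j = j} (inj₁ p) (inj₂ (q , _)) = contradiction (trans p q) (ℕₚ.<⇒≢ (Finₚ.toℕ<n j))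
  Next-functional {k = k} (inj₂ (p , _)) (inj₁ q) = contradiction (trans q p) (ℕₚ.<⇒≢ (Finₚ.toℕ<n k))
  Next-functional (inj₂ (_ , p)) (inj₂ (_ , q)) = Finₚ.toℕ-injective (trans p (sym q))

  Next-injective : ∀ {i j k} → Next j i → Next k i → j ≡ k
  Next-injective (inj₁ p) (inj₁ q) = Finₚ.toℕ-injective (ℕₚ.suc-injective (trans (sym p) q))
  Next-injective (inj₁ p) (inj₂ (_ , q)) = contradiction (trans (sym q) p) λ ()
  Next-injective (inj₂ (_ , p)) (inj₁ q) = contradiction (trans (sym p) q) λ ()
  Next-injective (inj₂ (p , _)) (inj₂ (q , _)) = Finₚ.toℕ-injective (ℕₚ.suc-injective (trans p (sym q)))

  Next-irrefl : ∀ {i} → ¬ Next i i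
  Next-irrefl (inj₁ p) = contradiction p (ℕₚ.<⇒≢ (ℕₚ.n<1+n _))
  Next-irrefl (inj₂ (p , q)) = contradiction (trans (cong suc (sym q)) p) (ℕₚ.<⇒≢ (ℕₚ.<-trans (ℕₚ.n<1+n 1) 3≤n))

  -- Here n ≥ 3 is needed: for n = 2 the two neighbours coincide.
  Next-asym : ∀ {i j} → Next i j → ¬ Next j i
  Next-asym (inj₁ p) (inj₁ q) = ℕₚ.<-asym (ℕₚ.≤-reflexive (sym p)) (ℕₚ.≤-reflexive (sym q))
  Next-asym (inj₁ p) (inj₂ (q , r)) = contradiction (trans (cong suc (sym (trans p (cong suc r)))) q) (ℕₚ.<⇒≢ 3≤n)
  Next-asym (inj₂ (p , q)) (inj₁ r) = contradiction (trans (cong suc (sym (trans r (cong suc q)))) p) (ℕₚ.<⇒≢ 3≤n)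
  Next-asym (inj₂ (p , _)) (inj₂ (_ , q)) = contradiction (trans (cong suc (sym q)) p) (ℕₚ.<⇒≢ (ℕₚ.<-trans (ℕₚ.n<1+n 1) 3≤n))

  form-c-α : ∀ k → ⟨ c , α k ⟩ ≡ 0ℤ
  form-c-α k = begin
      ⟨ c , α k ⟩ ≡⟨ sum-cong-≗ row ⟩
      sum (λ i → cartan i k) ≡⟨ sum-cong-≗ column ⟩
      sum (λ i → δ k i ℤ.* + 2 ℤ.+ (δ (proj₁ (next k)) i ℤ.* -1ℤ ℤ.+ δ (proj₁ (previous k)) i ℤ.* -1ℤ))
        ≡⟨ ∑-distrib-+ (λ i → δ k i ℤ.* + 2) (λ i → δ (proj₁ (next k)) i ℤ.* -1ℤ ℤ.+ δ (proj₁ (previous k)) i ℤ.* -1ℤ) ⟩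
      sum (λ i → δ k i ℤ.* + 2) ℤ.+ sum (λ i → δ (proj₁ (next k)) i ℤ.* -1ℤ ℤ.+ δ (proj₁ (previous k)) i ℤ.* -1ℤ)
        ≡⟨ cong₂ ℤ._+_ (sum-δ k (λ _ → + 2)) (trans
             (∑-distrib-+ (λ i → δ (proj₁ (next k)) i ℤ.* -1ℤ) (λ i → δ (proj₁ (previous k)) i ℤ.* -1ℤ))
             (cong₂ ℤ._+_ (sum-δ (proj₁ (next k)) (λ _ → -1ℤ)) (sum-δ (proj₁ (previous k)) (λ _ → -1ℤ)))) ⟩
      + 2 ℤ.+ (-1ℤ ℤ.+ -1ℤ) ∎
    where
      open ≡-Reasoning
      rearrange : ∀ a e → 1ℤ ℤ.* a ℤ.* e ≡ e ℤ.* a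
      rearrange = solve-∀
      row : ∀ i → sum (λ j → lookup c i ℤ.* cartan i j ℤ.* lookup (α k) j) ≡ cartan i k
      row i = trans
        (sum-cong-≗ λ j → trans (cong₂ (λ s t → s ℤ.* cartan i j ℤ.* t) (lookup-c i) (lookup-α k j))
                                (rearrange (cartan i j) (δ k j)))
        (sum-δ k (λ j → cartan i j))
      δ-eq : ∀ {i j : Fin n} → i ≡ j → δ i j ≡ 1ℤ
      δ-eq {i} {j} p = cong (λ b → if b then 1ℤ else 0ℤ) (dec-true (i Fin.≟ j) p)
      δ-ne : ∀ {i j : Fin n} → i ≢ j → δ i j ≡ 0ℤ
      δ-ne {i} {j} p = cong (λ b → if b then 1ℤ else 0ℤ) (dec-false (i Fin.≟ j) p)
      combine : ∀ {p q r v w x y z} → p ≡ w → q ≡ x → r ≡ y → v ≡ z → z ≡ w ℤ.* + 2 ℤ.+ (x ℤ.* -1ℤ ℤ.+ y ℤ.* -1ℤ) →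
                v ≡ p ℤ.* + 2 ℤ.+ (q ℤ.* -1ℤ ℤ.+ r ℤ.* -1ℤ)
      combine refl refl refl refl e = e
      nk = proj₂ (next k)
      pk = proj₂ (previous k)
      column : ∀ i → cartan i k ≡ δ k i ℤ.* + 2 ℤ.+ (δ (proj₁ (next k)) i ℤ.* -1ℤ ℤ.+ δ (proj₁ (previous k)) i ℤ.* -1ℤ)
      column i = cases (k Fin.≟ i) (next? k i) (next? i k)
        where
          cases : Dec (k ≡ i) → Dec (Next k i) → Dec (Next i k) → _
          cases (yes refl) _ _ = combine (δ-eq {k} {k} refl) (δ-ne λ p → Next-irrefl (subst (Next k) p nk))
            (δ-ne λ p → Next-irrefl (subst (λ t → Next t k) p pk)) (cartan-refl k) refl
          cases (no ne) (yes p) _ = combine (δ-ne ne) (δ-eq (Next-functional nk p))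
            (δ-ne λ q → Next-asym p (subst (λ t → Next t k) q pk)) (cartan-adjacent (ne ∘ sym) (inj₂ p)) refl
          cases (no ne) (no ¬p) (yes q) = combine (δ-ne ne) (δ-ne λ p → ¬p (subst (Next k) p nk))
            (δ-eq (Next-injective pk q)) (cartan-adjacent (ne ∘ sym) (inj₁ q)) refl
          cases (no ne) (no ¬p) (no ¬q) = combine (δ-ne ne) (δ-ne λ p → ¬p (subst (Next k) p nk))
            (δ-ne λ q → ¬q (subst (λ t → Next t k) q pk)) (cartan-far (ne ∘ sym) λ { (inj₁ q) → ¬q q ; (inj₂ p) → ¬p p }) refl

  form-c : ∀ x → ⟨ c , x ⟩ ≡ 0ℤ
  form-c x = subst (λ t → ⟨ c , t ⟩ ≡ 0ℤ) (combination-α x) (vanish (lookup x) α form-c-α)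
    where
      vanish : ∀ {m} (a : Fin m → ℤ) v → (∀ i → ⟨ c , v i ⟩ ≡ 0ℤ) → ⟨ c , combination a v ⟩ ≡ 0ℤ
      vanish {zero} a v h = trans (sum-cong-≗ λ i → trans
        (sum-cong-≗ λ j → trans (cong (lookup c i ℤ.* cartan i j ℤ.*_) (Vecₚ.lookup-replicate j 0ℤ)) (ℤₚ.*-zeroʳ (lookup c i ℤ.* cartan i j)))
        (sum-replicate-zero n)) (sum-replicate-zero n)
      vanish {suc m} a v h = trans (form-⊕ʳ (a zero • v zero) _ c)
        (cong₂ ℤ._+_ (trans (form-•ʳ (a zero) (v zero) c) (trans (cong (a zero ℤ.*_) (h zero)) (ℤₚ.*-zeroʳ (a zero))))
                     (vanish (a ∘ suc) (v ∘ suc) (h ∘ suc)))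

  interval-in : ∀ a b k → a ℕ.≤ toℕ k → toℕ k ℕ.≤ b → lookup (interval a b) k ≡ 1ℤ
  interval-in a b k p q = trans (Vecₚ.lookup∘tabulate _ k)
    (cong (λ t → if t then 1ℤ else 0ℤ) (dec-true ((a ℕ.≤? toℕ k) ×-dec (toℕ k ℕ.≤? b)) (p , q)))

  interval-out : ∀ a b k → ¬ (a ℕ.≤ toℕ k × toℕ k ℕ.≤ b) → lookup (interval a b) k ≡ 0ℤ
  interval-out a b k p = trans (Vecₚ.lookup∘tabulate _ k)
    (cong (λ t → if t then 1ℤ else 0ℤ) (dec-false ((a ℕ.≤? toℕ k) ×-dec (toℕ k ℕ.≤? b)) p))

  interval-split : ∀ {a b e} → a ℕ.≤ suc b → b ℕ.≤ e → interval a b ⊕ interval (suc b) e ≡ interval a e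
  interval-split {a} {b} {e} a≤ b≤e = ext λ k → trans (lookup-⊕ (interval a b) (interval (suc b) e) k)
      (cases k (a ℕ.≤? toℕ k) (toℕ k ℕ.≤? b) (toℕ k ℕ.≤? e))
    where
      cases : ∀ k → Dec (a ℕ.≤ toℕ k) → Dec (toℕ k ℕ.≤ b) → Dec (toℕ k ℕ.≤ e) →
              lookup (interval a b) k ℤ.+ lookup (interval (suc b) e) k ≡ lookup (interval a e) k
      cases k (no ¬p) _ _ = trans
        (cong₂ ℤ._+_ (interval-out a b k (¬p ∘ proj₁)) (interval-out (suc b) e k (¬p ∘ ℕₚ.≤-trans a≤ ∘ proj₁)))
        (sym (interval-out a e k (¬p ∘ proj₁)))
      cases k (yes p) (yes q) _ = trans
        (cong₂ ℤ._+_ (interval-in a b k p q) (interval-out (suc b) e k λ r → ℕₚ.<⇒≱ (proj₁ r) q))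
        (sym (interval-in a e k p (ℕₚ.≤-trans q b≤e)))
      cases k (yes p) (no ¬q) (yes r) = trans
        (cong₂ ℤ._+_ (interval-out a b k (¬q ∘ proj₂)) (interval-in (suc b) e k (ℕₚ.≰⇒> ¬q) r))
        (sym (interval-in a e k p r))
      cases k (yes p) (no ¬q) (no ¬r) = trans
        (cong₂ ℤ._+_ (interval-out a b k (¬q ∘ proj₂)) (interval-out (suc b) e k (¬r ∘ proj₂)))
        (sym (interval-out a e k (¬r ∘ proj₂)))

  lookup-α-same : ∀ i → lookup (α i) i ≡ 1ℤ
  lookup-α-same i = trans (lookup-α i i) (cong (λ b → if b then 1ℤ else 0ℤ) (dec-true (i Fin.≟ i) refl))

  lookup-α-other : ∀ {i k} → i ≢ k → lookup (α i) k ≡ 0ℤ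
  lookup-α-other {i} {k} ne = trans (lookup-α i k) (cong (λ b → if b then 1ℤ else 0ℤ) (dec-false (i Fin.≟ k) ne))

  interval-single : ∀ i → interval (toℕ i) (toℕ i) ≡ α i
  interval-single i = ext λ k → cases k (i Fin.≟ k)
    where
      cases : ∀ k → Dec (i ≡ k) → lookup (interval (toℕ i) (toℕ i)) k ≡ lookup (α i) k
      cases k (yes refl) = trans (interval-in (toℕ i) (toℕ i) i ℕₚ.≤-refl ℕₚ.≤-refl) (sym (lookup-α-same i))
      cases k (no ne)    = trans (interval-out (toℕ i) (toℕ i) k λ (p , q) → ne (Finₚ.toℕ-injective (ℕₚ.≤-antisym p q))) (sym (lookup-α-other ne))

  interval-suc : ∀ {a b} (j : Fin n) → a ℕ.≤ suc b → toℕ j ≡ suc b → interval a (suc b) ≡ interval a b ⊕ α j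
  interval-suc {a} {b} j a≤ eq = trans (sym (interval-split a≤ (ℕₚ.n≤1+n b)))
    (cong (interval a b ⊕_) (trans (cong (λ t → interval t t) (sym eq)) (interval-single j)))

  cartan-distant : ∀ {i j} → 1 ℕ.≤ toℕ i → suc (toℕ i) ℕ.< toℕ j → cartan i j ≡ 0ℤ
  cartan-distant {i} {j} 1≤i i+1<j = cartan-far ne far
    where
      i<j : toℕ i ℕ.< toℕ j
      i<j = ℕₚ.<-trans (ℕₚ.n<1+n _) i+1<j
      ne : i ≢ j
      ne p = ℕₚ.<⇒≢ i<j (cong toℕ p)
      far : ¬ Adjacent i j
      far (inj₁ (inj₁ p))       = ℕₚ.<⇒≢ i+1<j (sym p)
      far (inj₁ (inj₂ (p , _))) = ℕₚ.<⇒≢ (ℕₚ.<-trans i+1<j (Finₚ.toℕ<n j)) p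
      far (inj₂ (inj₁ p))       = ℕₚ.<⇒≢ (ℕₚ.<-trans i<j (ℕₚ.n<1+n _)) p
      far (inj₂ (inj₂ (_ , p))) = ℕₚ.<⇒≢ 1≤i (sym p)

  form-interval-distant : ∀ a l (j : Fin n) → 1 ℕ.≤ a → suc (l ℕ.+ a) ℕ.< toℕ j → ⟨ interval a (l ℕ.+ a) , α j ⟩ ≡ 0ℤ
  form-interval-distant a l j 1≤a far = go l far
    where
      index : ∀ k → suc k ℕ.< toℕ j → ∃ λ (i : Fin n) → toℕ i ≡ k
      index k p = let k<n = ℕₚ.<-trans (ℕₚ.<-trans (ℕₚ.n<1+n k) p) (Finₚ.toℕ<n j) in fromℕ< k<n , Finₚ.toℕ-fromℕ< k<n
      last : ∀ k (i : Fin n) → toℕ i ≡ k → 1 ℕ.≤ k → suc k ℕ.< toℕ j → ⟨ α i , α j ⟩ ≡ 0ℤ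
      last _ i refl p q = trans (form-α i j) (cartan-distant p q)
      go : ∀ l → suc (l ℕ.+ a) ℕ.< toℕ j → ⟨ interval a (l ℕ.+ a) , α j ⟩ ≡ 0ℤ
      go zero p = let (i , eq) = index a p in
        trans (cong (λ t → ⟨ t , α j ⟩) (trans (cong (λ t → interval t t) (sym eq)) (interval-single i))) (last a i eq 1≤a p)
      go (suc l) p = let (i , eq) = index (suc l ℕ.+ a) p in
        trans (cong (λ t → ⟨ t , α j ⟩) (interval-suc i (ℕₚ.≤-trans (ℕₚ.m≤n+m a l) (ℕₚ.n≤1+n _)) eq))
          (trans (form-⊕ˡ (interval a (l ℕ.+ a)) (α i) (α j))
            (cong₂ ℤ._+_ (go l (ℕₚ.<-trans (ℕₚ.n<1+n _) p)) (last _ i eq (s≤s z≤n) p)))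

  form-interval-adjacent : ∀ a l (j : Fin n) → 1 ℕ.≤ a → toℕ j ≡ suc (l ℕ.+ a) → ⟨ interval a (l ℕ.+ a) , α j ⟩ ≡ -1ℤ
  form-interval-adjacent a l j 1≤a eqj = go l eqj
    where
      index : ∀ k → toℕ j ≡ suc k → ∃ λ (i : Fin n) → toℕ i ≡ k
      index k p = let k<n = ℕₚ.<-trans (ℕₚ.≤-reflexive (sym p)) (Finₚ.toℕ<n j) in fromℕ< k<n , Finₚ.toℕ-fromℕ< k<n
      last : ∀ (i : Fin n) → toℕ j ≡ suc (toℕ i) → ⟨ α i , α j ⟩ ≡ -1ℤ
      last i p = trans (form-α i j) (cartan-adjacent (λ q → ℕₚ.<⇒≢ (ℕₚ.≤-reflexive (sym p)) (cong toℕ q)) (inj₁ (inj₁ p)))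
      go : ∀ l → toℕ j ≡ suc (l ℕ.+ a) → ⟨ interval a (l ℕ.+ a) , α j ⟩ ≡ -1ℤ
      go zero p = let (i , eq) = index a p in
        trans (cong (λ t → ⟨ t , α j ⟩) (trans (cong (λ t → interval t t) (sym eq)) (interval-single i)))
              (last i (trans p (cong suc (sym eq))))
      go (suc l) p = let (i , eq) = index (suc l ℕ.+ a) p in
        trans (cong (λ t → ⟨ t , α j ⟩) (interval-suc i (ℕₚ.≤-trans (ℕₚ.m≤n+m a l) (ℕₚ.n≤1+n _)) eq))
          (trans (form-⊕ˡ (interval a (l ℕ.+ a)) (α i) (α j))
            (cong₂ ℤ._+_ (form-interval-distant a l j 1≤a (ℕₚ.≤-reflexive (sym p))) (last i (trans p (cong suc (sym eq))))))

  interval∈W : ∀ {a b} → 1 ℕ.≤ a → a ℕ.≤ b → b ℕ.< n → ReflectionInW (interval a b)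
  interval∈W {a} {b} 1≤a a≤b b<n = subst (ReflectionInW ∘ interval a) (ℕₚ.m∸n+n≡m a≤b)
      (go (b ℕ.∸ a) (subst (ℕ._< n) (sym (ℕₚ.m∸n+n≡m a≤b)) b<n))
    where
      go : ∀ l → l ℕ.+ a ℕ.< n → ReflectionInW (interval a (l ℕ.+ a))
      go zero p = subst ReflectionInW
        (trans (sym (interval-single (fromℕ< p))) (cong (λ t → interval t t) (Finₚ.toℕ-fromℕ< p))) (simple∈W (fromℕ< p))
      go (suc l) p = subst ReflectionInW
        (sym (interval-suc (fromℕ< p) (ℕₚ.≤-trans (ℕₚ.m≤n+m a l) (ℕₚ.n≤1+n _)) (Finₚ.toℕ-fromℕ< p)))
        (⊕∈W (simple∈W (fromℕ< p)) (go l (ℕₚ.<-trans (ℕₚ.n<1+n _) p))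
             (form-interval-adjacent a l (fromℕ< p) 1≤a (Finₚ.toℕ-fromℕ< p)))

  ⊕-comm : ∀ x y → x ⊕ y ≡ y ⊕ x
  ⊕-comm x y = ext λ i → trans (lookup-⊕ x y i) (trans (ℤₚ.+-comm (lookup x i) (lookup y i)) (sym (lookup-⊕ y x i)))

  c⊖∈W : ∀ {x y} → ReflectionInW x → ReflectionInW y → ReflectionInW (x ⊕ y) → ReflectionInW (c ⊖ (x ⊕ y)) → ReflectionInW (c ⊖ y)
  c⊖∈W {x} {y} rx ry rxy r = subst ReflectionInW eq (⊕∈W rx r pair)
    where
      cancel : ∀ p q s → p ℤ.- (q ℤ.+ s) ℤ.+ q ≡ p ℤ.- s
      cancel = solve-∀
      eq : c ⊖ (x ⊕ y) ⊕ x ≡ c ⊖ y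
      eq = ext λ i → trans (lookup-⊕ (c ⊖ (x ⊕ y)) x i)
        (trans (cong (λ t → t ℤ.+ lookup x i) (trans (lookup-⊖ c (x ⊕ y) i) (cong (λ t → lookup c i ℤ.- t) (lookup-⊕ x y i))))
          (trans (cancel (lookup c i) (lookup x i) (lookup y i)) (sym (lookup-⊖ c y i))))
      double : ∀ t → + 2 ℤ.* t ≡ (+ 2 ℤ.+ t ℤ.+ (t ℤ.+ + 2)) ℤ.- + 4
      double = solve-∀
      total : + 2 ℤ.+ ⟨ y , x ⟩ ℤ.+ (⟨ y , x ⟩ ℤ.+ + 2) ≡ + 2
      total = trans (sym (trans (form-⊕ˡ x y (x ⊕ y)) (cong₂ ℤ._+_
                (trans (form-⊕ʳ x y x) (cong₂ ℤ._+_ (norm rx) (form-sym x y)))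
                (trans (form-⊕ʳ x y y) (cong (λ t → ⟨ y , x ⟩ ℤ.+ t) (norm ry)))))) (norm rxy)
      yx : ⟨ y , x ⟩ ≡ -1ℤ
      yx = ℤₚ.*-cancelˡ-≡ (+ 2) ⟨ y , x ⟩ -1ℤ (trans (double ⟨ y , x ⟩) (cong (ℤ._- + 4) total))
      pair : ⟨ c ⊖ (x ⊕ y) , x ⟩ ≡ -1ℤ
      pair = trans (form-⊖ˡ c (x ⊕ y) x)
        (cong₂ ℤ._-_ (form-c x) (trans (form-⊕ˡ x y x) (cong₂ ℤ._+_ (norm rx) yx)))

  0<n : 0 ℕ.< n
  0<n = ℕₚ.≤-trans (s≤s z≤n) 3≤n

  pred<n : ℕ.pred n ℕ.< n
  pred<n = ℕₚ.≤-reflexive (ℕₚ.suc-pred n {{ℕ.>-nonZero 0<n}})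

  <⇒≤pred : ∀ {b} → b ℕ.< n → b ℕ.≤ ℕ.pred n
  <⇒≤pred = ℕₚ.<⇒≤pred

  α₀≡c⊖interval : (i : Fin n) → toℕ i ≡ 0 → α i ≡ c ⊖ interval 1 (ℕ.pred n)
  α₀≡c⊖interval i eq = ext λ k → trans (cases k (i Fin.≟ k)) (sym (lookup-⊖ c (interval 1 (ℕ.pred n)) k))
    where
      cases : ∀ k → Dec (i ≡ k) → lookup (α i) k ≡ lookup c k ℤ.- lookup (interval 1 (ℕ.pred n)) k
      cases k (yes refl) = trans (lookup-α-same i) (sym (cong₂ ℤ._-_ (lookup-c i)
        (interval-out 1 (ℕ.pred n) i λ (p , _) → ℕₚ.<⇒≢ p (sym eq))))
      cases k (no ne)    = trans (lookup-α-other ne) (sym (cong₂ ℤ._-_ (lookup-c k)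
        (interval-in 1 (ℕ.pred n) k (ℕₚ.n≢0⇒n>0 λ p → ne (Finₚ.toℕ-injective (trans eq (sym p)))) (<⇒≤pred (Finₚ.toℕ<n k)))))

  c⊖interval∈W : ∀ {a b} → 1 ℕ.≤ a → a ℕ.≤ b → b ℕ.< n → ReflectionInW (c ⊖ interval a b)
  c⊖interval∈W {a} {b} 1≤a a≤b b<n = right (ℕₚ.m≤n⇒m<n∨m≡n (<⇒≤pred b<n))
    where
      top : ReflectionInW (c ⊖ interval 1 (ℕ.pred n))
      top = subst ReflectionInW (α₀≡c⊖interval (fromℕ< 0<n) (Finₚ.toℕ-fromℕ< 0<n)) (simple∈W (fromℕ< 0<n))
      a≤pred : a ℕ.≤ ℕ.pred n
      a≤pred = ℕₚ.≤-trans a≤b (<⇒≤pred b<n)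
      left : ∀ a → 1 ℕ.≤ a → a ℕ.≤ ℕ.pred n → ReflectionInW (c ⊖ interval a (ℕ.pred n))
      left (suc zero)    _ _ = top
      left (suc (suc a)) _ p = c⊖∈W (interval∈W (s≤s z≤n) (s≤s z≤n) (ℕₚ.<-trans p pred<n)) (interval∈W (s≤s z≤n) p pred<n)
          (subst ReflectionInW (sym eq) (interval∈W (s≤s z≤n) (ℕₚ.≤-trans (s≤s z≤n) p) pred<n))
          (subst (λ t → ReflectionInW (c ⊖ t)) (sym eq) top)
        where
          eq : interval 1 (suc a) ⊕ interval (suc (suc a)) (ℕ.pred n) ≡ interval 1 (ℕ.pred n)
          eq = interval-split (s≤s z≤n) (ℕₚ.≤-trans (ℕₚ.n≤1+n _) p)
      right : b ℕ.< ℕ.pred n ⊎ b ≡ ℕ.pred n → ReflectionInW (c ⊖ interval a b)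
      right (inj₂ p) = subst (λ t → ReflectionInW (c ⊖ interval a t)) (sym p) (left a 1≤a a≤pred)
      right (inj₁ p) = c⊖∈W (interval∈W (s≤s z≤n) p pred<n) (interval∈W 1≤a a≤b b<n)
          (subst ReflectionInW (sym eq) (interval∈W 1≤a a≤pred pred<n))
          (subst (λ t → ReflectionInW (c ⊖ t)) (sym eq) (left a 1≤a a≤pred))
        where
          eq : interval (suc b) (ℕ.pred n) ⊕ interval a b ≡ interval a (ℕ.pred n)
          eq = trans (⊕-comm _ _) (interval-split (ℕₚ.≤-trans a≤b (ℕₚ.n≤1+n b)) (ℕₚ.<⇒≤ p))

  module _ {x : Q} (rx : ReflectionInW x) (r-1 : ReflectionInW (x ⊕ -1ℤ • c)) where

    private
      At : ℤ → Set
      At m = ReflectionInW (x ⊕ m • c)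

      lookup-level : ∀ m i → lookup (x ⊕ m • c) i ≡ lookup x i ℤ.+ m ℤ.* lookup c i
      lookup-level m i = trans (lookup-⊕ x (m • c) i) (cong (λ t → lookup x i ℤ.+ t) (lookup-• m c i))

      form-level : ∀ k l → ⟨ x ⊕ l • c , x ⊕ k • c ⟩ ≡ + 2
      form-level k l = trans (form-⊕ˡ x (l • c) (x ⊕ k • c)) (trans
        (cong₂ ℤ._+_
          (trans (form-⊕ʳ x (k • c) x) (cong₂ ℤ._+_ (norm rx)
            (trans (form-•ʳ k c x) (trans (cong (k ℤ.*_) (trans (form-sym x c) (form-c x))) (ℤₚ.*-zeroʳ k)))))
          (trans (form-•ˡ l c (x ⊕ k • c)) (trans (cong (l ℤ.*_) (form-c (x ⊕ k • c))) (ℤₚ.*-zeroʳ l))))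
        refl)

      mirror : ∀ k l → At k → At l → At (+ 2 ℤ.* k ℤ.- l)
      mirror k l rk rl = subst ReflectionInW eq (⊝∈W (reflect∈W rk rl))
        where
          identity : ∀ k l p q → ℤ.- (p ℤ.+ l ℤ.* q ℤ.- + 2 ℤ.* (p ℤ.+ k ℤ.* q)) ≡ p ℤ.+ (+ 2 ℤ.* k ℤ.- l) ℤ.* q
          identity = solve-∀
          eq : ⊝ reflect (x ⊕ k • c) (x ⊕ l • c) ≡ x ⊕ (+ 2 ℤ.* k ℤ.- l) • c
          eq = ext λ i → begin
              lookup (⊝ reflect (x ⊕ k • c) (x ⊕ l • c)) i ≡⟨ lookup-⊝ (reflect (x ⊕ k • c) (x ⊕ l • c)) i ⟩
              ℤ.- lookup (reflect (x ⊕ k • c) (x ⊕ l • c)) i ≡⟨ cong ℤ.-_ (lookup-reflect (x ⊕ k • c) (x ⊕ l • c) i) ⟩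
              ℤ.- (lookup (x ⊕ l • c) i ℤ.- ⟨ x ⊕ l • c , x ⊕ k • c ⟩ ℤ.* lookup (x ⊕ k • c) i)
                ≡⟨ cong₂ (λ s t → ℤ.- (s ℤ.- t ℤ.* lookup (x ⊕ k • c) i)) (lookup-level l i) (form-level k l) ⟩
              ℤ.- (lookup x i ℤ.+ l ℤ.* lookup c i ℤ.- + 2 ℤ.* lookup (x ⊕ k • c) i)
                ≡⟨ cong (λ t → ℤ.- (lookup x i ℤ.+ l ℤ.* lookup c i ℤ.- + 2 ℤ.* t)) (lookup-level k i) ⟩
              ℤ.- (lookup x i ℤ.+ l ℤ.* lookup c i ℤ.- + 2 ℤ.* (lookup x i ℤ.+ k ℤ.* lookup c i)) ≡⟨ identity k l (lookup x i) (lookup c i) ⟩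
              lookup x i ℤ.+ (+ 2 ℤ.* k ℤ.- l) ℤ.* lookup c i ≡⟨ sym (lookup-level (+ 2 ℤ.* k ℤ.- l) i) ⟩
              lookup (x ⊕ (+ 2 ℤ.* k ℤ.- l) • c) i ∎
            where open ≡-Reasoning

      at0 : At 0ℤ
      at0 = subst ReflectionInW (ext λ i → sym (trans (lookup-level 0ℤ i)
        (trans (cong (λ t → lookup x i ℤ.+ t) (ℤₚ.*-zeroˡ (lookup c i))) (ℤₚ.+-identityʳ (lookup x i))))) rx

      up : ∀ m → At (+ m) × At (+ m ℤ.- 1ℤ)
      up zero    = at0 , r-1
      up (suc m) = let (p , q) = up m in
        subst At (step (+ m)) (mirror (+ m) (+ m ℤ.- 1ℤ) p q) , subst At (back (+ m)) p
        where
          step : ∀ m → + 2 ℤ.* m ℤ.- (m ℤ.- 1ℤ) ≡ 1ℤ ℤ.+ m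
          step = solve-∀
          back : ∀ m → m ≡ 1ℤ ℤ.+ m ℤ.- 1ℤ
          back = solve-∀

      down : ∀ m → At (ℤ.- + m) × At (ℤ.- + m ℤ.- 1ℤ)
      down zero    = at0 , r-1
      down (suc m) = let (p , q) = down m in
        subst At (back (+ m)) q , subst At (step (+ m)) (mirror (ℤ.- + m ℤ.- 1ℤ) (ℤ.- + m) q p)
        where
          step : ∀ m → + 2 ℤ.* (ℤ.- m ℤ.- 1ℤ) ℤ.- (ℤ.- m) ≡ ℤ.- (1ℤ ℤ.+ m) ℤ.- 1ℤ
          step = solve-∀
          back : ∀ m → ℤ.- m ℤ.- 1ℤ ≡ ℤ.- (1ℤ ℤ.+ m)
          back = solve-∀

    levels∈W : ∀ m → ReflectionInW (x ⊕ m • c)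
    levels∈W (+ m)        = proj₁ (up m)
    levels∈W (ℤ.-[1+ m ]) = proj₁ (down (suc m))

  finitePositiveRoot-level∈W : ∀ {y} → IsFinitePositiveRoot y → ∀ m → ReflectionInW (y ⊕ m • c)
  finitePositiveRoot-level∈W {y} (a , b , 1≤a , a≤b , b<n , eq) = levels∈W
      (subst ReflectionInW (sym eq) (interval∈W 1≤a a≤b b<n))
      (subst ReflectionInW ⊝-c⊖ (⊝∈W (subst (λ t → ReflectionInW (c ⊖ t)) (sym eq) (c⊖interval∈W 1≤a a≤b b<n))))
    where
      identity : ∀ p q → ℤ.- (p ℤ.- q) ≡ q ℤ.+ -1ℤ ℤ.* p
      identity = solve-∀
      ⊝-c⊖ : ⊝ (c ⊖ y) ≡ y ⊕ -1ℤ • c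
      ⊝-c⊖ = ext λ i → trans (lookup-⊝ (c ⊖ y) i) (trans (cong ℤ.-_ (lookup-⊖ c y i)) (trans (identity (lookup c i) (lookup y i))
        (sym (trans (lookup-⊕ y (-1ℤ • c) i) (cong (λ t → lookup y i ℤ.+ t) (lookup-• -1ℤ c i))))))

  realRoot∈W : ∀ {γ} → IsRealRoot γ → ReflectionInW γ
  realRoot∈W (x , m , inj₁ root , refl) = finitePositiveRoot-level∈W root m
  realRoot∈W (x , m , inj₂ root , refl) = subst ReflectionInW eq (⊝∈W (finitePositiveRoot-level∈W root (ℤ.- m)))
    where
      identity : ∀ p q m → ℤ.- (ℤ.- p ℤ.+ ℤ.- m ℤ.* q) ≡ p ℤ.+ m ℤ.* q
      identity = solve-∀
      eq : ⊝ (⊝ x ⊕ (ℤ.- m) • c) ≡ x ⊕ m • c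
      eq = ext λ i → begin
          lookup (⊝ (⊝ x ⊕ (ℤ.- m) • c)) i ≡⟨ lookup-⊝ (⊝ x ⊕ (ℤ.- m) • c) i ⟩
          ℤ.- lookup (⊝ x ⊕ (ℤ.- m) • c) i ≡⟨ cong ℤ.-_ (lookup-⊕ (⊝ x) ((ℤ.- m) • c) i) ⟩
          ℤ.- (lookup (⊝ x) i ℤ.+ lookup ((ℤ.- m) • c) i) ≡⟨ cong₂ (λ s t → ℤ.- (s ℤ.+ t)) (lookup-⊝ x i) (lookup-• (ℤ.- m) c i) ⟩
          ℤ.- (ℤ.- lookup x i ℤ.+ ℤ.- m ℤ.* lookup c i) ≡⟨ identity (lookup x i) (lookup c i) m ⟩
          lookup x i ℤ.+ m ℤ.* lookup c i ≡⟨ sym (trans (lookup-⊕ x (m • c) i) (cong (λ t → lookup x i ℤ.+ t) (lookup-• m c i))) ⟩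
          lookup (x ⊕ m • c) i ∎
        where open ≡-Reasoning

  -- The group generated by the simple reflections inside Aut(Q); since these
  -- are involutions, its elements are the maps induced by words in them.
  -- The word is only a witness: _≈_ and ℓ depend on the map alone.
  record W : Set where
    constructor mkW
    field
      to         : Q → Q
      expression : List (Fin n)
      to-word    : ∀ μ → to μ ≡ ⟦ expression ⟧ μ
  open W public

  infix 4 _≈_
  infixl 7 _∙_

  _≈_ : W → W → Set
  u ≈ v = ∀ μ → to u μ ≡ to v μ

  ε : W
  ε = mkW id [] (λ _ → refl)

  _∙_ : W → W → W
  u ∙ v = mkW (to u ∘ to v) (expression u List.++ expression v) λ μ →
    trans (to-word u (to v μ)) (trans (cong ⟦ expression u ⟧ (to-word v μ)) (sym (⟦⟧-++ (expression u) (expression v) μ)))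

  ∏ : ∀ {r} → (Fin r → W) → W
  ∏ = Functional.foldr _∙_ ε

  simple : Fin n → W
  simple i = mkW (reflect (α i)) (i ∷ []) (λ _ → refl)

  s : ∀ {γ} → IsRealRoot γ → W
  s {γ} root = mkW (reflect γ) (word (realRoot∈W root)) (correct (realRoot∈W root))

  IsExpression : W → List (Fin n) → Set
  IsExpression w is = ∀ μ → to w μ ≡ ⟦ is ⟧ μ

  HasExpressionOfLength : W → ℕ → Set
  HasExpressionOfLength w k = ∃ λ is → IsExpression w is × length is ≡ k

  isExpression? : ∀ w is → Dec (IsExpression w is)
  isExpression? w is = map′ (λ h μ → trans (to-word w μ) (h μ)) (λ h μ → trans (sym (to-word w μ)) (h μ))
    (⟦⟧-≗? (expression w) is)

  anyVec? : ∀ {m k} {P : Vec (Fin m) k → Set} → Decidable P → Dec (∃ P)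
  anyVec? {k = zero}  P? = map′ (λ p → [] , p) (λ { ([] , p) → p }) (P? [])
  anyVec? {k = suc k} P? = map′ (λ (x , xs , p) → x ∷ xs , p) (λ { (x ∷ xs , p) → x , xs , p })
    (Finₚ.any? λ x → anyVec? λ xs → P? (x ∷ xs))

  hasExpressionOfLength? : ∀ w → Decidable (HasExpressionOfLength w)
  hasExpressionOfLength? w k = map′
    (λ (is , h) → toList is , h , Vecₚ.length-toList is)
    (λ { (is , h , refl) → fromList is , subst (IsExpression w) (sym (Vecₚ.toList∘fromList is)) h })
    (anyVec? {k = k} λ is → isExpression? w (toList is))

  Least : (ℕ → Set) → ℕ → Set
  Least P k = P k × (∀ j → P j → k ℕ.≤ j)

  least : ∀ {P} → Decidable P → ∀ m → P m → ∃ (Least P)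
  least P? zero    p = zero , p , λ _ _ → z≤n
  least {P} P? (suc m) p with P? zero
  ... | yes p₀ = zero , p₀ , λ _ _ → z≤n
  ... | no ¬p₀ with least {P ∘ suc} (P? ∘ suc) m p
  ...   | k , pk , minimal = suc k , pk , λ { zero q → contradiction q ¬p₀ ; (suc j) q → s≤s (minimal j q) }

  minimalLength : ∀ w → ∃ (Least (HasExpressionOfLength w))
  minimalLength w = least (hasExpressionOfLength? w) (length (expression w)) (expression w , to-word w , refl)

  ℓ : W → ℕ
  ℓ w = proj₁ (minimalLength w)

  IsReducedExpression : W → List (Fin n) → Set
  IsReducedExpression w is = IsExpression w is × length is ≡ ℓ w

  reducedExpression : ∀ w → ∃ (IsReducedExpression w)
  reducedExpression w = proj₁ (proj₂ (minimalLength w))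

  _⋆_ : W → Fin n → W
  u ⋆ i = if does (ℓ u ℕ.<? ℓ (u ∙ simple i)) then u ∙ simple i else u

  -- w is the Hecke product u · v, computed from some reduced expression of v.
  IsHeckeProduct : W → W → W → Set
  IsHeckeProduct u v w = ∃ λ is → IsReducedExpression v is × w ≈ List.foldl _⋆_ u is

  Degree : Set
  Degree = Vec ℕ n

  fromDegree : Degree → Q
  fromDegree = Vec.map +_

  record IsMaximalRoot (d : Degree) (γ : Q) : Set where
    field
      positive : IsPositiveRealRoot γ
      below    : γ ≤Q fromDegree d
      maximal  : ∀ β → IsPositiveRealRoot β → β ≤Q fromDegree d → γ ≤Q β → β ≡ γ
  open IsMaximalRoot public

  -- IsZ d w holds when w is a value of z_d for some choice of the maximal
  -- roots and reduced expressions in its recursive definition, so a statement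
  -- about all such w holds for every choice; z-exists below shows that there
  -- is always one. It is meant for d with a vanishing coefficient, a condition
  -- that passes from d to e.
  data IsZ : Degree → W → Set where
    z-zero : ∀ {w} → w ≈ ε → IsZ (replicate n 0) w
    z-step : ∀ {d e γ u w} → d ≢ replicate n 0 → (γ-max : IsMaximalRoot d γ) →
             fromDegree e ≡ fromDegree d ⊖ γ → IsZ e u →
             IsHeckeProduct (s (proj₁ (positive γ-max))) u w → IsZ d w

  isFinitePositiveRoot? : Decidable IsFinitePositiveRoot
  isFinitePositiveRoot? x = map′
    (λ (a , b , p , q , eq) → toℕ a , toℕ b , p , q , Finₚ.toℕ<n b , eq)
    (λ (a , b , p , q , b<n , eq) → let a<n = ℕₚ.≤-<-trans q b<n in
      fromℕ< a<n , fromℕ< b<n ,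
      subst (1 ℕ.≤_) (sym (Finₚ.toℕ-fromℕ< a<n)) p ,
      subst₂ ℕ._≤_ (sym (Finₚ.toℕ-fromℕ< a<n)) (sym (Finₚ.toℕ-fromℕ< b<n)) q ,
      trans eq (sym (cong₂ interval (Finₚ.toℕ-fromℕ< a<n) (Finₚ.toℕ-fromℕ< b<n))))
    (Finₚ.any? λ (a : Fin n) → Finₚ.any? λ (b : Fin n) →
      (1 ℕ.≤? toℕ a) ×-dec ((toℕ a ℕ.≤? toℕ b) ×-dec (x ≟Q interval (toℕ a) (toℕ b))))

  private
    -- The coefficient of α 0 vanishes on finite roots, so γ determines m.
    finite-at-0 : ∀ {x} → IsFiniteRoot x → lookup x (fromℕ< 0<n) ≡ 0ℤ
    finite-at-0 {x} = [ at-0 x , (λ p → trans (sym (ℤₚ.neg-involutive (lookup x (fromℕ< 0<n))))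
      (cong ℤ.-_ (trans (sym (lookup-⊝ x (fromℕ< 0<n))) (at-0 (⊝ x) p)))) ]′
      where
        at-0 : ∀ x → IsFinitePositiveRoot x → lookup x (fromℕ< 0<n) ≡ 0ℤ
        at-0 x (a , b , 1≤a , _ , _ , eq) = trans (cong (λ t → lookup t (fromℕ< 0<n)) eq)
          (interval-out a b (fromℕ< 0<n) λ (p , _) → ℕₚ.<⇒≢ (ℕₚ.≤-trans 1≤a p) (sym (Finₚ.toℕ-fromℕ< 0<n)))

    level : Q → ℤ
    level γ = lookup γ (fromℕ< 0<n)

    finitePart : Q → Q
    finitePart γ = γ ⊖ level γ • c

    level-eq : ∀ {x m} → IsFiniteRoot x → level (x ⊕ m • c) ≡ m
    level-eq {x} {m} root = trans (lookup-⊕ x (m • c) i₀) (trans (cong₂ ℤ._+_ (finite-at-0 root)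
        (trans (lookup-• m c i₀) (trans (cong (m ℤ.*_) (lookup-c i₀)) (ℤₚ.*-identityʳ m)))) (ℤₚ.+-identityˡ m))
      where i₀ = fromℕ< 0<n

    cancel₁ : ∀ p q → p ℤ.+ q ℤ.- q ≡ p
    cancel₁ = solve-∀

    cancel₂ : ∀ p q → p ≡ p ℤ.- q ℤ.+ q
    cancel₂ = solve-∀

    finitePart-eq : ∀ {x m} → IsFiniteRoot x → finitePart (x ⊕ m • c) ≡ x
    finitePart-eq {x} {m} root = trans (cong (λ t → x ⊕ m • c ⊖ t • c) (level-eq {x} {m} root))
      (ext λ i → trans (lookup-⊖ (x ⊕ m • c) (m • c) i) (trans (cong (λ t → t ℤ.- lookup (m • c) i) (lookup-⊕ x (m • c) i))
        (cancel₁ (lookup x i) (lookup (m • c) i))))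

    decompose : ∀ γ → γ ≡ finitePart γ ⊕ level γ • c
    decompose γ = ext λ i → trans (cancel₂ (lookup γ i) (lookup (level γ • c) i))
      (sym (trans (lookup-⊕ (finitePart γ) (level γ • c) i) (cong (λ t → t ℤ.+ lookup (level γ • c) i) (lookup-⊖ γ (level γ • c) i))))

  isPositiveRealRoot? : Decidable IsPositiveRealRoot
  isPositiveRealRoot? γ = map′
    (λ (root , sign) → (finitePart γ , level γ , root , decompose γ) , sign)
    (λ { ((x , m , root , refl) , sign) →
         subst IsFiniteRoot (sym (finitePart-eq {x} {m} root)) root ,
         subst₂ (λ k y → 0ℤ ℤ.< k ⊎ (k ≡ 0ℤ × IsFinitePositiveRoot y)) (sym (level-eq {x} {m} root)) (sym (finitePart-eq {x} {m} root)) sign })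
    ((isFinitePositiveRoot? (finitePart γ) ⊎-dec isFinitePositiveRoot? (⊝ finitePart γ)) ×-dec
     ((0ℤ ℤ.<? level γ) ⊎-dec ((level γ ℤ.≟ 0ℤ) ×-dec isFinitePositiveRoot? (finitePart γ))))

  simple-positive : ∀ i → IsPositiveRealRoot (α i)
  simple-positive i = cases (toℕ i) refl
    where
      cases : ∀ k → toℕ i ≡ k → IsPositiveRealRoot (α i)
      cases zero eq = (x , 1ℤ , inj₂ (1 , ℕ.pred n , ℕₚ.≤-refl , <⇒≤pred (ℕₚ.≤-trans (s≤s (s≤s z≤n)) 3≤n) , pred<n , neg) , sum-eq) , inj₁ (ℤ.+<+ (s≤s z≤n))
        where
          x y : Q
          y = interval 1 (ℕ.pred n)
          x = ⊝ y
          neg : ⊝ x ≡ y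
          neg = ext λ k → trans (lookup-⊝ x k) (trans (cong ℤ.-_ (lookup-⊝ y k)) (ℤₚ.neg-involutive (lookup y k)))
          identity : ∀ p q → p ℤ.- q ≡ ℤ.- q ℤ.+ 1ℤ ℤ.* p
          identity = solve-∀
          sum-eq : α i ≡ x ⊕ 1ℤ • c
          sum-eq = trans (α₀≡c⊖interval i eq) (ext λ k → trans (lookup-⊖ c y k) (trans (identity (lookup c k) (lookup y k))
            (sym (trans (lookup-⊕ x (1ℤ • c) k) (cong₂ ℤ._+_ (lookup-⊝ y k) (lookup-• 1ℤ c k))))))
      cases (suc k) eq = (α i , 0ℤ , inj₁ finite , sum-eq) , inj₂ (refl , finite)
        where
          finite : IsFinitePositiveRoot (α i)
          finite = toℕ i , toℕ i , subst (1 ℕ.≤_) (sym eq) (s≤s z≤n) , ℕₚ.≤-refl , Finₚ.toℕ<n i , sym (interval-single i)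
          identity : ∀ p q → p ≡ p ℤ.+ 0ℤ ℤ.* q
          identity = solve-∀
          sum-eq : α i ≡ α i ⊕ 0ℤ • c
          sum-eq = ext λ k → trans (identity (lookup (α i) k) (lookup c k))
            (sym (trans (lookup-⊕ (α i) (0ℤ • c) k) (cong (λ t → lookup (α i) k ℤ.+ t) (lookup-• 0ℤ c k))))

  difference : Q → Q → Degree
  difference y x = Vec.map ℤ.∣_∣ (y ⊖ x)

  lookup-difference : ∀ x y → x ≤Q y → ∀ i → + lookup (difference y x) i ≡ lookup y i ℤ.- lookup x i
  lookup-difference x y x≤y i = trans
    (cong +_ (trans (Vecₚ.lookup-map i ℤ.∣_∣ (y ⊖ x)) (cong ℤ.∣_∣ (lookup-⊖ y x i))))
    (ℤₚ.0≤i⇒+∣i∣≡i (ℤₚ.i≤j⇒0≤j-i (x≤y i)))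

  lookup-fromDegree : ∀ d i → lookup (fromDegree d) i ≡ + lookup d i
  lookup-fromDegree d i = Vecₚ.lookup-map i +_ d

  fromDegree-difference : ∀ x y → x ≤Q y → fromDegree (difference y x) ≡ y ⊖ x
  fromDegree-difference x y x≤y = ext λ i → trans (lookup-fromDegree (difference y x) i)
    (trans (lookup-difference x y x≤y i) (sym (lookup-⊖ y x i)))

  private
    sum-< : ∀ {m} (x y : Vec ℕ m) → (∀ i → lookup x i ℕ.≤ lookup y i) → x ≢ y → Vec.sum x ℕ.< Vec.sum y
    sum-≤ : ∀ {m} (x y : Vec ℕ m) → (∀ i → lookup x i ℕ.≤ lookup y i) → Vec.sum x ℕ.≤ Vec.sum y
    sum-< [] [] _ ne = contradiction refl ne
    sum-< (a ∷ x) (b ∷ y) le ne with ℕₚ.m≤n⇒m<n∨m≡n (le zero)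
    ... | inj₁ a<b  = ℕₚ.+-mono-<-≤ a<b (sum-≤ x y (le ∘ suc))
    ... | inj₂ refl = ℕₚ.+-monoʳ-< a (sum-< x y (le ∘ suc) (ne ∘ cong (a ∷_)))
    sum-≤ [] [] _ = z≤n
    sum-≤ (a ∷ x) (b ∷ y) le = ℕₚ.+-mono-≤ (le zero) (sum-≤ x y (le ∘ suc))

    lookup≤sum : ∀ {m} (x : Vec ℕ m) i → lookup x i ℕ.≤ Vec.sum x
    lookup≤sum (a ∷ x) zero    = ℕₚ.m≤m+n a (Vec.sum x)
    lookup≤sum (a ∷ x) (suc i) = ℕₚ.≤-trans (lookup≤sum x i) (ℕₚ.m≤n+m (Vec.sum x) a)

    ≤Q-trans : ∀ x y z → x ≤Q y → y ≤Q z → x ≤Q z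
    ≤Q-trans x y z p q i = ℤₚ.≤-trans (p i) (q i)

    sum-difference-< : ∀ x x′ y → x ≤Q x′ → x′ ≤Q y → x′ ≢ x → Vec.sum (difference y x′) ℕ.< Vec.sum (difference y x)
    sum-difference-< x x′ y p q ne = sum-< (difference y x′) (difference y x) le distinct
      where
        le : ∀ i → lookup (difference y x′) i ℕ.≤ lookup (difference y x) i
        le i = ℤₚ.drop‿+≤+ (subst₂ ℤ._≤_ (sym (lookup-difference x′ y q i)) (sym (lookup-difference x y (≤Q-trans x x′ y p q) i))
          (ℤₚ.+-monoʳ-≤ (lookup y i) (ℤₚ.neg-mono-≤ (p i))))
        distinct : difference y x′ ≢ difference y x
        distinct eq = ne (ext λ i → trans (recover (lookup y i) (lookup x′ i)) (trans
            (cong (λ t → lookup y i ℤ.- t)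
              (trans (sym (lookup-difference x′ y q i)) (trans (cong (λ t → + lookup t i) eq) (lookup-difference x y (≤Q-trans x x′ y p q) i))))
            (sym (recover (lookup y i) (lookup x i)))))
          where
            recover : ∀ p q → q ≡ p ℤ.- (p ℤ.- q)
            recover = solve-∀

  module _ (d : Degree) where

    private
      IsLarger : Q → Q → Set
      IsLarger γ β = IsPositiveRealRoot β × β ≤Q fromDegree d × γ ≤Q β × β ≢ γ

      isLarger? : ∀ γ → Decidable (IsLarger γ)
      isLarger? γ β = isPositiveRealRoot? β ×-dec (Finₚ.all? (λ i → lookup β i ℤ.≤? lookup (fromDegree d) i) ×-dec
        (Finₚ.all? (λ i → lookup γ i ℤ.≤? lookup β i) ×-dec ¬? (β ≟Q γ)))

      shift : ∀ {m} → Q → Vec (Fin m) n → Q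
      shift γ v = γ ⊕ fromDegree (Vec.map toℕ v)

      larger? : ∀ γ → Dec (∃ (IsLarger γ))
      larger? γ = map′ (λ (v , h) → shift γ v , h) (λ (β , h) → vector β h , subst (IsLarger γ) (sym (shift-vector β h)) h)
          (anyVec? {suc N} (isLarger? γ ∘ shift γ))
        where
          N : ℕ
          N = Vec.sum (difference (fromDegree d) γ)
          bound : ∀ β → IsLarger γ β → ∀ i → lookup (difference β γ) i ℕ.< suc N
          bound β (_ , β≤d , γ≤β , _) i = s≤s (ℕₚ.≤-trans
            (ℤₚ.drop‿+≤+ (subst₂ ℤ._≤_ (sym (lookup-difference γ β γ≤β i)) (sym (lookup-difference γ (fromDegree d) (≤Q-trans γ β (fromDegree d) γ≤β β≤d) i))
              (ℤₚ.+-monoˡ-≤ (ℤ.- lookup γ i) (β≤d i))))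
            (lookup≤sum (difference (fromDegree d) γ) i))
          vector : ∀ β → IsLarger γ β → Vec (Fin (suc N)) n
          vector β h = tabulate λ i → fromℕ< (bound β h i)
          cancel : ∀ p q → p ℤ.+ (q ℤ.- p) ≡ q
          cancel = solve-∀
          shift-vector : ∀ β h → shift γ (vector β h) ≡ β
          shift-vector β h@(_ , _ , γ≤β , _) = ext λ i → begin
              lookup (shift γ (vector β h)) i ≡⟨ lookup-⊕ γ _ i ⟩
              lookup γ i ℤ.+ lookup (fromDegree (Vec.map toℕ (vector β h))) i
                ≡⟨ cong (λ t → lookup γ i ℤ.+ t) (trans (lookup-fromDegree (Vec.map toℕ (vector β h)) i)
                     (cong +_ (trans (Vecₚ.lookup-map i toℕ (vector β h))
                       (trans (cong toℕ (Vecₚ.lookup∘tabulate _ i)) (Finₚ.toℕ-fromℕ< (bound β h i)))))) ⟩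
              lookup γ i ℤ.+ + lookup (difference β γ) i ≡⟨ cong (λ t → lookup γ i ℤ.+ t) (lookup-difference γ β γ≤β i) ⟩
              lookup γ i ℤ.+ (lookup β i ℤ.- lookup γ i) ≡⟨ cancel (lookup γ i) (lookup β i) ⟩
              lookup β i ∎
            where open ≡-Reasoning

      climb : ∀ γ → IsPositiveRealRoot γ → γ ≤Q fromDegree d → Acc ℕ._<_ (Vec.sum (difference (fromDegree d) γ)) →
              ∃ λ β → IsMaximalRoot d β × γ ≤Q β
      climb γ pos γ≤d (acc rec) with larger? γ
      ... | yes (β , pos-β , β≤d , γ≤β , ne) =
        let (β′ , max , β≤β′) = climb β pos-β β≤d (rec (sum-difference-< γ β (fromDegree d) γ≤β β≤d ne)) in β′ , max , ≤Q-trans γ β β′ γ≤β β≤β′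
      ... | no ¬larger = γ , record
        { positive = pos
        ; below    = γ≤d
        ; maximal  = λ β pos-β β≤d γ≤β → decide β pos-β β≤d γ≤β (β ≟Q γ)
        } , λ i → ℤₚ.≤-refl
        where
          decide : ∀ β → IsPositiveRealRoot β → β ≤Q fromDegree d → γ ≤Q β → Dec (β ≡ γ) → β ≡ γ
          decide β _ _ _ (yes eq) = eq
          decide β p q r (no ne)  = contradiction (β , p , q , r , ne) ¬larger

    maximalRoot : ∀ γ → IsPositiveRealRoot γ → γ ≤Q fromDegree d → ∃ λ β → IsMaximalRoot d β × γ ≤Q β
    maximalRoot γ pos γ≤d = climb γ pos γ≤d (ℕᵢ.<-wellFounded _)

  z-exists : ∀ d → ∃ (IsZ d)
  z-exists d = go d (ℕᵢ.<-wellFounded (Vec.sum (difference (fromDegree d) 0Q)))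
    where
      0≤ : ∀ (d : Degree) i → lookup 0Q i ℤ.≤ lookup (fromDegree d) i
      0≤ d i = subst₂ ℤ._≤_ (sym (Vecₚ.lookup-replicate i 0ℤ)) (sym (lookup-fromDegree d i)) (ℤ.+≤+ z≤n)

      α≤ : ∀ (d : Degree) i → 1 ℕ.≤ lookup d i → α i ≤Q fromDegree d
      α≤ d i p k = cases (i Fin.≟ k)
        where
          cases : Dec (i ≡ k) → lookup (α i) k ℤ.≤ lookup (fromDegree d) k
          cases (yes refl) = subst₂ ℤ._≤_ (sym (lookup-α-same i)) (sym (lookup-fromDegree d i)) (ℤ.+≤+ p)
          cases (no ne)    = subst₂ ℤ._≤_ (sym (lookup-α-other ne)) (sym (lookup-fromDegree d k)) (ℤ.+≤+ z≤n)

      0≤α : ∀ i → 0Q ≤Q α i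
      0≤α i k = cases (i Fin.≟ k)
        where
          cases : Dec (i ≡ k) → lookup 0Q k ℤ.≤ lookup (α i) k
          cases (yes refl) = subst₂ ℤ._≤_ (sym (Vecₚ.lookup-replicate k 0ℤ)) (sym (lookup-α-same i)) (ℤ.+≤+ z≤n)
          cases (no ne)    = subst₂ ℤ._≤_ (sym (Vecₚ.lookup-replicate k 0ℤ)) (sym (lookup-α-other ne)) ℤₚ.≤-refl

      nonzero : ∀ i γ → α i ≤Q γ → γ ≢ 0Q
      nonzero i _ p refl = absurd (subst₂ ℤ._≤_ (lookup-α-same i) (Vecₚ.lookup-replicate i 0ℤ) (p i))
        where
          absurd : ¬ 1ℤ ℤ.≤ 0ℤ
          absurd (ℤ.+≤+ ())

      difference-0 : ∀ d → difference (fromDegree d) 0Q ≡ d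
      difference-0 d = trans (sym (Vecₚ.tabulate∘lookup _)) (trans (Vecₚ.tabulate-cong λ i → ℤₚ.+-injective
        (trans (lookup-difference 0Q (fromDegree d) (0≤ d) i) (trans (cong₂ ℤ._-_ (lookup-fromDegree d i) (Vecₚ.lookup-replicate i 0ℤ)) (ℤₚ.+-identityʳ _))))
        (Vecₚ.tabulate∘lookup d))

      go : ∀ d → Acc ℕ._<_ (Vec.sum (difference (fromDegree d) 0Q)) → ∃ (IsZ d)
      go d (acc rec) with Finₚ.any? (λ i → 1 ℕ.≤? lookup d i)
      ... | no none = subst (∃ ∘ IsZ) (sym zero-degree) (ε , z-zero λ _ → refl)
        where
          zero-degree : d ≡ replicate n 0
          zero-degree = trans (sym (Vecₚ.tabulate∘lookup d)) (trans (Vecₚ.tabulate-cong λ i →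
            trans (ℕₚ.n≤0⇒n≡0 (ℕₚ.≮⇒≥ λ p → none (i , p))) (sym (Vecₚ.lookup-replicate i 0))) (Vecₚ.tabulate∘lookup (replicate n 0)))
      ... | yes (i , p) with maximalRoot d (α i) (simple-positive i) (α≤ d i p)
      ...   | γ , γ-max , α≤γ with go (difference (fromDegree d) γ)
                 (rec (subst (λ t → Vec.sum t ℕ.< Vec.sum (difference (fromDegree d) 0Q)) (sym (difference-0 (difference (fromDegree d) γ)))
                   (sum-difference-< 0Q γ (fromDegree d) (≤Q-trans 0Q (α i) γ (0≤α i) α≤γ) (below γ-max) (nonzero i γ α≤γ))))
      ...     | u , z-u with reducedExpression u
      ...       | is , red = List.foldl _⋆_ (s (proj₁ (positive γ-max))) is ,
          z-step (λ { refl → ℕₚ.<⇒≢ p (sym (Vecₚ.lookup-replicate i 0)) }) γ-max (fromDegree-difference γ (fromDegree d) (below γ-max)) z-u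
            (is , red , λ _ → refl)

{-# OPTIONS --safe #-}

-- Fix a vertex with vanishing coefficient and count vertices from it: the
-- positive roots ≤ d are then sums of simple roots over linear intervals, and
-- a maximal one is a connected component of the support. Peeling these off
-- writes z_d as a Hecke product of reflections in intervals A₁, A₂, …, where for
-- i < j the interval A_j lies in A_i or is disconnected from it. In the Hecke
-- monoid the reflection in A absorbs the simple reflections at the ends of A
-- and commutes with those at its interior and far away. Hence the ends of A₁
-- can be deleted from all later intervals without changing the product, and
-- recursion leaves intervals that are strictly nested or disconnected. Each
-- reflection then fixes the simple roots in the later intervals, so that the
-- concatenated palindromic expressions are reduced.
module Submission where

open import Data.Nat using (ℕ; _≤_; _*_; _∸_)
open import Data.Fin using (Fin)
open import Data.Fin.Subset using (∣_∣)
open import Data.Product using (∃; _×_; proj₁)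
open import Data.Sum using (_⊎_)
open import Data.Vec using (lookup)
open import Relation.Binary.PropositionalEquality using (_≡_; _≢_)
open import Defs

import Algebra.Properties.Semiring.Sum as SemiringSum
open import Data.Bool using (true; false; not; if_then_else_)
open import Data.Fin as Fin using (zero; suc; toℕ; fromℕ<)
import Data.Fin.Properties as Finₚ
open import Data.Fin.Subset using (Subset; _∈_)
open import Data.Integer as ℤ using (ℤ; +_; 0ℤ; 1ℤ; -1ℤ)
import Data.Integer.Properties as ℤₚ
open import Data.Integer.Tactic.RingSolver using (solve-∀)
open import Data.List as List using (List; []; _∷_; _++_; length; reverse; foldl; foldr)
open import Data.List.Membership.Propositional using (find)
open import Data.List.Membership.Propositional.Properties using (∈-lookup)
import Data.List.Properties as Listₚ
open import Data.List.Relation.Unary.All as All using (All; []; _∷_)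
import Data.List.Relation.Unary.All.Properties as Allₚ
open import Data.List.Relation.Unary.AllPairs using (AllPairs; []; _∷_)
open import Data.List.Relation.Unary.Any using (Any; here; there)
open import Data.Nat as ℕ using (zero; suc; z≤n; s≤s; _≤‴_; ≤‴-refl; ≤‴-step)
import Data.Nat.Properties as ℕₚ
open import Data.Product using (∃₂; _,_; proj₂)
open import Data.Sum using (inj₁; inj₂; [_,_]′)
open import Data.Vec using ([]; _∷_; tabulate)
import Data.Vec.Properties as Vecₚ
open import Function using (_∘_)
open import Relation.Binary.PropositionalEquality using (refl; sym; trans; cong; cong₂; subst; subst₂; module ≡-Reasoning)
open import Relation.Nullary using (¬_; Dec; yes; no; does; contradiction)
open import Relation.Nullary.Decidable using (dec-true; dec-false; _×-dec_)

open SemiringSum ℤₚ.+-*-semiring using (sum; sum-cong-≗; ∑-distrib-+; ∑-comm; *-distribʳ-sum; sum-replicate-zero)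

-- The Hecke product compares lengths, and lengths are minima over words, so everything rests on the
-- criterion that `u ∙ simple i` is longer than `u` iff `to u (α i)` is positive. Rather than
-- following real roots through words, only their norm is kept: words preserve the form, and an
-- integral vector of norm 2 cannot have coefficients of both signs, because the norm is the sum of
-- squared differences around the cycle. This yields the exchange property and with it the
-- criterion. Ends have to be deleted in the Hecke monoid: if `d` is twice a simple root, the peeled
-- intervals are the same vertex twice, whose ordinary product is the identity while the Hecke
-- product is one reflection. A single cut at each end of A₁ is enough, since it makes inclusions in
-- A₁ strict; and cutting all later intervals at these ends is monotone, so the remaining list
-- satisfies the same hypothesis again.

-- Energy of integer sequences.

t≤t² : ∀ t → t ℤ.≤ t ℤ.* t
t≤t² (+ zero)    = ℤₚ.≤-refl
t≤t² (+ suc m)   = subst (+ suc m ℤ.≤_) (ℤₚ.pos-* (suc m) (suc m)) (ℤ.+≤+ (ℕₚ.m≤m*n (suc m) (suc m)))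
t≤t² ℤ.-[1+ m ] = ℤ.-≤+

-- The Dirichlet energy of a path; for one lap around the cycle it is the norm (`norm-squares`).
squares : (ℕ → ℤ) → ℕ → ℤ
squares y m = sum {m} λ k → (y (toℕ k) ℤ.- y (suc (toℕ k))) ℤ.* (y (toℕ k) ℤ.- y (suc (toℕ k)))

-- A step t contributes t², which bounds both t and its negative. Each stretch of a path can
-- therefore be charged in whichever direction is needed, here and in the next two lemmas.
rise : ∀ y m → y m ℤ.- y 0 ℤ.≤ squares y m
rise y zero    = ℤₚ.≤-reflexive (ℤₚ.+-inverseʳ (y 0))
rise y (suc m) = subst₂ ℤ._≤_ (left (y 0) (y 1) (y (suc m))) (right (y 0) (y 1) (squares (y ∘ suc) m))
    (ℤₚ.+-mono-≤ (t≤t² (y 1 ℤ.- y 0)) (rise (y ∘ suc) m))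
  where
    left : ∀ a b e → (b ℤ.- a) ℤ.+ (e ℤ.- b) ≡ e ℤ.- a
    left = solve-∀
    right : ∀ a b e → (b ℤ.- a) ℤ.* (b ℤ.- a) ℤ.+ e ≡ (a ℤ.- b) ℤ.* (a ℤ.- b) ℤ.+ e
    right = solve-∀

valley : ∀ y {k m} → k ℕ.≤ m → (y 0 ℤ.- y k) ℤ.+ (y m ℤ.- y k) ℤ.≤ squares y m
valley y {zero} {m} _ = subst (ℤ._≤ squares y m) (identity (y 0) (y m)) (rise y m)
  where
    identity : ∀ a b → b ℤ.- a ≡ (a ℤ.- a) ℤ.+ (b ℤ.- a)
    identity = solve-∀
valley y {suc k} {suc m} (s≤s k≤m) = subst (ℤ._≤ squares y (suc m)) (identity (y 0) (y 1) (y (suc k)) (y (suc m)))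
    (ℤₚ.+-mono-≤ (t≤t² (y 0 ℤ.- y 1)) (valley (y ∘ suc) k≤m))
  where
    identity : ∀ a b e f → (a ℤ.- b) ℤ.+ ((b ℤ.- e) ℤ.+ (f ℤ.- e)) ≡ (a ℤ.- e) ℤ.+ (f ℤ.- e)
    identity = solve-∀

peak-valley : ∀ y {j k m} → j ℕ.≤ k → k ℕ.≤ m →
              (y j ℤ.- y 0) ℤ.+ ((y j ℤ.- y k) ℤ.+ (y m ℤ.- y k)) ℤ.≤ squares y m
peak-valley y {zero} {k} {m} _ k≤m = subst (ℤ._≤ squares y m) (identity (y 0) ((y 0 ℤ.- y k) ℤ.+ (y m ℤ.- y k))) (valley y k≤m)
  where
    identity : ∀ a b → b ≡ (a ℤ.- a) ℤ.+ b
    identity = solve-∀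
peak-valley y {suc j} {suc k} {suc m} (s≤s j≤k) (s≤s k≤m) =
    subst₂ ℤ._≤_ (left (y 0) (y 1) (y (suc j)) ((y (suc j) ℤ.- y (suc k)) ℤ.+ (y (suc m) ℤ.- y (suc k))))
      (right (y 0) (y 1) (squares (y ∘ suc) m))
      (ℤₚ.+-mono-≤ (t≤t² (y 1 ℤ.- y 0)) (peak-valley (y ∘ suc) j≤k k≤m))
  where
    left : ∀ a b e r → (b ℤ.- a) ℤ.+ ((e ℤ.- b) ℤ.+ r) ≡ (e ℤ.- a) ℤ.+ r
    left = solve-∀
    right : ∀ a b e → (b ℤ.- a) ℤ.* (b ℤ.- a) ℤ.+ e ≡ (a ℤ.- b) ℤ.* (a ℤ.- b) ℤ.+ e
    right = solve-∀

squares-neg : ∀ y m → squares (ℤ.-_ ∘ y) m ≡ squares y m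
squares-neg y m = sum-cong-≗ {m} λ k → identity (y (toℕ k)) (y (suc (toℕ k)))
  where
    identity : ∀ a b → (ℤ.- a ℤ.- ℤ.- b) ℤ.* (ℤ.- a ℤ.- ℤ.- b) ≡ (a ℤ.- b) ℤ.* (a ℤ.- b)
    identity = solve-∀

-- On a closed path the legs before the peak and after the valley add up to a second copy of
-- `y j - y k`: there are two ways around from j to k.
oscillation : ∀ y {m j k} → y m ≡ y 0 → j ℕ.≤ m → k ℕ.≤ m → (y j ℤ.- y k) ℤ.+ (y j ℤ.- y k) ℤ.≤ squares y m
oscillation y {m} {j} {k} closed j≤m k≤m with ℕₚ.≤-total j k
... | inj₁ j≤k = subst (ℤ._≤ squares y m) (trans (cong (λ t → (y j ℤ.- y 0) ℤ.+ ((y j ℤ.- y k) ℤ.+ (t ℤ.- y k))) closed)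
      (identity (y 0) (y j) (y k))) (peak-valley y j≤k k≤m)
  where
    identity : ∀ a b e → (b ℤ.- a) ℤ.+ ((b ℤ.- e) ℤ.+ (a ℤ.- e)) ≡ (b ℤ.- e) ℤ.+ (b ℤ.- e)
    identity = solve-∀
-- If the valley comes first, negation exchanges peak and valley and keeps the energy.
... | inj₂ k≤j = subst₂ ℤ._≤_ (trans (cong (λ t → (ℤ.- y k ℤ.- ℤ.- y 0) ℤ.+ ((ℤ.- y k ℤ.- ℤ.- y j) ℤ.+ (ℤ.- t ℤ.- ℤ.- y j))) closed)
      (identity (y 0) (y j) (y k))) (squares-neg y m) (peak-valley (ℤ.-_ ∘ y) k≤j j≤m)
  where
    identity : ∀ a b e → (ℤ.- e ℤ.- ℤ.- a) ℤ.+ ((ℤ.- e ℤ.- ℤ.- b) ℤ.+ (ℤ.- a ℤ.- ℤ.- b)) ≡ (b ℤ.- e) ℤ.+ (b ℤ.- e)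
    identity = solve-∀

-- Discrete Green's identity: the left side pairs y with its second difference, the expression in
-- `form-αʳ`. On a closed path the two boundary terms cancel.
summation-by-parts : ∀ y m →
  sum {m} (λ k → (+ 2 ℤ.* y (suc (toℕ k)) ℤ.- y (suc (suc (toℕ k))) ℤ.- y (toℕ k)) ℤ.* y (suc (toℕ k)))
    ≡ squares y m ℤ.+ (y m ℤ.* (y m ℤ.- y (suc m)) ℤ.- y 0 ℤ.* (y 0 ℤ.- y 1))
summation-by-parts y zero    = sym (trans (ℤₚ.+-identityˡ _) (ℤₚ.+-inverseʳ (y 0 ℤ.* (y 0 ℤ.- y 1))))
summation-by-parts y (suc m) = trans
    (cong (λ t → (+ 2 ℤ.* y 1 ℤ.- y 2 ℤ.- y 0) ℤ.* y 1 ℤ.+ t) (summation-by-parts (y ∘ suc) m))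
    (identity (y 0) (y 1) (y 2) (squares (y ∘ suc) m) (y (suc m) ℤ.* (y (suc m) ℤ.- y (suc (suc m)))))
  where
    identity : ∀ a b e q r → (+ 2 ℤ.* b ℤ.- e ℤ.- a) ℤ.* b ℤ.+ (q ℤ.+ (r ℤ.- b ℤ.* (b ℤ.- e)))
                           ≡ ((a ℤ.- b) ℤ.* (a ℤ.- b) ℤ.+ q) ℤ.+ (r ℤ.- a ℤ.* (a ℤ.- b))
    identity = solve-∀

-- Walks around the cycle, the norm as an energy, and signs of roots.

module Roots (n : ℕ) (3≤n : 3 ℕ.≤ n) where
  open Affine n 3≤n

  succ pred : Fin n → Fin n
  succ i = proj₁ (next i)
  pred i = proj₁ (previous i)

  pred-succ : ∀ i → pred (succ i) ≡ i
  pred-succ i = Next-injective (proj₂ (previous (succ i))) (proj₂ (next i))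

  succ-pred : ∀ i → succ (pred i) ≡ i
  succ-pred i = Next-functional (proj₂ (next (pred i))) (proj₂ (previous i))

  walk : Fin n → ℕ → Fin n
  walk i zero    = i
  walk i (suc k) = succ (walk i k)

  walk-succ : ∀ i k → walk (succ i) k ≡ walk i (suc k)
  walk-succ i zero    = refl
  walk-succ i (suc k) = cong succ (walk-succ i k)

  -- Within n steps the walk wraps around at most once, since a second wrap would need `toℕ i + k`
  -- to reach `n + n`. So arithmetic modulo n reduces to two explicit equations.
  toℕ-walk : ∀ i k → k ℕ.≤ n → toℕ (walk i k) ≡ toℕ i ℕ.+ k ⊎ toℕ (walk i k) ℕ.+ n ≡ toℕ i ℕ.+ k
  toℕ-walk i zero    _   = inj₁ (sym (ℕₚ.+-identityʳ (toℕ i)))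
  toℕ-walk i (suc k) k<n with toℕ-walk i k (ℕₚ.<⇒≤ k<n) | proj₂ (next (walk i k))
  ... | inj₁ p | inj₁ q       = inj₁ (trans q (trans (cong suc p) (sym (ℕₚ.+-suc (toℕ i) k))))
  ... | inj₁ p | inj₂ (q , r) = inj₂ (trans (cong (ℕ._+ n) r) (trans (sym q) (trans (cong suc p) (sym (ℕₚ.+-suc (toℕ i) k)))))
  ... | inj₂ p | inj₁ q       = inj₂ (trans (cong (ℕ._+ n) q) (trans (cong suc p) (sym (ℕₚ.+-suc (toℕ i) k))))
  ... | inj₂ p | inj₂ (q , _) = contradiction
    (trans (cong (ℕ._+ n) (sym q)) (trans (cong suc p) (sym (ℕₚ.+-suc (toℕ i) k))))
    (ℕₚ.<⇒≢ (ℕₚ.+-mono-<-≤ (Finₚ.toℕ<n i) k<n) ∘ sym)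

  walk-closed : ∀ i → walk i n ≡ i
  walk-closed i with toℕ-walk i n ℕₚ.≤-refl
  ... | inj₁ p = contradiction (subst (ℕ._< n) p (Finₚ.toℕ<n (walk i n))) (ℕₚ.≤⇒≯ (ℕₚ.m≤n+m n (toℕ i)))
  ... | inj₂ p = Finₚ.toℕ-injective (ℕₚ.+-cancelʳ-≡ n _ _ p)

  origin : Fin n
  origin = fromℕ< 0<n

  walk-origin : ∀ i → walk origin (toℕ i) ≡ i
  walk-origin i with toℕ-walk origin (toℕ i) (ℕₚ.<⇒≤ (Finₚ.toℕ<n i))
  ... | inj₁ p = Finₚ.toℕ-injective (trans p (cong (ℕ._+ toℕ i) (Finₚ.toℕ-fromℕ< 0<n)))
  ... | inj₂ p = contradiction (subst (n ℕ.≤_) (trans p (cong (ℕ._+ toℕ i) (Finₚ.toℕ-fromℕ< 0<n))) (ℕₚ.m≤n+m n _))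
    (ℕₚ.<⇒≱ (Finₚ.toℕ<n i))

  -- One step before vertex 0, so that vertex i is met at time `suc (toℕ i)` and its predecessor
  -- also has a time on the walk.
  start : Fin n
  start = pred origin

  walk-start : ∀ i → walk start (suc (toℕ i)) ≡ i
  walk-start i = trans (sym (walk-succ start (toℕ i))) (trans (cong (λ t → walk t (toℕ i)) (succ-pred origin)) (walk-origin i))

  δ-eq : ∀ {i j : Fin n} → i ≡ j → δ i j ≡ 1ℤ
  δ-eq {i} {j} p = cong (λ b → if b then 1ℤ else 0ℤ) (dec-true (i Fin.≟ j) p)

  δ-ne : ∀ {i j : Fin n} → i ≢ j → δ i j ≡ 0ℤ
  δ-ne {i} {j} p = cong (λ b → if b then 1ℤ else 0ℤ) (dec-false (i Fin.≟ j) p)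

  cartan-column : ∀ k i → cartan i k ≡ δ k i ℤ.* + 2 ℤ.+ (δ (succ k) i ℤ.* -1ℤ ℤ.+ δ (pred k) i ℤ.* -1ℤ)
  cartan-column k i = cases (k Fin.≟ i) (succ k Fin.≟ i) (pred k Fin.≟ i)
    where
      next-k : Next k (succ k)
      next-k = proj₂ (next k)
      previous-k : Next (pred k) k
      previous-k = proj₂ (previous k)
      combine : ∀ {p q r v w x y z} → p ≡ w → q ≡ x → r ≡ y → v ≡ z → z ≡ w ℤ.* + 2 ℤ.+ (x ℤ.* -1ℤ ℤ.+ y ℤ.* -1ℤ) →
                v ≡ p ℤ.* + 2 ℤ.+ (q ℤ.* -1ℤ ℤ.+ r ℤ.* -1ℤ)
      combine refl refl refl refl e = e
      cases : Dec (k ≡ i) → Dec (succ k ≡ i) → Dec (pred k ≡ i) → _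
      cases (yes refl) _ _ = combine (δ-eq {k} {k} refl) (δ-ne λ p → Next-irrefl (subst (Next k) p next-k))
        (δ-ne λ p → Next-irrefl (subst (λ t → Next t k) p previous-k)) (cartan-refl k) refl
      cases (no ne) (yes refl) _ = combine (δ-ne ne) (δ-eq {i} {i} refl)
        (δ-ne λ q → Next-asym next-k (subst (λ t → Next t k) q previous-k)) (cartan-adjacent (ne ∘ sym) (inj₂ next-k)) refl
      cases (no ne) (no ¬p) (yes refl) = combine (δ-ne ne) (δ-ne ¬p) (δ-eq {i} {i} refl)
        (cartan-adjacent (ne ∘ sym) (inj₁ previous-k)) refl
      cases (no ne) (no ¬p) (no ¬q) = combine (δ-ne ne) (δ-ne ¬p) (δ-ne ¬q) (cartan-far (ne ∘ sym)
        λ { (inj₁ q) → ¬q (Next-injective previous-k q) ; (inj₂ p) → ¬p (Next-functional next-k p) }) refl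

  form-αʳ-sum : ∀ x k → ⟨ x , α k ⟩ ≡ sum (λ i → lookup x i ℤ.* cartan i k)
  form-αʳ-sum x k = sum-cong-≗ λ i → trans
    (sum-cong-≗ λ j → trans (cong (lookup x i ℤ.* cartan i j ℤ.*_) (lookup-α k j)) (ℤₚ.*-comm _ (δ k j)))
    (sum-δ k (λ j → lookup x i ℤ.* cartan i j))

  form-αʳ : ∀ x k → ⟨ x , α k ⟩ ≡ + 2 ℤ.* lookup x k ℤ.- lookup x (succ k) ℤ.- lookup x (pred k)
  form-αʳ x k = begin
      ⟨ x , α k ⟩ ≡⟨ form-αʳ-sum x k ⟩
      sum (λ i → lookup x i ℤ.* cartan i k)
        ≡⟨ sum-cong-≗ (λ i → trans (cong (lookup x i ℤ.*_) (cartan-column k i))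
             (identity₁ (lookup x i) (δ k i) (δ (succ k) i) (δ (pred k) i))) ⟩
      sum (λ i → δ k i ℤ.* (+ 2 ℤ.* lookup x i) ℤ.+ (δ (succ k) i ℤ.* (ℤ.- lookup x i) ℤ.+ δ (pred k) i ℤ.* (ℤ.- lookup x i)))
        ≡⟨ ∑-distrib-+ (λ i → δ k i ℤ.* (+ 2 ℤ.* lookup x i)) _ ⟩
      sum (λ i → δ k i ℤ.* (+ 2 ℤ.* lookup x i)) ℤ.+ sum (λ i → δ (succ k) i ℤ.* (ℤ.- lookup x i) ℤ.+ δ (pred k) i ℤ.* (ℤ.- lookup x i))
        ≡⟨ cong₂ ℤ._+_ (sum-δ k _) (trans (∑-distrib-+ (λ i → δ (succ k) i ℤ.* (ℤ.- lookup x i)) _)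
             (cong₂ ℤ._+_ (sum-δ (succ k) _) (sum-δ (pred k) _))) ⟩
      + 2 ℤ.* lookup x k ℤ.+ (ℤ.- lookup x (succ k) ℤ.+ ℤ.- lookup x (pred k))
        ≡⟨ sym (ℤₚ.+-assoc (+ 2 ℤ.* lookup x k) _ _) ⟩
      + 2 ℤ.* lookup x k ℤ.- lookup x (succ k) ℤ.- lookup x (pred k) ∎
    where
      open ≡-Reasoning
      identity₁ : ∀ a p q r → a ℤ.* (p ℤ.* + 2 ℤ.+ (q ℤ.* -1ℤ ℤ.+ r ℤ.* -1ℤ)) ≡
                  p ℤ.* (+ 2 ℤ.* a) ℤ.+ (q ℤ.* (ℤ.- a) ℤ.+ r ℤ.* (ℤ.- a))
      identity₁ = solve-∀

  form-expand : ∀ x y → ⟨ x , y ⟩ ≡ sum (λ k → ⟨ x , α k ⟩ ℤ.* lookup y k)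
  form-expand x y = trans (∑-comm (λ i j → lookup x i ℤ.* cartan i j ℤ.* lookup y j))
    (sum-cong-≗ λ j → trans (sym (*-distribʳ-sum (lookup y j) (λ i → lookup x i ℤ.* cartan i j)))
      (cong (ℤ._* lookup y j) (sym (form-αʳ-sum x j))))

  norm-squares : ∀ x → ⟨ x , x ⟩ ≡ squares (lookup x ∘ walk start) n
  norm-squares x = begin
      ⟨ x , x ⟩ ≡⟨ form-expand x x ⟩
      sum (λ k → ⟨ x , α k ⟩ ℤ.* lookup x k) ≡⟨ sum-cong-≗ term ⟩
      sum {n} (λ k → (+ 2 ℤ.* y (suc (toℕ k)) ℤ.- y (suc (suc (toℕ k))) ℤ.- y (toℕ k)) ℤ.* y (suc (toℕ k)))
        ≡⟨ summation-by-parts y n ⟩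
      squares y n ℤ.+ (y n ℤ.* (y n ℤ.- y (suc n)) ℤ.- y 0 ℤ.* (y 0 ℤ.- y 1))
        ≡⟨ cong (λ t → squares y n ℤ.+ (lookup x t ℤ.* (lookup x t ℤ.- lookup x (succ t)) ℤ.- y 0 ℤ.* (y 0 ℤ.- y 1))) (walk-closed start) ⟩
      squares y n ℤ.+ (y 0 ℤ.* (y 0 ℤ.- y 1) ℤ.- y 0 ℤ.* (y 0 ℤ.- y 1))
        ≡⟨ cong (λ t → squares y n ℤ.+ t) (ℤₚ.+-inverseʳ (y 0 ℤ.* (y 0 ℤ.- y 1))) ⟩
      squares y n ℤ.+ 0ℤ ≡⟨ ℤₚ.+-identityʳ _ ⟩
      squares y n ∎
    where
      open ≡-Reasoning
      y : ℕ → ℤ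
      y = lookup x ∘ walk start
      term : ∀ k → ⟨ x , α k ⟩ ℤ.* lookup x k ≡
             (+ 2 ℤ.* y (suc (toℕ k)) ℤ.- y (suc (suc (toℕ k))) ℤ.- y (toℕ k)) ℤ.* y (suc (toℕ k))
      term k = trans (cong (λ t → ⟨ x , α t ⟩ ℤ.* lookup x t) (sym (walk-start k)))
        (cong (ℤ._* y (suc (toℕ k))) (trans (form-αʳ x (walk start (suc (toℕ k))))
          (cong (λ t → + 2 ℤ.* y (suc (toℕ k)) ℤ.- y (suc (suc (toℕ k))) ℤ.- lookup x t) (pred-succ (walk start (toℕ k))))))

  coordinate-gap : ∀ x i j → (lookup x i ℤ.- lookup x j) ℤ.+ (lookup x i ℤ.- lookup x j) ℤ.≤ ⟨ x , x ⟩
  coordinate-gap x i j = subst₂ ℤ._≤_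
      (cong₂ (λ s t → (lookup x s ℤ.- lookup x t) ℤ.+ (lookup x s ℤ.- lookup x t)) (walk-start i) (walk-start j))
      (sym (norm-squares x))
      (oscillation (lookup x ∘ walk start) {n} {suc (toℕ i)} {suc (toℕ j)} (cong (lookup x) (walk-closed start)) (Finₚ.toℕ<n i) (Finₚ.toℕ<n j))

  -- The norm is the only property of real roots that is kept: it is invariant under words and
  -- already forces a sign.
  Root : Q → Set
  Root x = ⟨ x , x ⟩ ≡ + 2

  record Pos (x : Q) : Set where
    constructor mkPos
    field 0≤ : ∀ i → 0ℤ ℤ.≤ lookup x i
  open Pos public

  record Neg (x : Q) : Set where
    constructor mkNeg
    field ≤0 : ∀ i → lookup x i ℤ.≤ 0ℤ
  open Neg public

  -- Between a positive and a negative coordinate x changes by at least 2 along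
  -- each of the two paths around the cycle, so its norm is at least 4.
  sign : ∀ x → Root x → Pos x ⊎ Neg x
  sign x root with Finₚ.all? (λ i → 0ℤ ℤ.≤? lookup x i) | Finₚ.all? (λ i → lookup x i ℤ.≤? 0ℤ)
  ... | yes p | _     = inj₁ (mkPos p)
  ... | no _  | yes q = inj₂ (mkNeg q)
  ... | no ¬p | no ¬q = contradiction (ℤₚ.≤-trans (ℤₚ.+-mono-≤ gap gap)
          (ℤₚ.≤-trans (coordinate-gap x j i) (ℤₚ.≤-reflexive root))) λ { (ℤ.+≤+ (s≤s (s≤s ()))) }
    where
      below-0 : ∃ λ i → ¬ 0ℤ ℤ.≤ lookup x i
      below-0 = Finₚ.¬∀⟶∃¬ n (λ i → 0ℤ ℤ.≤ lookup x i) (λ i → 0ℤ ℤ.≤? lookup x i) ¬p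
      above-0 : ∃ λ j → ¬ lookup x j ℤ.≤ 0ℤ
      above-0 = Finₚ.¬∀⟶∃¬ n (λ j → lookup x j ℤ.≤ 0ℤ) (λ i → lookup x i ℤ.≤? 0ℤ) ¬q
      i j : Fin n
      i = proj₁ below-0
      j = proj₁ above-0
      gap : + 2 ℤ.≤ lookup x j ℤ.- lookup x i
      gap = ℤₚ.+-mono-≤ {1ℤ} {lookup x j} {1ℤ} (ℤₚ.i<j⇒suc[i]≤j (ℤₚ.≰⇒> (proj₂ above-0)))
        (ℤₚ.neg-mono-≤ {lookup x i} { -1ℤ} (ℤₚ.i<j⇒i≤pred[j] (ℤₚ.≰⇒> (proj₂ below-0))))

  Root-α : ∀ i → Root (α i)
  Root-α i = trans (form-α i i) (cartan-refl i)

  Pos-α : ∀ i → Pos (α i)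
  Pos-α i = mkPos λ k → cases k (i Fin.≟ k)
    where
      cases : ∀ k → Dec (i ≡ k) → 0ℤ ℤ.≤ lookup (α i) k
      cases k (yes refl) = subst (0ℤ ℤ.≤_) (sym (lookup-α-same i)) (ℤ.+≤+ z≤n)
      cases k (no ne)    = subst (0ℤ ℤ.≤_) (sym (lookup-α-other ne)) ℤₚ.≤-refl

  form-0ˡ : ∀ x y → (∀ i → lookup x i ≡ 0ℤ) → ⟨ x , y ⟩ ≡ 0ℤ
  form-0ˡ x y zeros = trans (cong (λ t → ⟨ t , y ⟩) eq) (trans (form-•ˡ 0ℤ x y) (ℤₚ.*-zeroˡ ⟨ x , y ⟩))
    where
      eq : x ≡ 0ℤ • x
      eq = ext λ i → trans (zeros i) (sym (trans (lookup-• 0ℤ x i) (ℤₚ.*-zeroˡ (lookup x i))))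

  ¬PosNeg : ∀ x → Root x → Pos x → ¬ Neg x
  ¬PosNeg x root p q = absurd (trans (sym root) (form-0ˡ x x λ i → ℤₚ.≤-antisym (≤0 q i) (0≤ p i)))
    where
      absurd : ¬ + 2 ≡ 0ℤ
      absurd ()

  form-reflect : ∀ β → Root β → ∀ x y → ⟨ reflect β x , reflect β y ⟩ ≡ ⟨ x , y ⟩
  form-reflect β root x y = begin
      ⟨ reflect β x , reflect β y ⟩ ≡⟨ form-reflectˡ β x (reflect β y) ⟩
      ⟨ x , reflect β y ⟩ ℤ.- ⟨ x , β ⟩ ℤ.* ⟨ β , reflect β y ⟩
        ≡⟨ cong₂ (λ s t → s ℤ.- ⟨ x , β ⟩ ℤ.* t) (form-reflectʳ β y x) (trans (form-reflectʳ β y β)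
             (cong₂ (λ s t → s ℤ.- ⟨ y , β ⟩ ℤ.* t) (form-sym β y) root)) ⟩
      ⟨ x , y ⟩ ℤ.- ⟨ y , β ⟩ ℤ.* ⟨ x , β ⟩ ℤ.- ⟨ x , β ⟩ ℤ.* (⟨ y , β ⟩ ℤ.- ⟨ y , β ⟩ ℤ.* + 2)
        ≡⟨ identity ⟨ x , y ⟩ ⟨ x , β ⟩ ⟨ y , β ⟩ ⟩
      ⟨ x , y ⟩ ∎
    where
      open ≡-Reasoning
      identity : ∀ a p q → a ℤ.- q ℤ.* p ℤ.- p ℤ.* (q ℤ.- q ℤ.* + 2) ≡ a
      identity = solve-∀

  reflect-involutive : ∀ β → Root β → ∀ x → reflect β (reflect β x) ≡ x
  reflect-involutive β root x = ext λ i → trans (lookup-reflect β (reflect β x) i) (trans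
      (cong₂ (λ s t → s ℤ.- t ℤ.* lookup β i) (lookup-reflect β x i)
        (trans (form-reflectˡ β x β) (cong (λ t → ⟨ x , β ⟩ ℤ.- ⟨ x , β ⟩ ℤ.* t) root)))
      (identity (lookup x i) ⟨ x , β ⟩ (lookup β i)))
    where
      identity : ∀ a p b → a ℤ.- p ℤ.* b ℤ.- (p ℤ.- p ℤ.* + 2) ℤ.* b ≡ a
      identity = solve-∀

  Root-reflect : ∀ β x → Root β → Root x → Root (reflect β x)
  Root-reflect β x b r = trans (form-reflect β b x x) r

  lookup-reflect-α : ∀ {j k} x → j ≢ k → lookup (reflect (α j) x) k ≡ lookup x k
  lookup-reflect-α {j} {k} x ne = trans (lookup-reflect (α j) x k)
    (trans (cong (λ t → lookup x k ℤ.- ⟨ x , α j ⟩ ℤ.* t) (lookup-α-other ne)) (identity (lookup x k) ⟨ x , α j ⟩))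
    where
      identity : ∀ a b → a ℤ.- b ℤ.* 0ℤ ≡ a
      identity = solve-∀

  multiple-of-α : ∀ j x → Root x → (∀ k → j ≢ k → lookup x k ≡ 0ℤ) → 0ℤ ℤ.≤ lookup x j → x ≡ α j
  multiple-of-α j x root zeros 0≤xⱼ = trans eq (trans (cong (_• α j) t≡1) (ext λ k → trans (lookup-• 1ℤ (α j) k) (ℤₚ.*-identityˡ _)))
    where
      t : ℤ
      t = lookup x j
      eq : x ≡ t • α j
      eq = ext λ k → trans (coordinate k (j Fin.≟ k)) (sym (lookup-• t (α j) k))
        where
          coordinate : ∀ k → Dec (j ≡ k) → lookup x k ≡ t ℤ.* lookup (α j) k
          coordinate k (yes refl) = sym (trans (cong (t ℤ.*_) (lookup-α-same j)) (ℤₚ.*-identityʳ t))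
          coordinate k (no ne)    = trans (zeros k ne) (sym (trans (cong (t ℤ.*_) (lookup-α-other ne)) (ℤₚ.*-zeroʳ t)))
      square : t ℤ.* (t ℤ.* + 2) ≡ + 2
      square = trans (sym (trans (form-•ˡ t (α j) (t • α j)) (cong (t ℤ.*_) (trans (form-•ʳ t (α j) (α j)) (cong (t ℤ.*_) (Root-α j))))))
        (trans (cong (λ y → ⟨ y , y ⟩) (sym eq)) root)
      unit : ∀ t → 0ℤ ℤ.≤ t → t ℤ.* (t ℤ.* + 2) ≡ + 2 → t ≡ 1ℤ
      unit (+ 0) _ ()
      unit (+ 1) _ _ = refl
      unit (+ suc (suc m)) _ e = contradiction
        (ℕₚ.≤-trans (ℕₚ.*-mono-≤ {2} {suc (suc m)} {2} {suc (suc m) ℕ.* 2} (s≤s (s≤s z≤n)) (s≤s (s≤s z≤n)))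
          (ℕₚ.≤-reflexive (ℤₚ.+-injective (trans (ℤₚ.pos-* (suc (suc m)) (suc (suc m) ℕ.* 2)) (trans (cong (+ suc (suc m) ℤ.*_) (ℤₚ.pos-* (suc (suc m)) 2)) e)))))
        λ { (s≤s (s≤s ())) }
      t≡1 : t ≡ 1ℤ
      t≡1 = unit t 0≤xⱼ square

  -- The reflection changes coordinate j only. If the result were negative, all other coordinates of
  -- x would be both non-negative and non-positive, leaving a multiple of `α j`.
  Pos-reflect-α : ∀ j x → Root x → Pos x → x ≢ α j → Pos (reflect (α j) x)
  Pos-reflect-α j x root pos ne = cases (sign (reflect (α j) x) (Root-reflect (α j) x (Root-α j) root))
    where
      zeros : Neg (reflect (α j) x) → ∀ k → j ≢ k → lookup x k ≡ 0ℤ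
      zeros neg k j≢k = ℤₚ.≤-antisym (ℤₚ.≤-trans (ℤₚ.≤-reflexive (sym (lookup-reflect-α x j≢k))) (≤0 neg k)) (0≤ pos k)
      cases : Pos (reflect (α j) x) ⊎ Neg (reflect (α j) x) → Pos (reflect (α j) x)
      cases (inj₁ p) = p
      cases (inj₂ q) = contradiction (multiple-of-α j x root (zeros q) (0≤ pos j)) ne

-- Exchange property, length criterion and Hecke products.

module Hecke (n : ℕ) (3≤n : 3 ℕ.≤ n) where
  open Affine n 3≤n
  open Roots n 3≤n

  ⟪_⟫ : List (Fin n) → W
  ⟪ is ⟫ = mkW ⟦ is ⟧ is (λ _ → refl)

  ⟦⟧-form : ∀ is x y → ⟨ ⟦ is ⟧ x , ⟦ is ⟧ y ⟩ ≡ ⟨ x , y ⟩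
  ⟦⟧-form []       x y = refl
  ⟦⟧-form (i ∷ is) x y = trans (form-reflect (α i) (Root-α i) (⟦ is ⟧ x) (⟦ is ⟧ y)) (⟦⟧-form is x y)

  to-form : ∀ u x y → ⟨ to u x , to u y ⟩ ≡ ⟨ x , y ⟩
  to-form u x y = trans (cong₂ ⟨_,_⟩ (to-word u x) (to-word u y)) (⟦⟧-form (expression u) x y)

  to-Root : ∀ u x → Root x → Root (to u x)
  to-Root u x root = trans (to-form u x x) root

  to-⊕ : ∀ u x y → to u (x ⊕ y) ≡ to u x ⊕ to u y
  to-⊕ u x y = trans (to-word u (x ⊕ y)) (trans (⟦⟧-⊕ (expression u) x y) (sym (cong₂ _⊕_ (to-word u x) (to-word u y))))

  to-• : ∀ u k x → to u (k • x) ≡ k • to u x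
  to-• u k x = trans (to-word u (k • x)) (trans (⟦⟧-• (expression u) k x) (cong (k •_) (sym (to-word u x))))

  to-⊝ : ∀ u x → to u (⊝ x) ≡ ⊝ to u x
  to-⊝ u x = trans (cong (to u) (⊝-as-• x)) (trans (to-• u -1ℤ x) (sym (⊝-as-• (to u x))))

  to-⊖ : ∀ u x y → to u (x ⊖ y) ≡ to u x ⊖ to u y
  to-⊖ u x y = trans (cong (to u) (⊖-as-⊕ x y)) (trans (to-⊕ u x (-1ℤ • y))
    (trans (cong (to u x ⊕_) (to-• u -1ℤ y)) (sym (⊖-as-⊕ (to u x) (to u y)))))

  to-reflect : ∀ u γ μ → to u (reflect γ μ) ≡ reflect (to u γ) (to u μ)
  to-reflect u γ μ = trans (to-⊖ u μ (⟨ μ , γ ⟩ • γ)) (cong (to u μ ⊖_)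
    (trans (to-• u ⟨ μ , γ ⟩ γ) (cong (_• to u γ) (sym (to-form u μ γ)))))

  simple-involutive : ∀ i μ → reflect (α i) (reflect (α i) μ) ≡ μ
  simple-involutive i = reflect-involutive (α i) (Root-α i)

  reflect-α-α : ∀ i → reflect (α i) (α i) ≡ ⊝ α i
  reflect-α-α i = ext λ k → trans (lookup-reflect (α i) (α i) k) (trans
      (cong (λ t → lookup (α i) k ℤ.- t ℤ.* lookup (α i) k) (Root-α i))
      (trans (identity (lookup (α i) k)) (sym (lookup-⊝ (α i) k))))
    where
      identity : ∀ a → a ℤ.- + 2 ℤ.* a ≡ ℤ.- a
      identity = solve-∀

  ⊝-involutive : ∀ x → ⊝ (⊝ x) ≡ x
  ⊝-involutive x = ext λ k → trans (lookup-⊝ (⊝ x) k) (trans (cong ℤ.-_ (lookup-⊝ x k)) (ℤₚ.neg-involutive (lookup x k)))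

  Neg-⊝ : ∀ x → Pos x → Neg (⊝ x)
  Neg-⊝ x p = mkNeg λ i → subst (ℤ._≤ 0ℤ) (sym (lookup-⊝ x i)) (ℤₚ.neg-mono-≤ (0≤ p i))

  Neg-reflect-α : ∀ j x → Root x → Neg x → reflect (α j) x ≢ α j → Neg (reflect (α j) x)
  Neg-reflect-α j x root neg ne = cases (sign (reflect (α j) x) root′)
    where
      root′ : Root (reflect (α j) x)
      root′ = Root-reflect (α j) x (Root-α j) root
      cases : Pos (reflect (α j) x) ⊎ Neg (reflect (α j) x) → Neg (reflect (α j) x)
      cases (inj₂ q) = q
      cases (inj₁ p) = contradiction neg (¬PosNeg x root (subst Pos (simple-involutive j x)
        (Pos-reflect-α j (reflect (α j) x) root′ p ne)))

  -- As the letters are applied from the right, `α i` turns negative at some letter j. By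
  -- `Pos-reflect-α` the root just before was `α j`, so s_i conjugated by the letters to the right
  -- of j is s_j, which cancels that letter.
  exchange : ∀ is i → Neg (⟦ is ⟧ (α i)) →
             ∃ λ js → length is ≡ suc (length js) × (∀ μ → ⟦ is ⟧ (reflect (α i) μ) ≡ ⟦ js ⟧ μ)
  exchange [] i neg = contradiction neg (¬PosNeg (α i) (Root-α i) (Pos-α i))
  exchange (j ∷ is) i neg = cases (sign x root)
    where
      x : Q
      x = ⟦ is ⟧ (α i)
      root : Root x
      root = to-Root ⟪ is ⟫ (α i) (Root-α i)
      equal : Dec (x ≡ α j) → Pos x → x ≡ α j
      equal (yes eq) _   = eq
      equal (no ne)  pos = contradiction neg
        (¬PosNeg (reflect (α j) x) (Root-reflect (α j) x (Root-α j) root) (Pos-reflect-α j x root pos ne))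
      cases : Pos x ⊎ Neg x → _
      cases (inj₂ q) = let (js , len , eq) = exchange is i q in j ∷ js , cong suc len , λ μ → cong (reflect (α j)) (eq μ)
      cases (inj₁ p) = is , refl , λ μ → trans (cong (reflect (α j)) (trans (to-reflect ⟪ is ⟫ (α i) μ)
        (cong (λ t → reflect t (⟦ is ⟧ μ)) (equal (x ≟Q α j) p)))) (simple-involutive j (⟦ is ⟧ μ))

  ℓ-≤ : ∀ w is → IsExpression w is → ℓ w ℕ.≤ length is
  ℓ-≤ w is h = proj₂ (proj₂ (minimalLength w)) (length is) (is , h , refl)

  ℓ-mono : ∀ u v → u ≈ v → ℓ u ℕ.≤ ℓ v
  ℓ-mono u v eq = let (is , h , len) = reducedExpression v in
    ℕₚ.≤-trans (ℓ-≤ u is (λ μ → trans (eq μ) (h μ))) (ℕₚ.≤-reflexive len)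

  ℓ-cong : ∀ u v → u ≈ v → ℓ u ≡ ℓ v
  ℓ-cong u v eq = ℕₚ.≤-antisym (ℓ-mono u v eq) (ℓ-mono v u (sym ∘ eq))

  ℓ-ε : ℓ ε ≡ 0
  ℓ-ε = ℕₚ.n≤0⇒n≡0 (ℓ-≤ ε [] (λ _ → refl))

  ℓ-∙⟪⟫ : ∀ u is → ℓ (u ∙ ⟪ is ⟫) ℕ.≤ ℓ u ℕ.+ length is
  ℓ-∙⟪⟫ u is = let (js , h , len) = reducedExpression u in
    ℕₚ.≤-trans (ℓ-≤ (u ∙ ⟪ is ⟫) (js ++ is) (λ μ → trans (h (⟦ is ⟧ μ)) (sym (⟦⟧-++ js is μ))))
      (ℕₚ.≤-reflexive (trans (Listₚ.length-++ js) (cong (ℕ._+ length is) len)))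

  ℓ-Neg : ∀ u i → Neg (to u (α i)) → ℓ (u ∙ simple i) ℕ.< ℓ u
  ℓ-Neg u i neg = ℕₚ.≤-trans (s≤s (ℓ-≤ (u ∙ simple i) js λ μ → trans (h (reflect (α i) μ)) (eq μ)))
      (ℕₚ.≤-reflexive (trans (sym len) len-is))
    where
      is = proj₁ (reducedExpression u)
      h = proj₁ (proj₂ (reducedExpression u))
      len-is = proj₂ (proj₂ (reducedExpression u))
      shorter = exchange is i (subst Neg (h (α i)) neg)
      js = proj₁ shorter
      len = proj₁ (proj₂ shorter)
      eq = proj₂ (proj₂ shorter)

  -- `u ∙ simple i` sends `α i` to a negative root, so `ℓ-Neg` applies to it; multiplying by s_i
  -- once more gives back u.
  ℓ-Pos : ∀ u i → Pos (to u (α i)) → ℓ (u ∙ simple i) ≡ suc (ℓ u)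
  ℓ-Pos u i pos = ℕₚ.≤-antisym
      (ℕₚ.≤-trans (ℓ-∙⟪⟫ u (i ∷ [])) (ℕₚ.≤-reflexive (ℕₚ.+-comm (ℓ u) 1)))
      (subst (ℕ._< ℓ (u ∙ simple i)) (ℓ-cong (u ∙ simple i ∙ simple i) u (λ μ → cong (to u) (simple-involutive i μ)))
        (ℓ-Neg (u ∙ simple i) i (subst Neg (sym (trans (cong (to u) (reflect-α-α i)) (to-⊝ u (α i)))) (Neg-⊝ (to u (α i)) pos))))

  Root-to-α : ∀ u i → Root (to u (α i))
  Root-to-α u i = to-Root u (α i) (Root-α i)

  signα : ∀ u i → Pos (to u (α i)) ⊎ Neg (to u (α i))
  signα u i = sign (to u (α i)) (Root-to-α u i)

  ⋆-Pos : ∀ u i → Pos (to u (α i)) → u ⋆ i ≡ u ∙ simple i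
  ⋆-Pos u i pos = cong (λ b → if b then u ∙ simple i else u)
    (dec-true (ℓ u ℕ.<? ℓ (u ∙ simple i)) (ℕₚ.≤-reflexive (sym (ℓ-Pos u i pos))))

  ⋆-Neg : ∀ u i → Neg (to u (α i)) → u ⋆ i ≡ u
  ⋆-Neg u i neg = cong (λ b → if b then u ∙ simple i else u)
    (dec-false (ℓ u ℕ.<? ℓ (u ∙ simple i)) (ℕₚ.<⇒≯ (ℓ-Neg u i neg)))

  ≡⇒≈ : ∀ {u v : W} → u ≡ v → u ≈ v
  ≡⇒≈ eq μ = cong (λ w → to w μ) eq

  ⋆-cong : ∀ u v i → u ≈ v → u ⋆ i ≈ v ⋆ i
  ⋆-cong u v i eq μ = cases (signα u i)
    where
      cases : Pos (to u (α i)) ⊎ Neg (to u (α i)) → to (u ⋆ i) μ ≡ to (v ⋆ i) μ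
      cases (inj₁ p) = trans (≡⇒≈ (⋆-Pos u i p) μ) (trans (eq (reflect (α i) μ)) (sym (≡⇒≈ (⋆-Pos v i (subst Pos (eq (α i)) p)) μ)))
      cases (inj₂ p) = trans (≡⇒≈ (⋆-Neg u i p) μ) (trans (eq μ) (sym (≡⇒≈ (⋆-Neg v i (subst Neg (eq (α i)) p)) μ)))

  infixl 7 _★_
  _★_ : W → List (Fin n) → W
  u ★ is = foldl _⋆_ u is

  ★-cong : ∀ u v is → u ≈ v → u ★ is ≈ v ★ is
  ★-cong u v []       eq = eq
  ★-cong u v (i ∷ is) eq = ★-cong (u ⋆ i) (v ⋆ i) is (⋆-cong u v i eq)

  ★-++ : ∀ u is js → u ★ (is ++ js) ≡ u ★ is ★ js
  ★-++ u is js = Listₚ.foldl-++ _⋆_ u is js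

  infix 30 _⁻¹
  _⁻¹ : W → W
  u ⁻¹ = ⟪ reverse (expression u) ⟫

  ⟦⟧-reverse : ∀ is μ → ⟦ reverse is ⟧ (⟦ is ⟧ μ) ≡ μ
  ⟦⟧-reverse []       μ = refl
  ⟦⟧-reverse (i ∷ is) μ = trans (cong (λ t → ⟦ t ⟧ (⟦ i ∷ is ⟧ μ)) (Listₚ.unfold-reverse i is))
    (trans (⟦⟧-++ (reverse is) (i ∷ []) (⟦ i ∷ is ⟧ μ)) (trans (cong ⟦ reverse is ⟧ (simple-involutive i (⟦ is ⟧ μ))) (⟦⟧-reverse is μ)))

  inverseˡ : ∀ u μ → to (u ⁻¹) (to u μ) ≡ μ
  inverseˡ u μ = trans (cong (to (u ⁻¹)) (to-word u μ)) (⟦⟧-reverse (expression u) μ)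

  inverseʳ : ∀ u μ → to u (to (u ⁻¹) μ) ≡ μ
  inverseʳ u μ = trans (to-word u _) (trans
    (cong (λ t → ⟦ t ⟧ (⟦ reverse (expression u) ⟧ μ)) (sym (Listₚ.reverse-involutive (expression u))))
    (⟦⟧-reverse (reverse (expression u)) μ))

  inverse-unique : ∀ u v → (∀ μ → to v (to u μ) ≡ μ) → v ≈ u ⁻¹
  inverse-unique u v h μ = trans (cong (to v) (sym (inverseʳ u μ))) (h (to (u ⁻¹) μ))

  ⁻¹-cong : ∀ u v → u ≈ v → u ⁻¹ ≈ v ⁻¹
  ⁻¹-cong u v eq = inverse-unique v (u ⁻¹) λ μ → trans (cong (to (u ⁻¹)) (sym (eq μ))) (inverseˡ u μ)

  ⁻¹-involutive : ∀ u → u ≈ (u ⁻¹) ⁻¹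
  ⁻¹-involutive u = inverse-unique (u ⁻¹) u (inverseʳ u)

  ⁻¹-∙ : ∀ u v → v ⁻¹ ∙ u ⁻¹ ≈ (u ∙ v) ⁻¹
  ⁻¹-∙ u v = inverse-unique (u ∙ v) (v ⁻¹ ∙ u ⁻¹) λ μ → trans (cong (to (v ⁻¹)) (inverseˡ u (to v μ))) (inverseˡ v μ)

  ⁻¹-∙simple : ∀ u i → simple i ∙ u ⁻¹ ≈ (u ∙ simple i) ⁻¹
  ⁻¹-∙simple u i = ⁻¹-∙ u (simple i)

  simple∙⁻¹ : ∀ u i → u ⁻¹ ∙ simple i ≈ (simple i ∙ u) ⁻¹
  simple∙⁻¹ u i = ⁻¹-∙ (simple i) u

  ℓ-⁻¹-≤ : ∀ u → ℓ (u ⁻¹) ℕ.≤ ℓ u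
  ℓ-⁻¹-≤ u = let (is , h , len) = reducedExpression u in
    ℕₚ.≤-trans (ℓ-≤ (u ⁻¹) (reverse is) (⁻¹-cong u ⟪ is ⟫ h)) (ℕₚ.≤-reflexive (trans (Listₚ.length-reverse is) len))

  ℓ-⁻¹ : ∀ u → ℓ (u ⁻¹) ≡ ℓ u
  ℓ-⁻¹ u = ℕₚ.≤-antisym (ℓ-⁻¹-≤ u)
    (ℕₚ.≤-trans (ℓ-mono u ((u ⁻¹) ⁻¹) (⁻¹-involutive u)) (ℓ-⁻¹-≤ (u ⁻¹)))

  -- Hecke multiplication on the left. Since it commutes with ⋆, the product
  -- u ★ is depends only on u and ε ★ is (★-ext), without Matsumoto's theorem.
  left : Fin n → W → W
  left i u = (u ⁻¹ ⋆ i) ⁻¹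

  left-Pos : ∀ i u → Pos (to (u ⁻¹) (α i)) → left i u ≈ simple i ∙ u
  left-Pos i u pos μ = trans (⁻¹-cong (u ⁻¹ ⋆ i) (u ⁻¹ ∙ simple i) (≡⇒≈ (⋆-Pos (u ⁻¹) i pos)) μ)
    (trans (sym (⁻¹-∙simple (u ⁻¹) i μ)) (cong (reflect (α i)) (sym (⁻¹-involutive u μ))))

  left-Neg : ∀ i u → Neg (to (u ⁻¹) (α i)) → left i u ≈ u
  left-Neg i u neg μ = trans (⁻¹-cong (u ⁻¹ ⋆ i) (u ⁻¹) (≡⇒≈ (⋆-Neg (u ⁻¹) i neg)) μ) (sym (⁻¹-involutive u μ))

  left-cong : ∀ i u v → u ≈ v → left i u ≈ left i v
  left-cong i u v eq = ⁻¹-cong (u ⁻¹ ⋆ i) (v ⁻¹ ⋆ i) (⋆-cong (u ⁻¹) (v ⁻¹) i (⁻¹-cong u v eq))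

  -- The question is whether multiplying on one side changes the sign tested on the other. It does
  -- only if `x ≡ α i`, equivalently `y ≡ α j`; then `u ∙ simple j` and `simple i ∙ u` coincide, and
  -- each side of the equation performs exactly one of the two multiplications. With opposite signs
  -- a change would need x and y to be negatives of simple roots simultaneously, which contradicts
  -- the signs.
  left-⋆ : ∀ i u j → left i (u ⋆ j) ≈ left i u ⋆ j
  left-⋆ i u j = cases (signα u j) (signα (u ⁻¹) i) (to u (α j) ≟Q α i)
    where
      x y : Q
      x = to u (α j)
      y = to (u ⁻¹) (α i)

      y⇒x : ∀ β → y ≡ β → to u β ≡ α i
      y⇒x β eq = trans (cong (to u) (sym eq)) (inverseʳ u (α i))

      y⁻ : y ≡ ⊝ α j → x ≡ ⊝ α i
      y⁻ eq = trans (sym (⊝-involutive x)) (cong ⊝_ (trans (sym (to-⊝ u (α j))) (y⇒x (⊝ α j) eq)))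

      reflect-y : to ((u ∙ simple j) ⁻¹) (α i) ≡ reflect (α j) y
      reflect-y = sym (⁻¹-∙simple u j (α i))

      cases : Pos x ⊎ Neg x → Pos y ⊎ Neg y → Dec (x ≡ α i) → left i (u ⋆ j) ≈ left i u ⋆ j
      cases (inj₁ px) (inj₁ py) (yes eq) μ = begin
          to (left i (u ⋆ j)) μ ≡⟨ left-cong i (u ⋆ j) (u ∙ simple j) (≡⇒≈ (⋆-Pos u j px)) μ ⟩
          to (left i (u ∙ simple j)) μ ≡⟨ left-Neg i (u ∙ simple j) neg μ ⟩
          to u (reflect (α j) μ) ≡⟨ to-reflect u (α j) μ ⟩
          reflect x (to u μ) ≡⟨ cong (λ t → reflect t (to u μ)) eq ⟩
          reflect (α i) (to u μ) ≡⟨ sym (≡⇒≈ (⋆-Neg (simple i ∙ u) j neg′) μ) ⟩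
          to ((simple i ∙ u) ⋆ j) μ ≡⟨ sym (⋆-cong (left i u) (simple i ∙ u) j (left-Pos i u py) μ) ⟩
          to (left i u ⋆ j) μ ∎
        where
          open ≡-Reasoning
          y≡ : y ≡ α j
          y≡ = trans (cong (to (u ⁻¹)) (sym eq)) (inverseˡ u (α j))
          neg : Neg (to ((u ∙ simple j) ⁻¹) (α i))
          neg = subst Neg (sym (trans reflect-y (trans (cong (reflect (α j)) y≡) (reflect-α-α j)))) (Neg-⊝ (α j) (Pos-α j))
          neg′ : Neg (to (simple i ∙ u) (α j))
          neg′ = subst Neg (sym (trans (cong (reflect (α i)) eq) (reflect-α-α i))) (Neg-⊝ (α i) (Pos-α i))
      cases (inj₁ px) (inj₁ py) (no ne) μ = begin
          to (left i (u ⋆ j)) μ ≡⟨ left-cong i (u ⋆ j) (u ∙ simple j) (≡⇒≈ (⋆-Pos u j px)) μ ⟩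
          to (left i (u ∙ simple j)) μ ≡⟨ left-Pos i (u ∙ simple j) pos μ ⟩
          reflect (α i) (to u (reflect (α j) μ)) ≡⟨ sym (≡⇒≈ (⋆-Pos (simple i ∙ u) j pos′) μ) ⟩
          to ((simple i ∙ u) ⋆ j) μ ≡⟨ sym (⋆-cong (left i u) (simple i ∙ u) j (left-Pos i u py) μ) ⟩
          to (left i u ⋆ j) μ ∎
        where
          open ≡-Reasoning
          pos : Pos (to ((u ∙ simple j) ⁻¹) (α i))
          pos = subst Pos (sym reflect-y) (Pos-reflect-α j y (Root-to-α (u ⁻¹) i) py λ eq → ne (y⇒x (α j) eq))
          pos′ : Pos (to (simple i ∙ u) (α j))
          pos′ = Pos-reflect-α i x (Root-to-α u j) px ne
      cases (inj₁ px) (inj₂ qy) _ μ = begin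
          to (left i (u ⋆ j)) μ ≡⟨ left-cong i (u ⋆ j) (u ∙ simple j) (≡⇒≈ (⋆-Pos u j px)) μ ⟩
          to (left i (u ∙ simple j)) μ ≡⟨ left-Neg i (u ∙ simple j) neg μ ⟩
          to (u ∙ simple j) μ ≡⟨ sym (≡⇒≈ (⋆-Pos u j px) μ) ⟩
          to (u ⋆ j) μ ≡⟨ sym (⋆-cong (left i u) u j (left-Neg i u qy) μ) ⟩
          to (left i u ⋆ j) μ ∎
        where
          open ≡-Reasoning
          impossible : reflect (α j) y ≢ α j
          impossible eq = ¬PosNeg x (Root-to-α u j) px (subst Neg (sym (y⁻ (trans (sym (simple-involutive j y))
            (trans (cong (reflect (α j)) eq) (reflect-α-α j))))) (Neg-⊝ (α i) (Pos-α i)))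
          neg : Neg (to ((u ∙ simple j) ⁻¹) (α i))
          neg = subst Neg (sym reflect-y) (Neg-reflect-α j y (Root-to-α (u ⁻¹) i) qy impossible)
      cases (inj₂ qx) (inj₁ py) _ μ = begin
          to (left i (u ⋆ j)) μ ≡⟨ left-cong i (u ⋆ j) u (≡⇒≈ (⋆-Neg u j qx)) μ ⟩
          to (left i u) μ ≡⟨ left-Pos i u py μ ⟩
          to (simple i ∙ u) μ ≡⟨ sym (≡⇒≈ (⋆-Neg (simple i ∙ u) j neg) μ) ⟩
          to ((simple i ∙ u) ⋆ j) μ ≡⟨ sym (⋆-cong (left i u) (simple i ∙ u) j (left-Pos i u py) μ) ⟩
          to (left i u ⋆ j) μ ∎
        where
          open ≡-Reasoning
          impossible : reflect (α i) x ≢ α i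
          impossible eq = ¬PosNeg y (Root-to-α (u ⁻¹) i) py (subst Neg (sym y≡) (Neg-⊝ (α j) (Pos-α j)))
            where
              x≡ : x ≡ ⊝ α i
              x≡ = trans (sym (simple-involutive i x)) (trans (cong (reflect (α i)) eq) (reflect-α-α i))
              ⊝-swap : ⊝ x ≡ α i
              ⊝-swap = trans (cong ⊝_ x≡) (⊝-involutive (α i))
              y≡ : y ≡ ⊝ α j
              y≡ = trans (cong (to (u ⁻¹)) (sym ⊝-swap)) (trans (to-⊝ (u ⁻¹) x) (cong ⊝_ (inverseˡ u (α j))))
          neg : Neg (to (simple i ∙ u) (α j))
          neg = Neg-reflect-α i x (Root-to-α u j) qx impossible
      cases (inj₂ qx) (inj₂ qy) _ μ = trans (left-cong i (u ⋆ j) u (≡⇒≈ (⋆-Neg u j qx)) μ)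
        (trans (left-Neg i u qy μ) (sym (trans (⋆-cong (left i u) u j (left-Neg i u qy) μ) (≡⇒≈ (⋆-Neg u j qx) μ))))

  left-★ : ∀ i u js → left i (u ★ js) ≈ left i u ★ js
  left-★ i u []       μ = refl
  left-★ i u (j ∷ js) μ = trans (left-★ i (u ⋆ j) js μ) (★-cong (left i (u ⋆ j)) (left i u ⋆ j) js (left-⋆ i u j) μ)

  first-letter : ∀ i u is → ε ★ is ≈ u → ε ★ (i ∷ is) ≈ left i u
  first-letter i u is eq μ = trans (★-cong (ε ⋆ i) (left i ε) is first μ)
      (trans (sym (left-★ i ε is μ)) (left-cong i (ε ★ is) u eq μ))
    where
      first : ε ⋆ i ≈ left i ε
      first ν = trans (≡⇒≈ (⋆-Pos ε i (Pos-α i)) ν) (sym (left-Pos i ε (Pos-α i) ν))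

  lefts : List (Fin n) → W → W
  lefts is u = foldr left u is

  lefts-cong : ∀ is u v → u ≈ v → lefts is u ≈ lefts is v
  lefts-cong []       u v eq = eq
  lefts-cong (i ∷ is) u v eq = left-cong i (lefts is u) (lefts is v) (lefts-cong is u v eq)

  lefts-★ : ∀ is u js → lefts is (u ★ js) ≈ lefts is u ★ js
  lefts-★ []       u js μ = refl
  lefts-★ (i ∷ is) u js μ = trans (left-cong i (lefts is (u ★ js)) (lefts is u ★ js) (lefts-★ is u js) μ) (left-★ i (lefts is u) js μ)

  -- A letter that fails to lengthen would make the element shorter than its word. So every Hecke
  -- multiplication by a letter of a reduced word is an ordinary one.
  lefts-reduced : ∀ is → length is ℕ.≤ ℓ ⟪ is ⟫ → ⟪ is ⟫ ≈ lefts is ε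
  lefts-reduced []       _ μ = refl
  lefts-reduced (i ∷ is) reduced μ = cases (signα (⟪ is ⟫ ⁻¹) i)
    where
      ℓ-eq : ℓ ⟪ i ∷ is ⟫ ≡ ℓ (⟪ is ⟫ ⁻¹ ∙ simple i)
      ℓ-eq = trans (sym (ℓ-⁻¹ ⟪ i ∷ is ⟫)) (ℓ-cong (⟪ i ∷ is ⟫ ⁻¹) (⟪ is ⟫ ⁻¹ ∙ simple i) (λ ν → trans (⁻¹-cong ⟪ i ∷ is ⟫ (simple i ∙ ⟪ is ⟫) (λ _ → refl) ν) (sym (simple∙⁻¹ ⟪ is ⟫ i ν))))
      cases : Pos (to (⟪ is ⟫ ⁻¹) (α i)) ⊎ Neg (to (⟪ is ⟫ ⁻¹) (α i)) → ⟦ i ∷ is ⟧ μ ≡ to (left i (lefts is ε)) μ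
      cases (inj₂ q) = contradiction (ℕₚ.≤-trans (ℕₚ.≤-trans reduced (ℕₚ.≤-reflexive ℓ-eq)) (ℕₚ.<⇒≤ (ℓ-Neg (⟪ is ⟫ ⁻¹) i q)))
        (ℕₚ.<⇒≱ (s≤s (ℕₚ.≤-trans (ℓ-⁻¹-≤ ⟪ is ⟫) (ℓ-≤ ⟪ is ⟫ is (λ _ → refl)))))
      cases (inj₁ p) = trans (sym (left-Pos i ⟪ is ⟫ p μ)) (left-cong i ⟪ is ⟫ (lefts is ε) (lefts-reduced is
        (ℕₚ.≤-pred (ℕₚ.≤-trans reduced (ℕₚ.≤-reflexive (trans ℓ-eq (trans (ℓ-Pos (⟪ is ⟫ ⁻¹) i p) (cong suc (ℓ-⁻¹ ⟪ is ⟫)))))))) μ)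

  ★-ext : ∀ is js → ε ★ is ≈ ε ★ js → ∀ u → u ★ is ≈ u ★ js
  ★-ext is js eq u μ = let (ws , h , len) = reducedExpression u in
    let u≈ : u ≈ lefts ws ε
        u≈ = λ ν → trans (h ν) (lefts-reduced ws (ℕₚ.≤-reflexive (trans len (ℓ-cong u ⟪ ws ⟫ h))) ν)
    in begin
      to (u ★ is) μ ≡⟨ ★-cong u (lefts ws ε) is u≈ μ ⟩
      to (lefts ws ε ★ is) μ ≡⟨ sym (lefts-★ ws ε is μ) ⟩
      to (lefts ws (ε ★ is)) μ ≡⟨ lefts-cong ws (ε ★ is) (ε ★ js) eq μ ⟩
      to (lefts ws (ε ★ js)) μ ≡⟨ lefts-★ ws ε js μ ⟩
      to (lefts ws ε ★ js) μ ≡⟨ sym (★-cong u (lefts ws ε) js u≈ μ) ⟩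
      to (u ★ js) μ ∎
    where open ≡-Reasoning

  -- Every letter lengthens; for `u = ε` these are the reduced words. Stated through signs of roots,
  -- the condition can be transported along elements that fix those roots (`Ascending-shift`).
  data Ascending (u : W) : List (Fin n) → Set where
    []  : Ascending u []
    _∷_ : ∀ {i is} → Pos (to u (α i)) → Ascending (u ∙ simple i) is → Ascending u (i ∷ is)

  Ascending-★ : ∀ u is → Ascending u is → u ★ is ≈ u ∙ ⟪ is ⟫
  Ascending-★ u []       []        μ = refl
  Ascending-★ u (i ∷ is) (p ∷ asc) μ = trans (cong (λ t → to (t ★ is) μ) (⋆-Pos u i p)) (Ascending-★ (u ∙ simple i) is asc μ)

  Ascending-ℓ : ∀ u is → Ascending u is → ℓ (u ∙ ⟪ is ⟫) ≡ ℓ u ℕ.+ length is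
  Ascending-ℓ u []       []        = trans (ℓ-cong (u ∙ ⟪ [] ⟫) u (λ _ → refl)) (sym (ℕₚ.+-identityʳ (ℓ u)))
  Ascending-ℓ u (i ∷ is) (p ∷ asc) = begin
      ℓ (u ∙ ⟪ i ∷ is ⟫) ≡⟨ ℓ-cong (u ∙ ⟪ i ∷ is ⟫) (u ∙ simple i ∙ ⟪ is ⟫) (λ _ → refl) ⟩
      ℓ (u ∙ simple i ∙ ⟪ is ⟫) ≡⟨ Ascending-ℓ (u ∙ simple i) is asc ⟩
      ℓ (u ∙ simple i) ℕ.+ length is ≡⟨ cong (ℕ._+ length is) (ℓ-Pos u i p) ⟩
      suc (ℓ u) ℕ.+ length is ≡⟨ sym (ℕₚ.+-suc (ℓ u) (length is)) ⟩
      ℓ u ℕ.+ suc (length is) ∎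
    where open ≡-Reasoning

  -- The loss of length at a descent cannot be made up by the remaining letters, each of which adds
  -- at most 1.
  ℓ-Ascending : ∀ u is → ℓ u ℕ.+ length is ℕ.≤ ℓ (u ∙ ⟪ is ⟫) → Ascending u is
  ℓ-Ascending u []       _ = []
  ℓ-Ascending u (i ∷ is) h = cases (signα u i)
    where
      h′ : suc (ℓ u) ℕ.+ length is ℕ.≤ ℓ (u ∙ simple i ∙ ⟪ is ⟫)
      h′ = subst₂ ℕ._≤_ (ℕₚ.+-suc (ℓ u) (length is)) (ℓ-cong (u ∙ ⟪ i ∷ is ⟫) (u ∙ simple i ∙ ⟪ is ⟫) (λ _ → refl)) h
      cases : Pos (to u (α i)) ⊎ Neg (to u (α i)) → Ascending u (i ∷ is)
      cases (inj₁ p) = p ∷ ℓ-Ascending (u ∙ simple i) is (subst (λ t → t ℕ.+ length is ℕ.≤ ℓ (u ∙ simple i ∙ ⟪ is ⟫)) (sym (ℓ-Pos u i p)) h′)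
      cases (inj₂ q) = contradiction (ℕₚ.≤-trans h′ (ℓ-∙⟪⟫ (u ∙ simple i) is))
        (ℕₚ.<⇒≱ (ℕₚ.+-monoˡ-< (length is) (ℕₚ.<-trans (ℓ-Neg u i q) (ℕₚ.n<1+n (ℓ u)))))

  Ascending-cong : ∀ u v is → u ≈ v → Ascending u is → Ascending v is
  Ascending-cong u v []       eq []        = []
  Ascending-cong u v (i ∷ is) eq (p ∷ asc) = subst Pos (eq (α i)) p ∷ Ascending-cong (u ∙ simple i) (v ∙ simple i) is (λ μ → eq (reflect (α i) μ)) asc

  Ascending-++ : ∀ u is js → Ascending u is → Ascending (u ∙ ⟪ is ⟫) js → Ascending u (is ++ js)
  Ascending-++ u []       js []        asc′ = Ascending-cong (u ∙ ⟪ [] ⟫) u js (λ _ → refl) asc′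
  Ascending-++ u (i ∷ is) js (p ∷ asc) asc′ = p ∷ Ascending-++ (u ∙ simple i) is js asc
    (Ascending-cong (u ∙ ⟪ i ∷ is ⟫) (u ∙ simple i ∙ ⟪ is ⟫) js (λ _ → refl) asc′)

  Fixes : W → Fin n → Set
  Fixes u j = to u (α j) ≡ α j

  fixes-commutes : ∀ u j → Fixes u j → ∀ μ → to u (reflect (α j) μ) ≡ reflect (α j) (to u μ)
  fixes-commutes u j fix μ = trans (to-reflect u (α j) μ) (cong (λ t → reflect t (to u μ)) fix)

  -- Since x commutes with u and fixes the simple roots of the word, it can be moved past u at every
  -- sign test without altering the root tested. This is what lets one reduced word be prolonged by
  -- another.
  Ascending-shift : ∀ x u is → (∀ μ → to x (to u μ) ≡ to u (to x μ)) → All (Fixes x) is →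
                    Ascending u is → Ascending (x ∙ u) is
  Ascending-shift x u []       _    _            []        = []
  Ascending-shift x u (i ∷ is) comm (fix ∷ fixes) (p ∷ asc) =
    subst Pos (sym (trans (comm (α i)) (cong (to u) fix))) p ∷
    Ascending-cong (x ∙ (u ∙ simple i)) (x ∙ u ∙ simple i) is (λ _ → refl) (Ascending-shift x (u ∙ simple i) is
      (λ μ → trans (comm (reflect (α i) μ)) (cong (to u) (fixes-commutes x i fix μ))) fixes asc)

-- Arcs of the cycle that avoid `base`, and the reflections in them.

module Arcs (n : ℕ) (3≤n : 3 ℕ.≤ n) (base : Fin n) where
  open Affine n 3≤n
  open Roots n 3≤n
  open Hecke n 3≤n

  vertex : ℕ → Fin n
  vertex = walk base

  b₀ : ℕ
  b₀ = toℕ base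

  toℕ-vertex : ∀ {k} → k ℕ.< n → toℕ (vertex k) ≡ b₀ ℕ.+ k ⊎ toℕ (vertex k) ℕ.+ n ≡ b₀ ℕ.+ k
  toℕ-vertex {k} k<n = toℕ-walk base k (ℕₚ.<⇒≤ k<n)

  vertex-injective : ∀ {j k} → j ℕ.< n → k ℕ.< n → vertex j ≡ vertex k → j ≡ k
  vertex-injective {j} {k} j<n k<n eq = cases (toℕ-vertex j<n) (toℕ-vertex k<n)
    where
      wrap : ∀ {j k} → k ℕ.< n → b₀ ℕ.+ j ℕ.+ n ≢ b₀ ℕ.+ k
      wrap {j} {k} k<n e = ℕₚ.<⇒≱ k<n (ℕₚ.≤-trans (ℕₚ.m≤n+m n j)
        (ℕₚ.≤-reflexive (ℕₚ.+-cancelˡ-≡ b₀ (j ℕ.+ n) k (trans (sym (ℕₚ.+-assoc b₀ j n)) e))))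
      t≡ : toℕ (vertex j) ≡ toℕ (vertex k)
      t≡ = cong toℕ eq
      cases : toℕ (vertex j) ≡ b₀ ℕ.+ j ⊎ toℕ (vertex j) ℕ.+ n ≡ b₀ ℕ.+ j →
              toℕ (vertex k) ≡ b₀ ℕ.+ k ⊎ toℕ (vertex k) ℕ.+ n ≡ b₀ ℕ.+ k → j ≡ k
      cases (inj₁ p) (inj₁ q) = ℕₚ.+-cancelˡ-≡ b₀ j k (trans (sym p) (trans t≡ q))
      cases (inj₁ p) (inj₂ q) = contradiction (trans (cong (ℕ._+ n) (trans (sym p) t≡)) q) (wrap k<n)
      cases (inj₂ p) (inj₁ q) = contradiction (trans (cong (ℕ._+ n) (trans (sym q) (sym t≡))) p) (wrap j<n)
      cases (inj₂ p) (inj₂ q) = ℕₚ.+-cancelˡ-≡ b₀ j k (trans (sym p) (trans (cong (ℕ._+ n) t≡) q))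

  position : ∀ i → ∃ λ k → k ℕ.< n × vertex k ≡ i
  position i = cases (b₀ ℕ.≤? toℕ i)
    where
      cases : Dec (b₀ ℕ.≤ toℕ i) → ∃ λ k → k ℕ.< n × vertex k ≡ i
      cases (yes b≤i) = k , k<n , found (toℕ-vertex k<n)
        where
          k = toℕ i ℕ.∸ b₀
          b+k : b₀ ℕ.+ k ≡ toℕ i
          b+k = ℕₚ.m+[n∸m]≡n b≤i
          k<n : k ℕ.< n
          k<n = ℕₚ.≤-<-trans (ℕₚ.m∸n≤m (toℕ i) b₀) (Finₚ.toℕ<n i)
          found : toℕ (vertex k) ≡ b₀ ℕ.+ k ⊎ toℕ (vertex k) ℕ.+ n ≡ b₀ ℕ.+ k → vertex k ≡ i
          found (inj₁ p) = Finₚ.toℕ-injective (trans p b+k)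
          found (inj₂ p) = contradiction (subst (n ℕ.≤_) (trans p b+k) (ℕₚ.m≤n+m n _)) (ℕₚ.<⇒≱ (Finₚ.toℕ<n i))
      cases (no b≰i) = k , k<n , found (toℕ-vertex k<n)
        where
          i<b : toℕ i ℕ.< b₀
          i<b = ℕₚ.≰⇒> b≰i
          k = toℕ i ℕ.+ n ℕ.∸ b₀
          b+k : b₀ ℕ.+ k ≡ toℕ i ℕ.+ n
          b+k = ℕₚ.m+[n∸m]≡n (ℕₚ.≤-trans (ℕₚ.<⇒≤ (Finₚ.toℕ<n base)) (ℕₚ.m≤n+m n (toℕ i)))
          k<n : k ℕ.< n
          k<n = ℕₚ.+-cancelˡ-< b₀ k n (subst (ℕ._< b₀ ℕ.+ n) (sym b+k) (ℕₚ.+-monoˡ-< n i<b))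
          found : toℕ (vertex k) ≡ b₀ ℕ.+ k ⊎ toℕ (vertex k) ℕ.+ n ≡ b₀ ℕ.+ k → vertex k ≡ i
          found (inj₁ p) = contradiction (subst (n ℕ.≤_) (sym (trans p b+k)) (ℕₚ.m≤n+m n _)) (ℕₚ.<⇒≱ (Finₚ.toℕ<n (vertex k)))
          found (inj₂ p) = Finₚ.toℕ-injective (ℕₚ.+-cancelʳ-≡ n _ _ (trans p b+k))

  pos : Fin n → ℕ
  pos i = proj₁ (position i)

  pos<n : ∀ i → pos i ℕ.< n
  pos<n i = proj₁ (proj₂ (position i))

  vertex-pos : ∀ i → vertex (pos i) ≡ i
  vertex-pos i = proj₂ (proj₂ (position i))

  pos-vertex : ∀ {k} → k ℕ.< n → pos (vertex k) ≡ k
  pos-vertex {k} k<n = vertex-injective (pos<n (vertex k)) k<n (vertex-pos (vertex k))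

  ext-vertex : ∀ {u v : Q} → (∀ k → k ℕ.< n → lookup u (vertex k) ≡ lookup v (vertex k)) → u ≡ v
  ext-vertex {u} {v} h = ext λ i → subst (λ j → lookup u j ≡ lookup v j) (vertex-pos i) (h (pos i) (pos<n i))

  In : ℕ → ℕ → ℕ → Set
  In x y k = x ℕ.≤ k × k ℕ.< y

  in? : ∀ x y k → Dec (In x y k)
  in? x y k = (x ℕ.≤? k) ×-dec (k ℕ.<? y)

  χ : ℕ → ℕ → ℕ → ℤ
  χ x y k = if does (in? x y k) then 1ℤ else 0ℤ

  χ-in : ∀ x y k → In x y k → χ x y k ≡ 1ℤ
  χ-in x y k p = cong (λ t → if t then 1ℤ else 0ℤ) (dec-true (in? x y k) p)

  χ-out : ∀ x y k → ¬ In x y k → χ x y k ≡ 0ℤ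
  χ-out x y k p = cong (λ t → if t then 1ℤ else 0ℤ) (dec-false (in? x y k) p)

  χ-1⇒in : ∀ x y k → χ x y k ≡ 1ℤ → In x y k
  χ-1⇒in x y k e = cases (in? x y k)
    where
      absurd : ¬ 0ℤ ≡ 1ℤ
      absurd ()
      cases : Dec (In x y k) → In x y k
      cases (yes p) = p
      cases (no ¬p) = contradiction (trans (sym (χ-out x y k ¬p)) e) absurd

  -- The sum of the simple roots at the vertices x, …, y - 1, counted from base.
  ρ : ℕ → ℕ → Q
  ρ x y = tabulate (χ x y ∘ pos)

  lookup-ρ : ∀ x y {k} → k ℕ.< n → lookup (ρ x y) (vertex k) ≡ χ x y k
  lookup-ρ x y {k} k<n = trans (Vecₚ.lookup∘tabulate (χ x y ∘ pos) (vertex k)) (cong (χ x y) (pos-vertex k<n))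

  ρ-in : ∀ x y {k} → k ℕ.< n → In x y k → lookup (ρ x y) (vertex k) ≡ 1ℤ
  ρ-in x y {k} k<n p = trans (lookup-ρ x y k<n) (χ-in x y k p)

  ρ-out : ∀ x y {k} → k ℕ.< n → ¬ In x y k → lookup (ρ x y) (vertex k) ≡ 0ℤ
  ρ-out x y {k} k<n p = trans (lookup-ρ x y k<n) (χ-out x y k p)

  ρ-base : ∀ x y → 1 ℕ.≤ x → lookup (ρ x y) base ≡ 0ℤ
  ρ-base x y 1≤x = ρ-out x y 0<n λ (x≤0 , _) → ℕₚ.<⇒≱ 1≤x x≤0

  -- Position n is `base` again, where both sides vanish by the bounds on x and y. Hence the second
  -- difference in `form-ρ` can be taken on the line, without wrapping around.
  lookup-ρ-≤ : ∀ x y {k} → 1 ℕ.≤ x → y ℕ.≤ n → k ℕ.≤ n → lookup (ρ x y) (vertex k) ≡ χ x y k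
  lookup-ρ-≤ x y {k} 1≤x y≤n k≤n = cases (ℕₚ.m≤n⇒m<n∨m≡n k≤n)
    where
      cases : k ℕ.< n ⊎ k ≡ n → lookup (ρ x y) (vertex k) ≡ χ x y k
      cases (inj₁ k<n)  = lookup-ρ x y k<n
      cases (inj₂ refl) = trans (cong (lookup (ρ x y)) (walk-closed base)) (trans (ρ-base x y 1≤x)
        (sym (χ-out x y n λ (_ , n<y) → ℕₚ.<⇒≱ n<y y≤n)))

  Pos-ρ : ∀ x y → Pos (ρ x y)
  Pos-ρ x y = mkPos λ i → subst (λ j → 0ℤ ℤ.≤ lookup (ρ x y) j) (vertex-pos i) (cases (pos i) (pos<n i) (in? x y (pos i)))
    where
      cases : ∀ k → k ℕ.< n → Dec (In x y k) → 0ℤ ℤ.≤ lookup (ρ x y) (vertex k)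
      cases k k<n (yes p) = ℤₚ.≤-trans (ℤ.+≤+ z≤n) (ℤₚ.≤-reflexive (sym (ρ-in x y k<n p)))
      cases k k<n (no ¬p) = ℤₚ.≤-reflexive (sym (ρ-out x y k<n ¬p))

  ρ-mono : ∀ x y u v → (∀ k → In x y k → In u v k) → ρ x y ≤Q ρ u v
  ρ-mono x y u v h i = subst (λ j → lookup (ρ x y) j ℤ.≤ lookup (ρ u v) j) (vertex-pos i) (cases (pos i) (pos<n i) (in? x y (pos i)))
    where
      cases : ∀ k → k ℕ.< n → Dec (In x y k) → lookup (ρ x y) (vertex k) ℤ.≤ lookup (ρ u v) (vertex k)
      cases k k<n (yes p) = ℤₚ.≤-reflexive (trans (ρ-in x y k<n p) (sym (ρ-in u v k<n (h k p))))
      cases k k<n (no ¬p) = ℤₚ.≤-trans (ℤₚ.≤-reflexive (ρ-out x y k<n ¬p)) (0≤ (Pos-ρ u v) (vertex k))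

  form-ρ : ∀ x y k → 1 ℕ.≤ x → y ℕ.≤ n → suc k ℕ.< n →
           ⟨ ρ x y , α (vertex (suc k)) ⟩ ≡ + 2 ℤ.* χ x y (suc k) ℤ.- χ x y (suc (suc k)) ℤ.- χ x y k
  form-ρ x y k 1≤x y≤n k<n = trans (form-αʳ (ρ x y) (vertex (suc k))) (combine
      (lookup-ρ-≤ x y 1≤x y≤n (ℕₚ.<⇒≤ k<n))
      (lookup-ρ-≤ x y 1≤x y≤n k<n)
      (trans (cong (lookup (ρ x y)) (pred-succ (vertex k))) (lookup-ρ-≤ x y 1≤x y≤n (ℕₚ.≤-trans (ℕₚ.n≤1+n k) (ℕₚ.<⇒≤ k<n)))))
    where
      combine : ∀ {p q r p′ q′ r′} → p ≡ p′ → q ≡ q′ → r ≡ r′ → + 2 ℤ.* p ℤ.- q ℤ.- r ≡ + 2 ℤ.* p′ ℤ.- q′ ℤ.- r′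
      combine refl refl refl = refl

  ρ≡α : ∀ {k} → k ℕ.< n → ρ k (suc k) ≡ α (vertex k)
  ρ≡α {k} k<n = ext-vertex λ j j<n → cases j j<n (k ℕ.≟ j)
    where
      cases : ∀ j → j ℕ.< n → Dec (k ≡ j) → lookup (ρ k (suc k)) (vertex j) ≡ lookup (α (vertex k)) (vertex j)
      cases j j<n (yes refl) = trans (ρ-in k (suc k) k<n (ℕₚ.≤-refl , ℕₚ.≤-refl)) (sym (lookup-α-same (vertex k)))
      cases j j<n (no ne)    = trans (ρ-out k (suc k) j<n λ (k≤j , j≤k) → ne (ℕₚ.≤-antisym k≤j (ℕₚ.≤-pred j≤k)))
        (sym (lookup-α-other λ eq → ne (vertex-injective k<n j<n eq)))

  ρ-split : ∀ {x y} → x ℕ.< y → y ℕ.≤ n → ρ x y ≡ α (vertex x) ⊕ ρ (suc x) y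
  ρ-split {x} {y} x<y y≤n = ext-vertex λ j j<n → trans (cases j j<n (x ℕ.≟ j) (in? x y j))
      (sym (lookup-⊕ (α (vertex x)) (ρ (suc x) y) (vertex j)))
    where
      cases : ∀ j → j ℕ.< n → Dec (x ≡ j) → Dec (In x y j) →
              lookup (ρ x y) (vertex j) ≡ lookup (α (vertex x)) (vertex j) ℤ.+ lookup (ρ (suc x) y) (vertex j)
      cases j j<n (yes refl) _ = trans (ρ-in x y j<n (ℕₚ.≤-refl , x<y)) (sym (cong₂ ℤ._+_ (lookup-α-same (vertex x))
        (ρ-out (suc x) y j<n λ (p , _) → ℕₚ.<-irrefl refl p)))
      cases j j<n (no ne) (yes (p , q)) = trans (ρ-in x y j<n (p , q)) (sym (cong₂ ℤ._+_
        (lookup-α-other λ eq → ne (vertex-injective (ℕₚ.<-≤-trans x<y y≤n) j<n eq)) (ρ-in (suc x) y j<n (ℕₚ.≤∧≢⇒< p ne , q))))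
      cases j j<n (no ne) (no ¬p) = trans (ρ-out x y j<n ¬p) (sym (cong₂ ℤ._+_
        (lookup-α-other λ eq → ne (vertex-injective (ℕₚ.<-≤-trans x<y y≤n) j<n eq))
        (ρ-out (suc x) y j<n λ (p , q) → ¬p (ℕₚ.<⇒≤ p , q))))

  form-ρ-before : ∀ {x y} → 1 ℕ.≤ x → suc x ℕ.< y → y ℕ.≤ n → ⟨ ρ (suc x) y , α (vertex x) ⟩ ≡ -1ℤ
  form-ρ-before {suc x} {y} 1≤x x<y y≤n = trans (form-ρ (suc (suc x)) y x (s≤s z≤n) y≤n (ℕₚ.<-trans (ℕₚ.n<1+n (suc x)) (ℕₚ.<-≤-trans x<y y≤n)))
      (combine (χ-out _ y (suc x) λ (p , _) → ℕₚ.<-irrefl refl p) (χ-in (suc (suc x)) y (suc (suc x)) (ℕₚ.≤-refl , x<y))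
        (χ-out _ y x λ (p , _) → ℕₚ.<-irrefl refl (ℕₚ.<-trans (ℕₚ.n<1+n x) p)))
    where
      combine : ∀ {p q r} → p ≡ 0ℤ → q ≡ 1ℤ → r ≡ 0ℤ → + 2 ℤ.* p ℤ.- q ℤ.- r ≡ -1ℤ
      combine refl refl refl = refl

  -- The arc ends at y - 1. The adjacent positions x - 1 and y belong to none of the three; spans
  -- nested in the arc or apart from it never meet them.
  Outside Inside Endpoint : ℕ → ℕ → ℕ → Set
  Outside x y k = suc k ℕ.< x ⊎ y ℕ.< k
  Inside x y k = x ℕ.< k × suc k ℕ.< y
  Endpoint x y k = In x y k × (k ≡ x ⊎ suc k ≡ y)

  form-ρ-0 : ∀ x y k → 1 ℕ.≤ x → y ℕ.≤ n → 1 ℕ.≤ k → k ℕ.< n → Inside x y k ⊎ Outside x y k → ⟨ ρ x y , α (vertex k) ⟩ ≡ 0ℤ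
  form-ρ-0 x y (suc k) 1≤x y≤n _ k<n h = trans (form-ρ x y k 1≤x y≤n k<n) (cases h)
    where
      combine : ∀ {p q r} a → p ≡ a → q ≡ a → r ≡ a → + 2 ℤ.* p ℤ.- q ℤ.- r ≡ 0ℤ
      combine a refl refl refl = identity a
        where
          identity : ∀ a → + 2 ℤ.* a ℤ.- a ℤ.- a ≡ 0ℤ
          identity = solve-∀
      cases : Inside x y (suc k) ⊎ Outside x y (suc k) → + 2 ℤ.* χ x y (suc k) ℤ.- χ x y (suc (suc k)) ℤ.- χ x y k ≡ 0ℤ
      cases (inj₁ (s≤s p , q)) = combine 1ℤ (χ-in x y (suc k) (ℕₚ.≤-trans p (ℕₚ.n≤1+n k) , ℕₚ.<-trans (ℕₚ.n<1+n (suc k)) q))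
        (χ-in x y (suc (suc k)) (ℕₚ.≤-trans p (ℕₚ.≤-trans (ℕₚ.n≤1+n k) (ℕₚ.n≤1+n (suc k))) , q))
        (χ-in x y k (p , ℕₚ.<-trans (ℕₚ.n<1+n k) (ℕₚ.<-trans (ℕₚ.n<1+n (suc k)) q)))
      cases (inj₂ (inj₁ p)) = combine 0ℤ (χ-out x y (suc k) λ (q , _) → ℕₚ.<⇒≱ (ℕₚ.<-trans (ℕₚ.n<1+n (suc k)) p) q)
        (χ-out x y (suc (suc k)) λ (q , _) → ℕₚ.<⇒≱ p q)
        (χ-out x y k λ (q , _) → ℕₚ.<⇒≱ (ℕₚ.<-trans (ℕₚ.n<1+n k) (ℕₚ.<-trans (ℕₚ.n<1+n (suc k)) p)) q)
      cases (inj₂ (inj₂ p)) = combine 0ℤ (χ-out x y (suc k) λ (_ , q) → ℕₚ.<-asym p q)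
        (χ-out x y (suc (suc k)) λ (_ , q) → ℕₚ.<-asym (ℕₚ.<-trans p (ℕₚ.n<1+n (suc k))) q)
        (χ-out x y k λ (_ , q) → ℕₚ.<⇒≱ q (ℕₚ.≤-pred p))

  -- The value is 1, or 2 if the arc is a single vertex.
  form-ρ-endpoint : ∀ x y k → 1 ℕ.≤ x → y ℕ.≤ n → Endpoint x y k → 1ℤ ℤ.≤ ⟨ ρ x y , α (vertex k) ⟩
  form-ρ-endpoint (suc x) y zero _ _ ((() , _) , _)
  form-ρ-endpoint x y (suc k) 1≤x y≤n (p@(_ , k<y) , end) = subst (1ℤ ℤ.≤_) (sym (form-ρ x y k 1≤x y≤n (ℕₚ.<-≤-trans k<y y≤n)))
      (cases end (in? x y k) (in? x y (suc (suc k))))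
    where
      bound : ∀ {p q r} → p ≡ 1ℤ → (q ≡ 1ℤ × r ≡ 0ℤ) ⊎ (q ≡ 0ℤ × r ≡ 1ℤ) ⊎ (q ≡ 0ℤ × r ≡ 0ℤ) → 1ℤ ℤ.≤ + 2 ℤ.* p ℤ.- q ℤ.- r
      bound refl (inj₁ (refl , refl))        = ℤₚ.≤-refl
      bound refl (inj₂ (inj₁ (refl , refl))) = ℤₚ.≤-refl
      bound refl (inj₂ (inj₂ (refl , refl))) = ℤ.+≤+ (s≤s z≤n)
      beneath : suc k ≡ x → ¬ In x y k
      beneath refl (q , _) = ℕₚ.<-irrefl refl q
      above : suc (suc k) ≡ y → ¬ In x y (suc (suc k))
      above refl (_ , q) = ℕₚ.<-irrefl refl q
      cases : suc k ≡ x ⊎ suc (suc k) ≡ y → Dec (In x y k) → Dec (In x y (suc (suc k))) →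
              1ℤ ℤ.≤ + 2 ℤ.* χ x y (suc k) ℤ.- χ x y (suc (suc k)) ℤ.- χ x y k
      cases (inj₁ e) _        (yes r) = bound (χ-in x y (suc k) p) (inj₁ (χ-in x y _ r , χ-out x y k (beneath e)))
      cases (inj₁ e) _        (no ¬r) = bound (χ-in x y (suc k) p) (inj₂ (inj₂ (χ-out x y _ ¬r , χ-out x y k (beneath e))))
      cases (inj₂ e) (yes r) _        = bound (χ-in x y (suc k) p) (inj₂ (inj₁ (χ-out x y _ (above e) , χ-in x y k r)))
      cases (inj₂ e) (no ¬r) _        = bound (χ-in x y (suc k) p) (inj₂ (inj₂ (χ-out x y _ (above e) , χ-out x y k ¬r)))

  reflect-ρ-fixes : ∀ x y k → 1 ℕ.≤ x → y ℕ.≤ n → 1 ℕ.≤ k → k ℕ.< n → Inside x y k ⊎ Outside x y k →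
                    reflect (ρ x y) (α (vertex k)) ≡ α (vertex k)
  reflect-ρ-fixes x y k 1≤x y≤n 1≤k k<n h = ext λ i → trans (lookup-reflect (ρ x y) (α (vertex k)) i)
      (trans (cong (λ t → lookup (α (vertex k)) i ℤ.- t ℤ.* lookup (ρ x y) i)
        (trans (form-sym (α (vertex k)) (ρ x y)) (form-ρ-0 x y k 1≤x y≤n 1≤k k<n h)))
        (identity (lookup (α (vertex k)) i) (lookup (ρ x y) i)))
    where
      identity : ∀ a b → a ℤ.- 0ℤ ℤ.* b ≡ a
      identity = solve-∀

  -- At least one copy of `ρ x y` is subtracted from a simple root below it. This is the descent by
  -- which the reflection absorbs its end letters.
  reflect-ρ-endpoint : ∀ x y k → 1 ℕ.≤ x → y ℕ.≤ n → Endpoint x y k → Neg (reflect (ρ x y) (α (vertex k)))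
  reflect-ρ-endpoint x y k 1≤x y≤n end@((x≤k , k<y) , _) = mkNeg λ i → ℤₚ.≤-trans
      (ℤₚ.≤-reflexive (trans (lookup-reflect (ρ x y) (α (vertex k)) i)
        (cong (λ t → lookup (α (vertex k)) i ℤ.- t ℤ.* lookup (ρ x y) i) (form-sym (α (vertex k)) (ρ x y)))))
      (bound i (lookup (ρ x y) i) (0≤ (Pos-ρ x y) i) (beneath i))
    where
      t : ℤ
      t = ⟨ ρ x y , α (vertex k) ⟩
      beneath : ∀ i → lookup (α (vertex k)) i ℤ.≤ lookup (ρ x y) i
      beneath i = subst (λ z → lookup z i ℤ.≤ lookup (ρ x y) i) (ρ≡α (ℕₚ.<-≤-trans k<y y≤n))
        (ρ-mono k (suc k) x y (λ j (k≤j , j≤k) → ℕₚ.≤-trans x≤k k≤j , ℕₚ.≤-<-trans (ℕₚ.≤-pred j≤k) k<y) i)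
      bound : ∀ i r → 0ℤ ℤ.≤ r → lookup (α (vertex k)) i ℤ.≤ r → lookup (α (vertex k)) i ℤ.- t ℤ.* r ℤ.≤ 0ℤ
      bound i r 0≤r α≤r = ℤₚ.i≤j⇒i-j≤0 (ℤₚ.≤-trans α≤r (ℤₚ.≤-trans (ℤₚ.≤-reflexive (sym (ℤₚ.*-identityˡ r)))
        (ℤₚ.*-monoʳ-≤-nonNeg r {{ℤ.nonNegative 0≤r}} (form-ρ-endpoint x y k 1≤x y≤n end))))

  module _ {x y a e : ℕ} where

    private
      b+ : ∀ {u v} → u ℕ.≤ v → b₀ ℕ.+ u ℕ.≤ b₀ ℕ.+ v
      b+ = ℕₚ.+-monoʳ-≤ b₀
      b- : ∀ {u v} → b₀ ℕ.+ u ℕ.≤ b₀ ℕ.+ v → u ℕ.≤ v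
      b- = ℕₚ.+-cancelˡ-≤ b₀ _ _
      n- : ∀ {u v} → u ℕ.+ n ℕ.≤ v ℕ.+ n → u ℕ.≤ v
      n- = ℕₚ.+-cancelʳ-≤ n _ _
      n+ : ∀ {u v} → u ℕ.≤ v → u ℕ.+ n ℕ.≤ v ℕ.+ n
      n+ = ℕₚ.+-monoˡ-≤ n
      b≤ : ∀ k → b₀ ℕ.≤ b₀ ℕ.+ k
      b≤ = ℕₚ.m≤m+n b₀
      infixr 5 _∙≤_
      _∙≤_ : ∀ {i j k} → i ℕ.≤ j → j ℕ.≤ k → i ℕ.≤ k
      _∙≤_ = ℕₚ.≤-trans
      ≡≤ : ∀ {i j} → i ≡ j → i ℕ.≤ j
      ≡≤ = ℕₚ.≤-reflexive
      ≡≥ : ∀ {i j} → i ≡ j → j ℕ.≤ i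
      ≡≥ = ℕₚ.≤-reflexive ∘ sym
      bsuc : ∀ {k} → suc (b₀ ℕ.+ k) ≡ b₀ ℕ.+ suc k
      bsuc {k} = sym (ℕₚ.+-suc b₀ k)

      -- t is the index of the vertex at position k.
      At : ℕ → ℕ → Set
      At t k = t ≡ b₀ ℕ.+ k ⊎ t ℕ.+ n ≡ b₀ ℕ.+ k

    ρ≡interval : (∀ t k → t ℕ.< n → k ℕ.< n → At t k → In x y k → a ℕ.≤ t × t ℕ.≤ e) →
                 (∀ t k → t ℕ.< n → k ℕ.< n → At t k → a ℕ.≤ t × t ℕ.≤ e → In x y k) →
                 ρ x y ≡ interval a e
    ρ≡interval f g = ext-vertex λ k k<n → cases k k<n (in? x y k)
      where
        cases : ∀ k → k ℕ.< n → Dec (In x y k) → lookup (ρ x y) (vertex k) ≡ lookup (interval a e) (vertex k)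
        cases k k<n (yes p) = let (q , r) = f _ k (Finₚ.toℕ<n (vertex k)) k<n (toℕ-vertex k<n) p in
          trans (ρ-in x y k<n p) (sym (interval-in a e (vertex k) q r))
        cases k k<n (no ¬p) = trans (ρ-out x y k<n ¬p)
          (sym (interval-out a e (vertex k) (¬p ∘ g _ k (Finₚ.toℕ<n (vertex k)) k<n (toℕ-vertex k<n))))

    ρ≡c⊖interval : (∀ t k → t ℕ.< n → k ℕ.< n → At t k → In x y k → ¬ (a ℕ.≤ t × t ℕ.≤ e)) →
                   (∀ t k → t ℕ.< n → k ℕ.< n → At t k → ¬ (a ℕ.≤ t × t ℕ.≤ e) → In x y k) →
                   ρ x y ≡ c ⊖ interval a e
    ρ≡c⊖interval f g = ext-vertex λ k k<n → trans (cases k k<n ((a ℕ.≤? toℕ (vertex k)) ×-dec (toℕ (vertex k) ℕ.≤? e)))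
        (sym (trans (lookup-⊖ c (interval a e) (vertex k)) (cong (λ t → t ℤ.- lookup (interval a e) (vertex k)) (lookup-c (vertex k)))))
      where
        cases : ∀ k → k ℕ.< n → Dec (a ℕ.≤ toℕ (vertex k) × toℕ (vertex k) ℕ.≤ e) →
                lookup (ρ x y) (vertex k) ≡ 1ℤ ℤ.- lookup (interval a e) (vertex k)
        cases k k<n (yes p) = trans (ρ-out x y k<n λ q → f _ k (Finₚ.toℕ<n (vertex k)) k<n (toℕ-vertex k<n) q p)
          (sym (cong (λ t → 1ℤ ℤ.- t) (interval-in a e (vertex k) (proj₁ p) (proj₂ p))))
        cases k k<n (no ¬p) = trans (ρ-in x y k<n (g _ k (Finₚ.toℕ<n (vertex k)) k<n (toℕ-vertex k<n) ¬p))
          (sym (cong (λ t → 1ℤ ℤ.- t) (interval-out a e (vertex k) ¬p)))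

    -- Counted from `base`, an arc lies before vertex 0, beyond it, or contains it. The first two
    -- give finite intervals with indices unshifted or shifted by n; the third is the complement of
    -- a finite interval.
    ρ≡interval-right : b₀ ℕ.+ x ≡ a → b₀ ℕ.+ y ≡ suc e → e ℕ.< n → ρ x y ≡ interval a e
    ρ≡interval-right ba be e<n = ρ≡interval
      (λ { t k _ _ (inj₁ p) (q , r) → (≡≥ ba ∙≤ b+ q ∙≤ ≡≥ p) , ℕₚ.≤-pred (s≤s (≡≤ p) ∙≤ ≡≤ bsuc ∙≤ b+ r ∙≤ ≡≤ be)
         ; t k _ _ (inj₂ p) (q , r) → contradiction (≡≤ bsuc ∙≤ b+ r ∙≤ ≡≤ be ∙≤ e<n ∙≤ ℕₚ.m≤n+m n t ∙≤ ≡≤ p) ℕₚ.1+n≰n })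
      (λ { t k _ _ (inj₁ p) (q , r) → b- (≡≤ ba ∙≤ q ∙≤ ≡≤ p) , b- (≡≥ bsuc ∙≤ s≤s (≡≥ p) ∙≤ s≤s r ∙≤ ≡≥ be)
         ; t k _ k<n (inj₂ p) (q , r) → contradiction (n- (s≤s (≡≤ p) ∙≤ ≡≤ bsuc ∙≤ b+ k<n)) (ℕₚ.≤⇒≯ (b≤ x ∙≤ ≡≤ ba ∙≤ q)) })

    ρ≡interval-left : b₀ ℕ.+ x ≡ a ℕ.+ n → b₀ ℕ.+ y ≡ suc e ℕ.+ n → y ℕ.≤ n → ρ x y ≡ interval a e
    ρ≡interval-left ba be y≤n = ρ≡interval
      (λ { t k t<n _ (inj₁ p) (q , r) → contradiction (ℕₚ.m≤n+m n a ∙≤ ≡≥ ba ∙≤ b+ q ∙≤ ≡≥ p) (ℕₚ.<⇒≱ t<n)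
         ; t k _ _ (inj₂ p) (q , r) → n- (≡≥ ba ∙≤ b+ q ∙≤ ≡≥ p) , ℕₚ.≤-pred (n- (s≤s (≡≤ p) ∙≤ ≡≤ bsuc ∙≤ b+ r ∙≤ ≡≤ be)) })
      (λ { t k _ _ (inj₁ p) (q , r) → contradiction (b≤ k ∙≤ ≡≥ p ∙≤ r) (ℕₚ.<⇒≱ (n- (≡≥ be ∙≤ b+ y≤n)))
         ; t k _ _ (inj₂ p) (q , r) → b- (≡≤ ba ∙≤ n+ q ∙≤ ≡≤ p) , b- (≡≥ bsuc ∙≤ s≤s (≡≥ p) ∙≤ n+ (s≤s r) ∙≤ ≡≥ be) })

    ρ≡c⊖interval-around : b₀ ℕ.+ x ≡ suc e → b₀ ℕ.+ y ≡ a ℕ.+ n → e ℕ.< n → y ℕ.≤ n → ρ x y ≡ c ⊖ interval a e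
    ρ≡c⊖interval-around be ba e<n y≤n = ρ≡c⊖interval
      (λ { t k _ _ (inj₁ p) (q , r) (_ , t≤e) → ℕₚ.<⇒≱ (≡≥ be ∙≤ b+ q ∙≤ ≡≥ p) t≤e
         ; t k _ _ (inj₂ p) (q , r) (a≤t , _) → ℕₚ.<⇒≱ (n- (s≤s (≡≤ p) ∙≤ ≡≤ bsuc ∙≤ b+ r ∙≤ ≡≤ ba)) a≤t })
      (λ { t k t<n _ (inj₁ p) h →
             b- (≡≤ be ∙≤ ℕₚ.≰⇒> (λ t≤e → h ((n- (≡≥ ba ∙≤ b+ y≤n) ∙≤ b≤ k ∙≤ ≡≥ p) , t≤e)) ∙≤ ≡≤ p) ,
             b- (≡≥ bsuc ∙≤ s≤s (≡≥ p) ∙≤ t<n ∙≤ ℕₚ.m≤n+m n a ∙≤ ≡≥ ba)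
         ; t k _ k<n (inj₂ p) h →
             b- (≡≤ be ∙≤ e<n ∙≤ ℕₚ.m≤n+m n t ∙≤ ≡≤ p) ,
             b- (≡≥ bsuc ∙≤ s≤s (≡≥ p) ∙≤ n+ (ℕₚ.≰⇒> λ a≤t → h (a≤t , ℕₚ.≤-pred (n- (s≤s (≡≤ p) ∙≤ ≡≤ bsuc ∙≤ b+ k<n) ∙≤ b≤ x ∙≤ ≡≤ be))) ∙≤ ≡≥ ba) })

  -- Positions 0 and n are both `base`; the outer bounds keep the arc away from either.
  IsArc : ℕ → ℕ → Set
  IsArc x y = 1 ℕ.≤ x × x ℕ.< y × y ℕ.≤ n

-- Positive real roots as arcs, their supports and palindromic reduced words.

count-insert : ∀ {m} (p q : Subset m) i → lookup p i ≡ true → lookup q i ≡ false →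
               (∀ j → j ≢ i → lookup p j ≡ lookup q j) → ∣ p ∣ ≡ suc ∣ q ∣
count-insert (true ∷ p) (false ∷ q) zero refl refl h = cong (λ t → suc ∣ t ∣) (trans (sym (Vecₚ.tabulate∘lookup p))
  (trans (Vecₚ.tabulate-cong (λ j → h (suc j) λ ())) (Vecₚ.tabulate∘lookup q)))
count-insert (s ∷ p) (t ∷ q) (suc i) e f h with h zero (λ ())
count-insert (true ∷ p)  (true ∷ q)  (suc i) e f h | refl = cong suc (count-insert p q i e f λ j ne → h (suc j) (ne ∘ Finₚ.suc-injective))
count-insert (false ∷ p) (false ∷ q) (suc i) e f h | refl = count-insert p q i e f λ j ne → h (suc j) (ne ∘ Finₚ.suc-injective)

count-empty : ∀ {m} (p : Subset m) → (∀ j → lookup p j ≡ false) → ∣ p ∣ ≡ 0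
count-empty []          h = refl
count-empty (true ∷ p)  h = contradiction (h zero) λ ()
count-empty (false ∷ p) h = count-empty p (h ∘ suc)

∸-step : ∀ {x y} → x ℕ.< y → y ℕ.∸ x ≡ suc (y ℕ.∸ suc x)
∸-step {zero}  {suc y} _         = refl
∸-step {suc x} {suc y} (s≤s x<y) = ∸-step x<y

module Words (n : ℕ) (3≤n : 3 ℕ.≤ n) (base : Fin n) where
  open Affine n 3≤n
  open Roots n 3≤n
  open Hecke n 3≤n
  open Arcs n 3≤n base

  interval-positive : ∀ {a e} → 1 ℕ.≤ a → a ℕ.≤ e → e ℕ.< n → IsPositiveRealRoot (interval a e)
  interval-positive {a} {e} 1≤a a≤e e<n = (interval a e , 0ℤ , inj₁ finite , eq) , inj₂ (refl , finite)
    where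
      finite : IsFinitePositiveRoot (interval a e)
      finite = a , e , 1≤a , a≤e , e<n , refl
      eq : interval a e ≡ interval a e ⊕ 0ℤ • c
      eq = ext λ i → sym (trans (lookup-⊕ (interval a e) (0ℤ • c) i) (trans
        (cong (λ t → lookup (interval a e) i ℤ.+ t) (trans (lookup-• 0ℤ c i) (ℤₚ.*-zeroˡ (lookup c i)))) (ℤₚ.+-identityʳ _)))

  c⊖≡ : ∀ x → c ⊖ x ≡ ⊝ x ⊕ 1ℤ • c
  c⊖≡ x = ext λ i → trans (lookup-⊖ c x i) (trans (identity (lookup c i) (lookup x i))
      (sym (trans (lookup-⊕ (⊝ x) (1ℤ • c) i) (cong₂ ℤ._+_ (lookup-⊝ x i) (lookup-• 1ℤ c i)))))
    where
      identity : ∀ p q → p ℤ.- q ≡ ℤ.- q ℤ.+ 1ℤ ℤ.* p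
      identity = solve-∀

  c⊖interval-positive : ∀ {a e} → 1 ℕ.≤ a → a ℕ.≤ e → e ℕ.< n → IsPositiveRealRoot (c ⊖ interval a e)
  c⊖interval-positive {a} {e} 1≤a a≤e e<n =
    (⊝ interval a e , 1ℤ , inj₂ (a , e , 1≤a , a≤e , e<n , ⊝-involutive (interval a e)) , c⊖≡ (interval a e)) , inj₁ (ℤ.+<+ (s≤s z≤n))

  ρ-positive : ∀ {x y} → IsArc x y → IsPositiveRealRoot (ρ x y)
  ρ-positive {suc x} {suc y} (_ , s≤s x<y , y<n) = cases (b₀ ℕ.+ suc y ℕ.≤? n) (b₀ ℕ.+ suc x ℕ.≤? n)
    where
      +-y : b₀ ℕ.+ suc y ≡ suc (b₀ ℕ.+ y)
      +-y = ℕₚ.+-suc b₀ y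
      +-x : b₀ ℕ.+ suc x ≡ suc (b₀ ℕ.+ x)
      +-x = ℕₚ.+-suc b₀ x
      b₀<n : b₀ ℕ.< n
      b₀<n = Finₚ.toℕ<n base
      cases : Dec (b₀ ℕ.+ suc y ℕ.≤ n) → Dec (b₀ ℕ.+ suc x ℕ.≤ n) → IsPositiveRealRoot (ρ (suc x) (suc y))
      cases (yes p) _ = subst IsPositiveRealRoot (sym (ρ≡interval-right refl +-y e<n))
          (interval-positive (ℕₚ.≤-trans (s≤s z≤n) (ℕₚ.≤-reflexive (sym +-x))) (ℕₚ.+-monoʳ-≤ b₀ x<y) e<n)
        where
          e<n : b₀ ℕ.+ y ℕ.< n
          e<n = subst (ℕ._≤ n) +-y p
      cases (no p) (yes q) = subst IsPositiveRealRoot (sym (ρ≡c⊖interval-around +-x wrap (subst (ℕ._≤ n) +-x q) y<n))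
          (c⊖interval-positive (ℕₚ.m<n⇒0<n∸m (ℕₚ.≰⇒> p))
            (ℕₚ.+-cancelʳ-≤ n _ _ (subst (ℕ._≤ b₀ ℕ.+ x ℕ.+ n) wrap (ℕₚ.+-mono-≤ (ℕₚ.m≤m+n b₀ x) y<n)))
            (subst (ℕ._≤ n) +-x q))
        where
          wrap : b₀ ℕ.+ suc y ≡ (b₀ ℕ.+ suc y ℕ.∸ n) ℕ.+ n
          wrap = sym (ℕₚ.m∸n+n≡m (ℕₚ.<⇒≤ (ℕₚ.≰⇒> p)))
      cases (no _) (no q) = subst IsPositiveRealRoot (sym (ρ≡interval-left {a = b₀ ℕ.+ suc x ℕ.∸ n} {e = b₀ ℕ.+ y ℕ.∸ n} wrap-x (trans +-y (cong suc wrap-y)) y<n))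
          (interval-positive (ℕₚ.m<n⇒0<n∸m n<b+x) (ℕₚ.∸-monoˡ-≤ n (ℕₚ.+-monoʳ-≤ b₀ x<y))
            (ℕₚ.+-cancelʳ-< n _ _ (subst (ℕ._< n ℕ.+ n) wrap-y (ℕₚ.+-mono-< b₀<n y<n))))
        where
          n<b+x : n ℕ.< b₀ ℕ.+ suc x
          n<b+x = ℕₚ.≰⇒> q
          n≤b+y : n ℕ.≤ b₀ ℕ.+ y
          n≤b+y = ℕₚ.≤-trans (ℕₚ.<⇒≤ n<b+x) (ℕₚ.+-monoʳ-≤ b₀ x<y)
          wrap-x : b₀ ℕ.+ suc x ≡ (b₀ ℕ.+ suc x ℕ.∸ n) ℕ.+ n
          wrap-x = sym (ℕₚ.m∸n+n≡m (ℕₚ.<⇒≤ n<b+x))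
          wrap-y : b₀ ℕ.+ y ≡ (b₀ ℕ.+ y ℕ.∸ n) ℕ.+ n
          wrap-y = sym (ℕₚ.m∸n+n≡m n≤b+y)

  interval-arc : ∀ {a e} → 1 ℕ.≤ a → a ℕ.≤ e → e ℕ.< n → ¬ (a ℕ.≤ b₀ × b₀ ℕ.≤ e) → ∃₂ λ x y → IsArc x y × ρ x y ≡ interval a e
  interval-arc {a} {e} 1≤a a≤e e<n ∉ = cases (a ℕ.≤? b₀)
    where
      b₀<n : b₀ ℕ.< n
      b₀<n = Finₚ.toℕ<n base
      cases : Dec (a ℕ.≤ b₀) → ∃₂ λ x y → IsArc x y × ρ x y ≡ interval a e
      cases (no a≰b) = a ℕ.∸ b₀ , suc e ℕ.∸ b₀ ,
          (ℕₚ.m<n⇒0<n∸m b<a , ℕₚ.∸-monoˡ-< (s≤s a≤e) (ℕₚ.<⇒≤ b<a) , ℕₚ.≤-trans (ℕₚ.m∸n≤m (suc e) b₀) e<n) ,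
          ρ≡interval-right (ℕₚ.m+[n∸m]≡n (ℕₚ.<⇒≤ b<a)) (ℕₚ.m+[n∸m]≡n (ℕₚ.≤-trans (ℕₚ.<⇒≤ b<a) (ℕₚ.≤-trans a≤e (ℕₚ.n≤1+n e)))) e<n
        where
          b<a : b₀ ℕ.< a
          b<a = ℕₚ.≰⇒> a≰b
      cases (yes a≤b) = a ℕ.+ n ℕ.∸ b₀ , suc e ℕ.+ n ℕ.∸ b₀ ,
          (ℕₚ.m<n⇒0<n∸m (ℕₚ.<-≤-trans b₀<n (ℕₚ.m≤n+m n a)) , ℕₚ.∸-monoˡ-< (ℕₚ.+-monoˡ-< n (s≤s a≤e)) b≤a+n , y≤n) ,
          ρ≡interval-left (ℕₚ.m+[n∸m]≡n b≤a+n) +-y y≤n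
        where
          e<b : e ℕ.< b₀
          e<b = ℕₚ.≰⇒> λ b≤e → ∉ (a≤b , b≤e)
          b≤a+n : b₀ ℕ.≤ a ℕ.+ n
          b≤a+n = ℕₚ.≤-trans (ℕₚ.<⇒≤ b₀<n) (ℕₚ.m≤n+m n a)
          +-y : b₀ ℕ.+ (suc e ℕ.+ n ℕ.∸ b₀) ≡ suc e ℕ.+ n
          +-y = ℕₚ.m+[n∸m]≡n (ℕₚ.≤-trans (ℕₚ.<⇒≤ b₀<n) (ℕₚ.m≤n+m n (suc e)))
          y≤n : suc e ℕ.+ n ℕ.∸ b₀ ℕ.≤ n
          y≤n = ℕₚ.+-cancelˡ-≤ b₀ _ _ (subst (ℕ._≤ b₀ ℕ.+ n) (sym +-y) (ℕₚ.+-monoˡ-≤ n e<b))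

  c⊖interval-arc : ∀ {a e} → 1 ℕ.≤ a → a ℕ.≤ e → e ℕ.< n → a ℕ.≤ b₀ → b₀ ℕ.≤ e → ∃₂ λ x y → IsArc x y × ρ x y ≡ c ⊖ interval a e
  c⊖interval-arc {a} {e} 1≤a a≤e e<n a≤b b≤e = suc e ℕ.∸ b₀ , a ℕ.+ n ℕ.∸ b₀ ,
      (ℕₚ.m<n⇒0<n∸m (s≤s b≤e) , ℕₚ.∸-monoˡ-< (ℕₚ.≤-<-trans e<n (ℕₚ.m<n+m n 1≤a)) (ℕₚ.≤-trans b≤e (ℕₚ.n≤1+n e)) , y≤n) ,
      ρ≡c⊖interval-around (ℕₚ.m+[n∸m]≡n (ℕₚ.≤-trans b≤e (ℕₚ.n≤1+n e))) +-y e<n y≤n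
    where
      +-y : b₀ ℕ.+ (a ℕ.+ n ℕ.∸ b₀) ≡ a ℕ.+ n
      +-y = ℕₚ.m+[n∸m]≡n (ℕₚ.≤-trans (ℕₚ.<⇒≤ (Finₚ.toℕ<n base)) (ℕₚ.m≤n+m n a))
      y≤n : a ℕ.+ n ℕ.∸ b₀ ℕ.≤ n
      y≤n = ℕₚ.+-cancelˡ-≤ b₀ _ _ (subst (ℕ._≤ b₀ ℕ.+ n) (sym +-y) (ℕₚ.+-monoˡ-≤ n a≤b))

  -- The coefficient of a finite root at `base` is at least -1, so a positive level m must be 1 and
  -- the interval being subtracted from `c` must contain `base`. At level 0 the root is a finite
  -- interval missing `base`. Both are arcs.
  root-arc : ∀ γ → IsPositiveRealRoot γ → lookup γ base ℤ.≤ 0ℤ → ∃₂ λ x y → IsArc x y × γ ≡ ρ x y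
  root-arc γ ((x , m , root , eq) , sgn) γ≤0 = cases root sgn
    where
      at-base : lookup x base ℤ.+ m ℤ.≤ 0ℤ
      at-base = subst (ℤ._≤ 0ℤ) (trans (cong (λ t → lookup t base) eq) (trans (lookup-⊕ x (m • c) base)
        (cong (λ t → lookup x base ℤ.+ t) (trans (lookup-• m c base) (trans (cong (m ℤ.*_) (lookup-c base)) (ℤₚ.*-identityʳ m)))))) γ≤0
      fromρ : ∀ {z} → γ ≡ z → (∃₂ λ x y → IsArc x y × ρ x y ≡ z) → ∃₂ λ x y → IsArc x y × γ ≡ ρ x y
      fromρ eq (u , v , arc , e) = u , v , arc , trans eq (sym e)
      ¬1≤0 : ¬ 1ℤ ℤ.≤ 0ℤ
      ¬1≤0 (ℤ.+≤+ ())
      level-0 : m ≡ 0ℤ → γ ≡ x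
      level-0 m≡0 = trans eq (ext λ i → trans (lookup-⊕ x (m • c) i) (trans (cong (λ t → lookup x i ℤ.+ t)
        (trans (lookup-• m c i) (trans (cong (ℤ._* lookup c i) m≡0) (ℤₚ.*-zeroˡ (lookup c i))))) (ℤₚ.+-identityʳ _)))
      interval-≥0 : ∀ a e i → 0ℤ ℤ.≤ lookup (interval a e) i
      interval-≥0 a e i = decide ((a ℕ.≤? toℕ i) ×-dec (toℕ i ℕ.≤? e))
        where
          decide : Dec (a ℕ.≤ toℕ i × toℕ i ℕ.≤ e) → 0ℤ ℤ.≤ lookup (interval a e) i
          decide (yes (p , q)) = subst (0ℤ ℤ.≤_) (sym (interval-in a e i p q)) (ℤ.+≤+ z≤n)
          decide (no ¬p)       = subst (0ℤ ℤ.≤_) (sym (interval-out a e i ¬p)) ℤₚ.≤-refl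
      cases : IsFiniteRoot x → 0ℤ ℤ.< m ⊎ (m ≡ 0ℤ × IsFinitePositiveRoot x) → ∃₂ λ x y → IsArc x y × γ ≡ ρ x y
      cases _ (inj₂ (m≡0 , a , e , 1≤a , a≤e , e<n , x≡)) = fromρ (trans (level-0 m≡0) x≡) (interval-arc 1≤a a≤e e<n
        λ (p , q) → ¬1≤0 (subst (ℤ._≤ 0ℤ) (cong₂ ℤ._+_ (trans (cong (λ t → lookup t base) x≡) (interval-in a e base p q)) m≡0) at-base))
      cases (inj₁ (a , e , 1≤a , a≤e , e<n , x≡)) (inj₁ 0<m) = contradiction
        (ℤₚ.≤-trans (ℤₚ.+-mono-≤ {0ℤ} {lookup x base} {1ℤ} {m} (subst (λ t → 0ℤ ℤ.≤ lookup t base) (sym x≡) (interval-≥0 a e base)) (ℤₚ.i<j⇒suc[i]≤j 0<m)) at-base) ¬1≤0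
      cases (inj₂ (a , e , 1≤a , a≤e , e<n , ⊝x≡)) (inj₁ 0<m) = decide ((a ℕ.≤? b₀) ×-dec (b₀ ℕ.≤? e))
        where
          x≡ : x ≡ ⊝ interval a e
          x≡ = trans (sym (⊝-involutive x)) (cong ⊝_ ⊝x≡)
          x-base : lookup x base ≡ ℤ.- lookup (interval a e) base
          x-base = trans (cong (λ t → lookup t base) x≡) (lookup-⊝ (interval a e) base)
          cancel : ∀ m → 1ℤ ℤ.+ (-1ℤ ℤ.+ m) ≡ m
          cancel = solve-∀
          decide : Dec (a ℕ.≤ b₀ × b₀ ℕ.≤ e) → ∃₂ λ x y → IsArc x y × γ ≡ ρ x y
          decide (yes (p , q)) = fromρ (trans eq (trans (cong₂ (λ s t → s ⊕ t • c) x≡ m≡1) (sym (c⊖≡ (interval a e))))) (c⊖interval-arc 1≤a a≤e e<n p q)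
            where
              m≤1 : m ℤ.≤ 1ℤ
              m≤1 = subst (ℤ._≤ 1ℤ) (cancel m) (ℤₚ.+-monoʳ-≤ 1ℤ (subst (λ t → t ℤ.+ m ℤ.≤ 0ℤ)
                (trans x-base (cong ℤ.-_ (interval-in a e base p q))) at-base))
              m≡1 : m ≡ 1ℤ
              m≡1 = ℤₚ.≤-antisym m≤1 (ℤₚ.i<j⇒suc[i]≤j 0<m)
          decide (no ∉) = contradiction (ℤₚ.≤-trans (ℤₚ.i<j⇒suc[i]≤j 0<m) (subst (ℤ._≤ 0ℤ)
            (trans (cong (ℤ._+ m) (trans x-base (cong ℤ.-_ (interval-out a e base ∉)))) (ℤₚ.+-identityˡ m)) at-base)) ¬1≤0

  supp-ρ : ∀ {x y} → x ≤‴ y → y ℕ.≤ n → ∣ supp (ρ x y) ∣ ≡ y ℕ.∸ x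
  supp-ρ {x} ≤‴-refl _ = trans (count-empty (supp (ρ x x)) λ j → trans (Vecₚ.lookup-map j _ (ρ x x))
      (cong (λ a → not (does (a ℤ.≟ 0ℤ))) (subst (λ i → lookup (ρ x x) i ≡ 0ℤ) (vertex-pos j)
        (ρ-out x x (pos<n j) λ (p , q) → ℕₚ.<⇒≱ q p)))) (sym (ℕₚ.n∸n≡0 x))
  supp-ρ {x} {y} (≤‴-step x<‴y) y≤n = trans (count-insert (supp (ρ x y)) (supp (ρ (suc x) y)) (vertex x)
      (support x y (ρ-in x y x<n (ℕₚ.≤-refl , x<y))) (support (suc x) y (ρ-out (suc x) y x<n λ (p , _) → ℕₚ.<-irrefl refl p)) same)
      (trans (cong suc (supp-ρ x<‴y y≤n)) (sym (∸-step x<y)))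
    where
      x<y : x ℕ.< y
      x<y = ℕₚ.≤‴⇒≤ x<‴y
      x<n : x ℕ.< n
      x<n = ℕₚ.<-≤-trans x<y y≤n
      support : ∀ u v {i a} → lookup (ρ u v) i ≡ a → lookup (supp (ρ u v)) i ≡ not (does (a ℤ.≟ 0ℤ))
      support u v {i} e = trans (Vecₚ.lookup-map i _ (ρ u v)) (cong (λ a → not (does (a ℤ.≟ 0ℤ))) e)
      same : ∀ j → j ≢ vertex x → lookup (supp (ρ x y)) j ≡ lookup (supp (ρ (suc x) y)) j
      same j ne = trans (support x y {j} {lookup (ρ (suc x) y) j} (trans (cong (λ t → lookup t j) (ρ-split x<y y≤n)) (trans (lookup-⊕ (α (vertex x)) (ρ (suc x) y) j)
        (trans (cong (ℤ._+ lookup (ρ (suc x) y) j) (lookup-α-other (ne ∘ sym))) (ℤₚ.+-identityˡ _)))))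
        (sym (support (suc x) y {j} {lookup (ρ (suc x) y) j} refl))

  palindrome : ℕ → ℕ → List (Fin n)
  palindrome x zero          = []
  palindrome x (suc zero)    = vertex x ∷ []
  palindrome x (suc (suc l)) = vertex x ∷ palindrome (suc x) (suc l) ++ vertex x ∷ []

  -- Truncated subtraction gives an empty span the empty word, so spans that vanish under cutting
  -- stay meaningful.
  word : ℕ → ℕ → List (Fin n)
  word x y = palindrome x (y ℕ.∸ x)

  word-empty : ∀ {x y} → y ℕ.≤ x → word x y ≡ []
  word-empty {x} y≤x = cong (palindrome x) (ℕₚ.m≤n⇒m∸n≡0 y≤x)

  word-single : ∀ x → word x (suc x) ≡ vertex x ∷ []
  word-single x = cong (palindrome x) (ℕₚ.m+n∸n≡m 1 x)

  word-step : ∀ {x y} → suc x ℕ.< y → word x y ≡ vertex x ∷ word (suc x) y ++ vertex x ∷ []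
  word-step {x} {y} p = trans (cong (palindrome x) (trans (∸-step (ℕₚ.<-trans (ℕₚ.n<1+n x) p)) (cong suc (∸-step p))))
    (cong (λ l → vertex x ∷ palindrome (suc x) l ++ vertex x ∷ []) (sym (∸-step p)))

  length-palindrome : ∀ x l → length (palindrome x (suc l)) ≡ 2 ℕ.* suc l ℕ.∸ 1
  length-palindrome x zero    = refl
  length-palindrome x (suc l) = begin
      suc (length (palindrome (suc x) (suc l) ++ vertex x ∷ [])) ≡⟨ cong suc (Listₚ.length-++ (palindrome (suc x) (suc l))) ⟩
      suc (length (palindrome (suc x) (suc l)) ℕ.+ 1) ≡⟨ cong suc (ℕₚ.+-comm _ 1) ⟩
      suc (suc (length (palindrome (suc x) (suc l)))) ≡⟨ cong (λ t → suc (suc t)) (length-palindrome (suc x) l) ⟩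
      suc (suc (l ℕ.+ suc (l ℕ.+ 0))) ≡⟨ cong suc (sym (ℕₚ.+-suc l (suc (l ℕ.+ 0)))) ⟩
      suc (l ℕ.+ suc (suc (l ℕ.+ 0))) ∎
    where open ≡-Reasoning

  length-word : ∀ {x y} → IsArc x y → length (word x y) ≡ 2 ℕ.* ∣ supp (ρ x y) ∣ ℕ.∸ 1
  length-word {x} {y} (_ , x<y , y≤n) = begin
      length (palindrome x (y ℕ.∸ x)) ≡⟨ cong (λ l → length (palindrome x l)) (∸-step x<y) ⟩
      length (palindrome x (suc (y ℕ.∸ suc x))) ≡⟨ length-palindrome x (y ℕ.∸ suc x) ⟩
      2 ℕ.* suc (y ℕ.∸ suc x) ℕ.∸ 1 ≡⟨ cong (λ l → 2 ℕ.* l ℕ.∸ 1) (sym (∸-step x<y)) ⟩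
      2 ℕ.* (y ℕ.∸ x) ℕ.∸ 1 ≡⟨ cong (λ l → 2 ℕ.* l ℕ.∸ 1) (sym (supp-ρ (ℕₚ.≤⇒≤‴ (ℕₚ.<⇒≤ x<y)) y≤n)) ⟩
      2 ℕ.* ∣ supp (ρ x y) ∣ ℕ.∸ 1 ∎
    where open ≡-Reasoning

  All-word : ∀ {P : Fin n → Set} {x y} → (∀ k → In x y k → P (vertex k)) → All P (word x y)
  All-word {P} {x} {y} h = cases (x ℕ.<? y)
    where
      go : ∀ {x} → suc x ≤‴ y → (∀ k → In x y k → P (vertex k)) → All P (word x y)
      go {x} ≤‴-refl h = subst (All P) (sym (word-single x)) (h x (ℕₚ.≤-refl , ℕₚ.≤-refl) ∷ [])
      go {x} (≤‴-step p) h = subst (All P) (sym (word-step x+1<y))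
          (first ∷ Allₚ.++⁺ (go p λ k (q , r) → h k (ℕₚ.<⇒≤ q , r)) (first ∷ []))
        where
          x+1<y : suc x ℕ.< y
          x+1<y = ℕₚ.≤‴⇒≤ p
          first : P (vertex x)
          first = h x (ℕₚ.≤-refl , ℕₚ.<-trans (ℕₚ.n<1+n x) x+1<y)
      cases : Dec (x ℕ.< y) → All P (word x y)
      cases (yes p) = go (ℕₚ.≤⇒≤‴ p) h
      cases (no ¬p) = subst (All P) (sym (word-empty (ℕₚ.≮⇒≥ ¬p))) []

  σ : ∀ {x y} → IsArc x y → W
  σ arc = s (proj₁ (ρ-positive arc))

  Root-ρ : ∀ {x y} → IsArc x y → Root (ρ x y)
  Root-ρ arc = ReflectionInW.norm (realRoot∈W (proj₁ (ρ-positive arc)))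

  σ-self-inverse : ∀ {x y} (arc : IsArc x y) → σ arc ≈ σ arc ⁻¹
  σ-self-inverse {x} {y} arc = inverse-unique (σ arc) (σ arc) (reflect-involutive (ρ x y) (Root-ρ arc))

  -- Conjugating τ, the reflection in the arc without its first vertex v, by s_v gives the
  -- reflection in the whole arc. Both new letters lengthen: τ sends `α v` to `ρ x y`, and s_v sends
  -- that to `ρ (suc x) y`, both positive. Hence Hecke and ordinary products agree and the length
  -- grows by 2.
  word-σ : ∀ {x y} (p : suc x ≤‴ y) (arc : IsArc x y) →
           ε ★ word x y ≈ σ arc × ⟪ word x y ⟫ ≈ σ arc × ℓ (σ arc) ≡ length (word x y)
  word-σ {x} ≤‴-refl arc@(_ , _ , x<n) =
      (λ μ → trans (cong (λ is → to (ε ★ is) μ) (word-single x)) (trans (≡⇒≈ (⋆-Pos ε (vertex x) (Pos-α (vertex x))) μ) (single μ))) ,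
      (λ μ → trans (cong (λ is → ⟦ is ⟧ μ) (word-single x)) (single μ)) ,
      trans (ℓ-cong (σ arc) (ε ∙ simple (vertex x)) (sym ∘ single))
        (trans (ℓ-Pos ε (vertex x) (Pos-α (vertex x))) (trans (cong suc ℓ-ε) (cong length (sym (word-single x)))))
    where
      single : ∀ μ → reflect (α (vertex x)) μ ≡ reflect (ρ x (suc x)) μ
      single μ = cong (λ t → reflect t μ) (sym (ρ≡α x<n))
  word-σ {x} {y} (≤‴-step p) arc@(1≤x , x<y , y≤n) = hecke , expr , len
    where
      x+1<y : suc x ℕ.< y
      x+1<y = ℕₚ.≤‴⇒≤ p
      arc′ : IsArc (suc x) y
      arc′ = s≤s z≤n , x+1<y , y≤n
      w : List (Fin n)
      w = word (suc x) y
      v : Fin n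
      v = vertex x
      τ : W
      τ = σ arc′
      step : word x y ≡ v ∷ w ++ v ∷ []
      step = word-step x+1<y
      ih = word-σ p arc′
      ρ-sum : ∀ γ δ → ⟨ γ , δ ⟩ ≡ -1ℤ → reflect δ γ ≡ δ ⊕ γ
      ρ-sum γ δ e = ext λ i → trans (lookup-reflect δ γ i) (trans (cong (λ t → lookup γ i ℤ.- t ℤ.* lookup δ i) e)
          (trans (identity (lookup γ i) (lookup δ i)) (sym (lookup-⊕ δ γ i))))
        where
          identity : ∀ a b → a ℤ.- -1ℤ ℤ.* b ≡ b ℤ.+ a
          identity = solve-∀
      pairing : ⟨ ρ (suc x) y , α v ⟩ ≡ -1ℤ
      pairing = form-ρ-before 1≤x x+1<y y≤n
      reflect-α : reflect (α v) (ρ (suc x) y) ≡ ρ x y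
      reflect-α = trans (ρ-sum (ρ (suc x) y) (α v) pairing) (sym (ρ-split x<y y≤n))
      τα : to τ (α v) ≡ ρ x y
      τα = trans (ρ-sum (α v) (ρ (suc x) y) (trans (form-sym (α v) (ρ (suc x) y)) pairing))
        (trans (⊕-comm (ρ (suc x) y) (α v)) (sym (ρ-split x<y y≤n)))
      conjugate : ∀ μ → reflect (α v) (reflect (ρ (suc x) y) (reflect (α v) μ)) ≡ reflect (ρ x y) μ
      conjugate μ = trans (sym (reflect-reflect (α v) (ρ (suc x) y) (Root-α v) μ)) (cong (λ t → reflect t μ) reflect-α)
      pos₁ : Pos (to (τ ⁻¹) (α v))
      pos₁ = subst Pos (trans (sym τα) (σ-self-inverse arc′ (α v))) (Pos-ρ x y)
      pos₂ : Pos (to (simple v ∙ τ) (α v))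
      pos₂ = subst Pos (sym (trans (cong (reflect (α v)) (trans τα (sym reflect-α))) (simple-involutive v (ρ (suc x) y)))) (Pos-ρ (suc x) y)
      hecke : ε ★ word x y ≈ σ arc
      hecke μ = begin
          to (ε ★ word x y) μ ≡⟨ cong (λ is → to (ε ★ is) μ) step ⟩
          to (ε ★ ((v ∷ w) ++ v ∷ [])) μ ≡⟨ ≡⇒≈ (★-++ ε (v ∷ w) (v ∷ [])) μ ⟩
          to ((ε ★ (v ∷ w)) ⋆ v) μ ≡⟨ ⋆-cong (ε ★ (v ∷ w)) (simple v ∙ τ) v
            (λ ν → trans (first-letter v τ w (proj₁ ih) ν) (left-Pos v τ pos₁ ν)) μ ⟩
          to ((simple v ∙ τ) ⋆ v) μ ≡⟨ ≡⇒≈ (⋆-Pos (simple v ∙ τ) v pos₂) μ ⟩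
          to (simple v ∙ τ ∙ simple v) μ ≡⟨ conjugate μ ⟩
          to (σ arc) μ ∎
        where open ≡-Reasoning
      expr : ⟪ word x y ⟫ ≈ σ arc
      expr μ = trans (cong (λ is → ⟦ is ⟧ μ) step) (trans (cong (reflect (α v)) (trans (⟦⟧-++ w (v ∷ []) μ)
        (proj₁ (proj₂ ih) (reflect (α v) μ)))) (conjugate μ))
      len : ℓ (σ arc) ≡ length (word x y)
      len = begin
          ℓ (σ arc) ≡⟨ ℓ-cong (σ arc) (simple v ∙ τ ∙ simple v) (sym ∘ conjugate) ⟩
          ℓ (simple v ∙ τ ∙ simple v) ≡⟨ ℓ-Pos (simple v ∙ τ) v pos₂ ⟩
          suc (ℓ (simple v ∙ τ)) ≡⟨ cong suc (sym (ℓ-⁻¹ (simple v ∙ τ))) ⟩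
          suc (ℓ ((simple v ∙ τ) ⁻¹)) ≡⟨ cong suc (ℓ-cong ((simple v ∙ τ) ⁻¹) (τ ⁻¹ ∙ simple v) (sym ∘ simple∙⁻¹ τ v)) ⟩
          suc (ℓ (τ ⁻¹ ∙ simple v)) ≡⟨ cong suc (ℓ-Pos (τ ⁻¹) v pos₁) ⟩
          suc (suc (ℓ (τ ⁻¹))) ≡⟨ cong (λ t → suc (suc t)) (trans (ℓ-⁻¹ τ) (proj₂ (proj₂ ih))) ⟩
          suc (suc (length w)) ≡⟨ cong suc (sym (trans (Listₚ.length-++ w) (ℕₚ.+-comm (length w) 1))) ⟩
          suc (length (w ++ v ∷ [])) ≡⟨ cong length (sym step) ⟩
          length (word x y) ∎
        where open ≡-Reasoning

  module _ {x y} (arc : IsArc x y) where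

    private
      facts : ε ★ word x y ≈ σ arc × ⟪ word x y ⟫ ≈ σ arc × ℓ (σ arc) ≡ length (word x y)
      facts = word-σ (ℕₚ.≤⇒≤‴ (proj₁ (proj₂ arc))) arc

    ★-word : ε ★ word x y ≈ σ arc
    ★-word = proj₁ facts

    ⟪word⟫ : ⟪ word x y ⟫ ≈ σ arc
    ⟪word⟫ = proj₁ (proj₂ facts)

    ℓ-σ : ℓ (σ arc) ≡ length (word x y)
    ℓ-σ = proj₂ (proj₂ facts)

-- Combinatorics of cutting spans.

-- Only an end equal to a moves, and only by one. A maximum with `suc a` would also change spans
-- lying to the left of a.
cutˡ : ℕ → ℕ → ℕ
cutˡ a x with x ℕ.≟ a
... | yes _ = suc x
... | no _  = x

cutʳ : ℕ → ℕ → ℕ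
cutʳ b y with y ℕ.≟ b
... | yes _ = ℕ.pred y
... | no _  = y

cutˡ-≡ : ∀ a → cutˡ a a ≡ suc a
cutˡ-≡ a with a ℕ.≟ a
... | yes _ = refl
... | no ne = contradiction refl ne

cutˡ-≢ : ∀ {a x} → x ≢ a → cutˡ a x ≡ x
cutˡ-≢ {a} {x} ne with x ℕ.≟ a
... | yes e = contradiction e ne
... | no _  = refl

cutʳ-≡ : ∀ b → cutʳ b b ≡ ℕ.pred b
cutʳ-≡ b with b ℕ.≟ b
... | yes _ = refl
... | no ne = contradiction refl ne

cutʳ-≢ : ∀ {b y} → y ≢ b → cutʳ b y ≡ y
cutʳ-≢ {b} {y} ne with y ℕ.≟ b
... | yes e = contradiction e ne
... | no _  = refl

≤-cutˡ : ∀ a x → x ℕ.≤ cutˡ a x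
≤-cutˡ a x with x ℕ.≟ a
... | yes _ = ℕₚ.n≤1+n x
... | no _  = ℕₚ.≤-refl

cutʳ-≤ : ∀ b y → cutʳ b y ℕ.≤ y
cutʳ-≤ b y with y ℕ.≟ b
... | yes _ = ℕₚ.pred[n]≤n
... | no _  = ℕₚ.≤-refl

cutˡ-mono : ∀ a {x u} → x ℕ.≤ u → cutˡ a x ℕ.≤ cutˡ a u
cutˡ-mono a {x} {u} x≤u with x ℕ.≟ a | u ℕ.≟ a
... | yes _    | yes _ = s≤s x≤u
... | yes refl | no ne = ℕₚ.≤∧≢⇒< x≤u (ne ∘ sym)
... | no _     | yes _ = ℕₚ.≤-trans x≤u (ℕₚ.n≤1+n u)
... | no _     | no _  = x≤u

cutʳ-mono : ∀ b {v y} → v ℕ.≤ y → cutʳ b v ℕ.≤ cutʳ b y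
cutʳ-mono b {v} {y} v≤y with v ℕ.≟ b | y ℕ.≟ b
... | yes _ | yes _    = ℕₚ.pred-mono-≤ v≤y
... | yes _ | no _     = ℕₚ.≤-trans ℕₚ.pred[n]≤n v≤y
... | no ne | yes refl = ℕₚ.<⇒≤pred (ℕₚ.≤∧≢⇒< v≤y ne)
... | no _  | no _     = v≤y

<-cutˡ : ∀ {a x} → a ℕ.≤ x → a ℕ.< cutˡ a x
<-cutˡ {a} {x} a≤x with x ℕ.≟ a
... | yes refl = ℕₚ.≤-refl
... | no ne    = ℕₚ.≤∧≢⇒< a≤x (ne ∘ sym)

cutʳ-< : ∀ {a b y} → a ℕ.< b → y ℕ.≤ b → cutʳ b y ℕ.< b
cutʳ-< {a} {b} {y} a<b y≤b with y ℕ.≟ b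
cutʳ-< {a} {suc b} _ _ | yes refl = ℕₚ.≤-refl
... | no ne = ℕₚ.≤∧≢⇒< y≤b ne

-- (x , y) stands for the positions x, …, y - 1; it is empty if y ≤ x.
Span : Set
Span = ℕ × ℕ

_⊑_ Nested Laminar : Span → Span → Set
(u , v) ⊑ (x , y) = x ℕ.≤ u × v ℕ.≤ y
-- Spans are half-open, so the strict inequality leaves at least one position between them: the
-- supports are not merely disjoint but disconnected.
Apart : Span → Span → Set
Apart (x , y) (u , v) = v ℕ.< x ⊎ y ℕ.< u
Nested A B = B ⊑ A ⊎ Apart A B
Laminar A@(x , y) B@(u , v) = (x ℕ.< u × v ℕ.< y) ⊎ Apart A B

cut : Span → Span → Span
cut (a , b) (x , y) = cutˡ a x , cutʳ b y

cut-⊑ : ∀ A B → cut A B ⊑ B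
cut-⊑ (a , b) (x , y) = ≤-cutˡ a x , cutʳ-≤ b y

⊑-trans : ∀ {A B C} → A ⊑ B → B ⊑ C → A ⊑ C
⊑-trans (p , q) (r , t) = ℕₚ.≤-trans r p , ℕₚ.≤-trans q t

Apart-⊑ : ∀ {A B C D} → C ⊑ A → D ⊑ B → Apart A B → Apart C D
Apart-⊑ (p , q) (r , t) (inj₁ h) = inj₁ (ℕₚ.≤-<-trans t (ℕₚ.<-≤-trans h p))
Apart-⊑ (p , q) (r , t) (inj₂ h) = inj₂ (ℕₚ.≤-<-trans q (ℕₚ.<-≤-trans h r))

-- Cutting both spans at the same places is monotone, so inclusion persists, and apartness persists
-- because spans only shrink. Thus the cut tail is again a valid input.
Nested-cut : ∀ A {B C} → Nested B C → Nested (cut A B) (cut A C)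
Nested-cut (a , b) (inj₁ (p , q)) = inj₁ (cutˡ-mono a p , cutʳ-mono b q)
Nested-cut A {B} {C} (inj₂ h)     = inj₂ (Apart-⊑ {B} {C} (cut-⊑ A B) (cut-⊑ A C) h)

Laminar-cut : ∀ {a b} B → a ℕ.< b → Nested (a , b) B → Laminar (a , b) (cut (a , b) B)
Laminar-cut {a} {b} (x , y) a<b (inj₁ (p , q)) = inj₁ (<-cutˡ p , cutʳ-< a<b q)
Laminar-cut {a} {b} B a<b (inj₂ h) = inj₂ (Apart-⊑ {a , b} {B} (ℕₚ.≤-refl , ℕₚ.≤-refl) (cut-⊑ (a , b) B) h)

Laminar-⊑ : ∀ {A B C} → C ⊑ B → Laminar A B → Laminar A C
Laminar-⊑ (p , q) (inj₁ (r , t)) = inj₁ (ℕₚ.<-≤-trans r p , ℕₚ.≤-<-trans q t)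
Laminar-⊑ {A} {B} {C} h (inj₂ apart) = inj₂ (Apart-⊑ {A} {B} (ℕₚ.≤-refl , ℕₚ.≤-refl) h apart)

AllPairs-Nested-cut : ∀ A L → AllPairs Nested L → AllPairs Nested (List.map (cut A) L)
AllPairs-Nested-cut A []      []       = []
AllPairs-Nested-cut A (B ∷ L) (h ∷ hs) = Allₚ.map⁺ (All.map (Nested-cut A {B}) h) ∷ AllPairs-Nested-cut A L hs

-- Rewriting words in the Hecke monoid.

module Rewriting (n : ℕ) (3≤n : 3 ℕ.≤ n) where
  open Affine n 3≤n
  open Roots n 3≤n
  open Hecke n 3≤n

  infix 4 _≋_
  -- Equality in the Hecke monoid, seen through its right action. Quantifying over u makes it a
  -- congruence, while `≋-ε` allows it to be tested at `ε`.
  record _≋_ (is js : List (Fin n)) : Set where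
    constructor mk≋
    field same : ∀ u → u ★ is ≈ u ★ js
  open _≋_ public

  ≋-refl : ∀ {is} → is ≋ is
  ≋-refl = mk≋ λ u μ → refl

  ≋-reflexive : ∀ {is js} → is ≡ js → is ≋ js
  ≋-reflexive refl = ≋-refl

  ≋-sym : ∀ {is js} → is ≋ js → js ≋ is
  ≋-sym h = mk≋ λ u μ → sym (same h u μ)

  ≋-trans : ∀ {is js ks} → is ≋ js → js ≋ ks → is ≋ ks
  ≋-trans h k = mk≋ λ u μ → trans (same h u μ) (same k u μ)

  ≋-++ : ∀ {is js ks ls} → is ≋ js → ks ≋ ls → is ++ ks ≋ js ++ ls
  ≋-++ {is} {js} {ks} {ls} h k = mk≋ λ u μ → begin
      to (u ★ (is ++ ks)) μ ≡⟨ ≡⇒≈ (★-++ u is ks) μ ⟩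
      to (u ★ is ★ ks) μ ≡⟨ ★-cong (u ★ is) (u ★ js) ks (same h u) μ ⟩
      to (u ★ js ★ ks) μ ≡⟨ same k (u ★ js) μ ⟩
      to (u ★ js ★ ls) μ ≡⟨ sym (≡⇒≈ (★-++ u js ls) μ) ⟩
      to (u ★ (js ++ ls)) μ ∎
    where open ≡-Reasoning

  ≋-assoc : ∀ is js ks → (is ++ js) ++ ks ≋ is ++ (js ++ ks)
  ≋-assoc is js ks = ≋-reflexive (Listₚ.++-assoc is js ks)

  ≋-ε : ∀ {is js} → ε ★ is ≈ ε ★ js → is ≋ js
  ≋-ε {is} {js} h = mk≋ (★-ext is js h)

  absorbs : ∀ w v e → ε ★ w ≈ v → Neg (to v (α e)) → w ++ e ∷ [] ≋ w
  absorbs w v e eq neg = ≋-ε λ μ → trans (≡⇒≈ (★-++ ε w (e ∷ [])) μ)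
    (trans (⋆-cong (ε ★ w) v e eq μ) (trans (≡⇒≈ (⋆-Neg v e neg) μ) (sym (eq μ))))

  idempotent : ∀ i → i ∷ i ∷ [] ≋ i ∷ []
  idempotent i = absorbs (i ∷ []) (simple i) i (λ μ → ≡⇒≈ (⋆-Pos ε i (Pos-α i)) μ)
    (subst Neg (sym (reflect-α-α i)) (Neg-⊝ (α i) (Pos-α i)))

  -- v commutes with s_j, and the inverse of v fixes `α j` too. So s_j lengthens v on either side,
  -- and both Hecke products are the same ordinary product.
  commutes : ∀ w v j → ε ★ w ≈ v → Fixes v j → w ++ j ∷ [] ≋ j ∷ w
  commutes w v j eq fix = ≋-ε λ μ → begin
      to (ε ★ (w ++ j ∷ [])) μ ≡⟨ ≡⇒≈ (★-++ ε w (j ∷ [])) μ ⟩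
      to ((ε ★ w) ⋆ j) μ ≡⟨ ⋆-cong (ε ★ w) v j eq μ ⟩
      to (v ⋆ j) μ ≡⟨ ≡⇒≈ (⋆-Pos v j (subst Pos (sym fix) (Pos-α j))) μ ⟩
      to v (reflect (α j) μ) ≡⟨ fixes-commutes v j fix μ ⟩
      reflect (α j) (to v μ) ≡⟨ sym (left-Pos j v (subst Pos (sym fix⁻¹) (Pos-α j)) μ) ⟩
      to (left j v) μ ≡⟨ sym (first-letter j v w eq μ) ⟩
      to (ε ★ (j ∷ w)) μ ∎
    where
      open ≡-Reasoning
      fix⁻¹ : to (v ⁻¹) (α j) ≡ α j
      fix⁻¹ = trans (cong (to (v ⁻¹)) (sym fix)) (inverseˡ v (α j))

  Movable : List (Fin n) → Fin n → Set
  Movable w j = w ++ j ∷ [] ≋ w ⊎ w ++ j ∷ [] ≋ j ∷ w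

  -- Whether j is absorbed or passed, w arrives directly in front of the rest, where the hypothesis
  -- applies; the move is then undone.
  Movable-∷ : ∀ w j {is js} → Movable w j → w ++ is ≋ w ++ js → w ++ j ∷ is ≋ w ++ j ∷ js
  Movable-∷ w j {is} {js} m h = ≋-trans (≋-sym (≋-assoc w (j ∷ []) is)) (≋-trans (cases m) (≋-assoc w (j ∷ []) js))
    where
      cases : Movable w j → (w ++ j ∷ []) ++ is ≋ (w ++ j ∷ []) ++ js
      cases (inj₁ p) = ≋-trans (≋-++ p ≋-refl) (≋-trans h (≋-++ (≋-sym p) ≋-refl))
      cases (inj₂ p) = ≋-trans (≋-++ p ≋-refl) (≋-trans (≋-++ (≋-refl {j ∷ []}) h) (≋-++ (≋-sym p) ≋-refl))

  -- Past any sequence of movable letters w remains available to absorb e.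
  drop-last : ∀ w e is → w ++ e ∷ [] ≋ w → All (Movable w) is → w ++ (is ++ e ∷ []) ≋ w ++ is
  drop-last w e []       absorb []       = ≋-trans absorb (≋-reflexive (sym (Listₚ.++-identityʳ w)))
  drop-last w e (i ∷ is) absorb (m ∷ ms) = Movable-∷ w i m (drop-last w e is absorb ms)

  drop-first : ∀ w e is → w ++ e ∷ [] ≋ w → w ++ e ∷ is ≋ w ++ is
  drop-first w e is absorb = ≋-trans (≋-sym (≋-assoc w (e ∷ []) is)) (≋-++ absorb ≋-refl)

  commutes-++ : ∀ w is → All (λ j → w ++ j ∷ [] ≋ j ∷ w) is → w ++ is ≋ is ++ w
  commutes-++ w []       []       = ≋-reflexive (Listₚ.++-identityʳ w)
  commutes-++ w (i ∷ is) (h ∷ hs) = ≋-trans (≋-sym (≋-assoc w (i ∷ []) is))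
    (≋-trans (≋-++ h ≋-refl) (≋-++ (≋-refl {i ∷ []}) (commutes-++ w is hs)))

-- Deleting the ends of an arc from later words, and the resulting normal form.

module Insertion (n : ℕ) (3≤n : 3 ℕ.≤ n) (base : Fin n) where
  open Affine n 3≤n
  open Roots n 3≤n
  open Hecke n 3≤n
  open Arcs n 3≤n base
  open Words n 3≤n base
  open Rewriting n 3≤n

  Bounded : Span → Set
  Bounded (x , y) = 1 ℕ.≤ x × y ℕ.≤ n

  word′ : Span → List (Fin n)
  word′ (x , y) = word x y

  words : List Span → List (Fin n)
  words = List.concatMap word′

  module _ {a b} (arc : IsArc a b) where

    private
      A : Span
      A = a , b
      w : List (Fin n)
      w = word a b
      1≤a : 1 ℕ.≤ a
      1≤a = proj₁ arc
      a<b : a ℕ.< b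
      a<b = proj₁ (proj₂ arc)
      b≤n : b ℕ.≤ n
      b≤n = proj₂ (proj₂ arc)

    endpoint-absorbed : ∀ k → Endpoint a b k → w ++ vertex k ∷ [] ≋ w
    endpoint-absorbed k end = absorbs w (σ arc) (vertex k) (★-word arc) (reflect-ρ-endpoint a b k 1≤a b≤n end)

    σ-fixes : ∀ {k} → 1 ℕ.≤ k → k ℕ.< n → Inside a b k ⊎ Outside a b k → Fixes (σ arc) (vertex k)
    σ-fixes {k} 1≤k k<n h = reflect-ρ-fixes a b k 1≤a b≤n 1≤k k<n h

    distant-commutes : ∀ {k} → 1 ℕ.≤ k → k ℕ.< n → Inside a b k ⊎ Outside a b k → w ++ vertex k ∷ [] ≋ vertex k ∷ w
    distant-commutes {k} 1≤k k<n h = commutes w (σ arc) (vertex k) (★-word arc) (σ-fixes 1≤k k<n h)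

    in-movable : ∀ k → In a b k → Movable w (vertex k)
    in-movable k p@(a≤k , k<b) = cases (k ℕ.≟ a) (suc k ℕ.≟ b)
      where
        cases : Dec (k ≡ a) → Dec (suc k ≡ b) → Movable w (vertex k)
        cases (yes e) _       = inj₁ (endpoint-absorbed k (p , inj₁ e))
        cases (no _)  (yes e) = inj₁ (endpoint-absorbed k (p , inj₂ e))
        cases (no ¬e) (no ¬f) = inj₂ (distant-commutes (ℕₚ.≤-trans 1≤a a≤k) (ℕₚ.<-≤-trans k<b b≤n)
          (inj₁ (ℕₚ.≤∧≢⇒< a≤k (¬e ∘ sym) , ℕₚ.≤∧≢⇒< k<b ¬f)))

    Laminar-letter : ∀ B k → Laminar A B → In (proj₁ B) (proj₂ B) k → Inside a b k ⊎ Outside a b k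
    Laminar-letter (x , y) k (inj₁ (p , q)) (r , t)        = inj₁ (ℕₚ.<-≤-trans p r , ℕₚ.≤-<-trans t q)
    Laminar-letter (x , y) k (inj₂ (inj₁ y<a)) (r , t)     = inj₂ (inj₁ (ℕₚ.≤-<-trans t y<a))
    Laminar-letter (x , y) k (inj₂ (inj₂ b<x)) (r , t)     = inj₂ (inj₂ (ℕₚ.<-≤-trans b<x r))

    Laminar-fixes : ∀ B → Bounded B → Laminar A B → All (Fixes (σ arc)) (word′ B)
    Laminar-fixes B@(x , y) (1≤x , y≤n) h = All-word λ k p@(x≤k , k<y) →
      σ-fixes (ℕₚ.≤-trans 1≤x x≤k) (ℕₚ.<-≤-trans k<y y≤n) (Laminar-letter B k h p)

    Laminar-commutes : ∀ B → Bounded B → Laminar A B → w ++ word′ B ≋ word′ B ++ w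
    Laminar-commutes B@(x , y) (1≤x , y≤n) h = commutes-++ w (word x y) (All-word λ k p@(x≤k , k<y) →
      distant-commutes (ℕₚ.≤-trans 1≤x x≤k) (ℕₚ.<-≤-trans k<y y≤n) (Laminar-letter B k h p))

    -- Vertex a occurs only as the outermost letters of the palindrome. The first copy meets w at
    -- once, the last one after movable letters.
    cut-first : ∀ y → a ℕ.< y → y ℕ.≤ b → w ++ word a y ≋ w ++ word (suc a) y
    cut-first y a<y y≤b = cases (ℕₚ.m≤n⇒m<n∨m≡n a<y)
      where
        absorb : w ++ vertex a ∷ [] ≋ w
        absorb = endpoint-absorbed a ((ℕₚ.≤-refl , a<b) , inj₁ refl)
        cases : suc a ℕ.< y ⊎ suc a ≡ y → w ++ word a y ≋ w ++ word (suc a) y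
        cases (inj₁ p) = ≋-trans (≋-reflexive (cong (w ++_) (word-step p))) (≋-trans (drop-first w (vertex a) _ absorb)
          (drop-last w (vertex a) (word (suc a) y) absorb (All-word λ k (q , r) → in-movable k (ℕₚ.<⇒≤ q , ℕₚ.<-≤-trans r y≤b))))
        cases (inj₂ refl) = ≋-trans (≋-reflexive (cong (w ++_) (word-single a))) (≋-trans absorb
          (≋-reflexive (sym (trans (cong (w ++_) (word-empty {suc a} {suc a} ℕₚ.≤-refl)) (Listₚ.++-identityʳ w)))))

  -- The last vertex b is the middle letter of the palindrome. Induction passes through the outer
  -- letters, which are movable, until b stands directly behind w and is absorbed.
  cut-last : ∀ {a b} (arc : IsArc a (suc b)) {x} → suc x ≤‴ suc b → a ℕ.≤ x → word a (suc b) ++ word x (suc b) ≋ word a (suc b) ++ word x b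
  cut-last {a} {b} arc ≤‴-refl a≤x = ≋-trans (≋-reflexive (cong (word a (suc b) ++_) (word-single b)))
    (≋-trans (endpoint-absorbed arc b ((a≤x , ℕₚ.≤-refl) , inj₂ refl))
      (≋-reflexive (sym (trans (cong (word a (suc b) ++_) (word-empty {b} {b} ℕₚ.≤-refl)) (Listₚ.++-identityʳ _)))))
  cut-last {a} {b} arc {x} (≤‴-step p) a≤x = ≋-trans (≋-reflexive (cong (w ++_) (word-step x+1<b+1)))
      (≋-trans (Movable-∷ w (vertex x) (in-movable arc x (a≤x , x<b+1)) inner) (last (ℕₚ.m≤n⇒m<n∨m≡n (ℕₚ.≤-pred x+1<b+1))))
    where
      w : List (Fin n)
      w = word a (suc b)
      x+1<b+1 : suc x ℕ.< suc b
      x+1<b+1 = ℕₚ.≤‴⇒≤ p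
      x<b+1 : x ℕ.< suc b
      x<b+1 = ℕₚ.<-trans (ℕₚ.n<1+n x) x+1<b+1
      inner : w ++ (word (suc x) (suc b) ++ vertex x ∷ []) ≋ w ++ (word (suc x) b ++ vertex x ∷ [])
      inner = ≋-trans (≋-sym (≋-assoc w (word (suc x) (suc b)) _)) (≋-trans
        (≋-++ (cut-last arc p (ℕₚ.≤-trans a≤x (ℕₚ.n≤1+n x))) ≋-refl) (≋-assoc w (word (suc x) b) _))
      last : suc x ℕ.< b ⊎ suc x ≡ b → w ++ vertex x ∷ word (suc x) b ++ vertex x ∷ [] ≋ w ++ word x b
      last (inj₁ q)    = ≋-reflexive (cong (w ++_) (sym (word-step q)))
      -- With the middle letter gone its two neighbours meet; they are equal and merge by
      -- idempotence.
      last (inj₂ refl) = ≋-++ (≋-refl {w}) (≋-trans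
        (≋-reflexive (cong (λ t → vertex x ∷ t ++ vertex x ∷ []) (word-empty {suc x} {suc x} ℕₚ.≤-refl)))
        (≋-trans (idempotent (vertex x)) (≋-reflexive (sym (word-single x)))))

  cut-word : ∀ {a b} → IsArc a b → ∀ B → Nested (a , b) B → word a b ++ word′ B ≋ word a b ++ word′ (cut (a , b) B)
  cut-word {a} {suc b} arc@(1≤a , a<b , b≤n) (x , y) nested = nonempty (x ℕ.<? y)
    where
      w : List (Fin n)
      w = word a (suc b)
      unchanged : ∀ {x y x′ y′} → x ≡ x′ → y ≡ y′ → w ++ word x y ≋ w ++ word x′ y′
      unchanged refl refl = ≋-refl
      right : ∀ x y → a ℕ.≤ x → y ℕ.≤ suc b → w ++ word x y ≋ w ++ word x (cutʳ (suc b) y)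
      right x y a≤x y≤b = cases (y ℕ.≟ suc b) (x ℕ.<? y)
        where
          cases : Dec (y ≡ suc b) → Dec (x ℕ.< y) → w ++ word x y ≋ w ++ word x (cutʳ (suc b) y)
          cases (yes refl) (yes p) = ≋-trans (cut-last arc (ℕₚ.≤⇒≤‴ p) a≤x) (unchanged refl (sym (cutʳ-≡ (suc b))))
          cases (no ne)    _       = unchanged refl (sym (cutʳ-≢ ne))
          cases (yes _)    (no ¬p) = ≋-reflexive (cong (w ++_) (trans (word-empty (ℕₚ.≮⇒≥ ¬p))
            (sym (word-empty (ℕₚ.≤-trans (cutʳ-≤ (suc b) y) (ℕₚ.≮⇒≥ ¬p))))))
      nonempty : Dec (x ℕ.< y) → w ++ word x y ≋ w ++ word (cutˡ a x) (cutʳ (suc b) y)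
      nonempty (no ¬p) = ≋-reflexive (cong (w ++_) (trans (word-empty (ℕₚ.≮⇒≥ ¬p))
        (sym (word-empty (ℕₚ.≤-trans (cutʳ-≤ (suc b) y) (ℕₚ.≤-trans (ℕₚ.≮⇒≥ ¬p) (≤-cutˡ a x)))))))
      nonempty (yes x<y) = cases nested (x ℕ.≟ a)
        where
          cases : Nested (a , suc b) (x , y) → Dec (x ≡ a) → w ++ word x y ≋ w ++ word (cutˡ a x) (cutʳ (suc b) y)
          cases (inj₁ (a≤x , y≤b)) (yes refl) = ≋-trans (cut-first arc y x<y y≤b) (≋-trans
            (right (suc a) y (ℕₚ.n≤1+n a) y≤b) (unchanged (sym (cutˡ-≡ a)) refl))
          cases (inj₁ (a≤x , y≤b)) (no ne) = ≋-trans (right x y a≤x y≤b) (unchanged (sym (cutˡ-≢ ne)) refl)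
          -- A nonempty span apart from A shares neither end with it, so the cut leaves it alone.
          cases (inj₂ (inj₁ y<a)) _ = unchanged (sym (cutˡ-≢ (ℕₚ.<⇒≢ (ℕₚ.<-trans x<y y<a)))) (sym (cutʳ-≢ (ℕₚ.<⇒≢ (ℕₚ.<-trans y<a a<b))))
          cases (inj₂ (inj₂ b<x)) _ = unchanged (sym (cutˡ-≢ (ℕₚ.<⇒≢ (ℕₚ.<-trans a<b b<x) ∘ sym))) (sym (cutʳ-≢ (ℕₚ.<⇒≢ (ℕₚ.<-trans b<x x<y) ∘ sym)))

  Bounded-cut : ∀ A B → Bounded B → Bounded (cut A B)
  Bounded-cut (a , b) (x , y) (1≤x , y≤n) = ℕₚ.≤-trans 1≤x (≤-cutˡ a x) , ℕₚ.≤-trans (cutʳ-≤ b y) y≤n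

  -- Once B is cut it is laminar with the arc, so w commutes with its word. Hence w can slide past
  -- it, cut the rest of the list, and slide back.
  cut-words : ∀ {a b} → IsArc a b → ∀ L → All Bounded L → All (Nested (a , b)) L →
              word a b ++ words L ≋ word a b ++ words (List.map (cut (a , b)) L)
  cut-words arc [] [] [] = ≋-refl
  cut-words {a} {b} arc (B ∷ L) (bd ∷ bds) (h ∷ hs) =
      ≋-trans (≋-sym (≋-assoc w (word′ B) (words L))) (
      ≋-trans (≋-++ (≋-trans (cut-word arc B h) slide) ≋-refl) (
      ≋-trans (≋-assoc (word′ B′) w (words L)) (
      ≋-trans (≋-++ (≋-refl {word′ B′}) (cut-words arc L bds hs)) (
      ≋-trans (≋-sym (≋-assoc (word′ B′) w (words L′))) (
      ≋-trans (≋-++ (≋-sym slide) ≋-refl) (≋-assoc w (word′ B′) (words L′)))))))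
    where
      w : List (Fin n)
      w = word a b
      B′ : Span
      B′ = cut (a , b) B
      L′ : List Span
      L′ = List.map (cut (a , b)) L
      slide : w ++ word′ B′ ≋ word′ B′ ++ w
      slide = Laminar-commutes arc B′ (Bounded-cut (a , b) B bd) (Laminar-cut B (proj₁ (proj₂ arc)) h)

  record Normal (L : List Span) : Set where
    field
      spans   : List Span
      arcs    : All (λ (x , y) → IsArc x y) spans
      laminar : AllPairs Laminar spans
      same-z  : words L ≋ words spans
      -- Needed for the induction: laminarity of a new head with the cut list carries over to the
      -- spans produced from that list.
      inside  : All (λ B → Any (B ⊑_) L) spans
  open Normal public

  -- The recursion runs on the length because the tail is replaced by its cut version. Spans that
  -- have become empty are discarded on arrival.
  normalise : ∀ m L → length L ≡ m → All Bounded L → AllPairs Nested L → Normal L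
  normalise zero [] _ _ _ = record { spans = [] ; arcs = [] ; laminar = [] ; same-z = ≋-refl ; inside = [] }
  normalise (suc m) ((a , b) ∷ L) len (bd ∷ bds) (h ∷ hs) = cases (a ℕ.<? b)
    where
      cases : Dec (a ℕ.< b) → Normal ((a , b) ∷ L)
      cases (no a≮b) = record
        { spans   = spans N
        ; arcs    = arcs N
        ; laminar = laminar N
        ; same-z  = ≋-trans (≋-reflexive (cong (_++ words L) (word-empty (ℕₚ.≮⇒≥ a≮b)))) (same-z N)
        ; inside  = All.map there (inside N)
        }
        where
          N : Normal L
          N = normalise m L (ℕₚ.suc-injective len) bds hs
      cases (yes a<b) = record
        { spans   = (a , b) ∷ spans N
        ; arcs    = arc ∷ arcs N
        ; laminar = All.map laminar-head (inside N) ∷ laminar N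
        ; same-z  = ≋-trans (cut-words arc L bds h) (≋-++ (≋-refl {word a b}) (same-z N))
        ; inside  = here (ℕₚ.≤-refl , ℕₚ.≤-refl) ∷ All.map inside-tail (inside N)
        }
        where
          arc : IsArc a b
          arc = proj₁ bd , a<b , proj₂ bd
          L′ : List Span
          L′ = List.map (cut (a , b)) L
          N : Normal L′
          N = normalise m L′ (trans (Listₚ.length-map (cut (a , b)) L) (ℕₚ.suc-injective len))
            (Allₚ.map⁺ (All.map (λ {B} → Bounded-cut (a , b) B) bds)) (AllPairs-Nested-cut (a , b) L hs)
          laminar-cuts : All (Laminar (a , b)) L′
          laminar-cuts = Allₚ.map⁺ (All.map (λ {B} → Laminar-cut B a<b) h)
          laminar-head : ∀ {B} → Any (B ⊑_) L′ → Laminar (a , b) B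
          laminar-head {B} any = let (C , C∈ , B⊑C) = find any in
            Laminar-⊑ {a , b} {C} {B} B⊑C (All.lookup laminar-cuts C∈)
          weaken : ∀ {B} M → Any (B ⊑_) (List.map (cut (a , b)) M) → Any (B ⊑_) M
          weaken {B} (C ∷ M) (here p)  = here (⊑-trans {B} {cut (a , b) C} {C} p (cut-⊑ (a , b) C))
          weaken (C ∷ M) (there p) = there (weaken M p)
          inside-tail : ∀ {B} → Any (B ⊑_) L′ → Any (B ⊑_) ((a , b) ∷ L)
          inside-tail p = there (weaken L p)

-- Lengths and compatibility of laminar families, and the peeling of z_d.

module Main (n : ℕ) (3≤n : 3 ℕ.≤ n) (base : Fin n) where
  open Affine n 3≤n
  open Roots n 3≤n
  open Hecke n 3≤n
  open Arcs n 3≤n base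
  open Words n 3≤n base
  open Rewriting n 3≤n
  open Insertion n 3≤n base

  Arc : Span → Set
  Arc (x , y) = IsArc x y

  ρ′ : Span → Q
  ρ′ (x , y) = ρ x y

  arc-bounded : ∀ {A} → Arc A → Bounded A
  arc-bounded (1≤x , _ , y≤n) = 1≤x , y≤n

  roots : (L : List Span) → Fin (length L) → Q
  roots L i = ρ′ (List.lookup L i)

  roots-positive : ∀ {L} → All Arc L → ∀ i → IsPositiveRealRoot (roots L i)
  roots-positive (arc ∷ arcs) zero    = ρ-positive arc
  roots-positive (arc ∷ arcs) (suc i) = roots-positive arcs i

  reflections : ∀ {L} → All Arc L → Fin (length L) → W
  reflections arcs i = s (proj₁ (roots-positive arcs i))

  ⟪words⟫ : ∀ L (arcs : All Arc L) → ∏ (reflections arcs) ≈ ⟪ words L ⟫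
  ⟪words⟫ []            []           μ = refl
  ⟪words⟫ ((x , y) ∷ L) (arc ∷ arcs) μ = trans (cong (to (σ arc)) (⟪words⟫ L arcs μ))
    (trans (sym (⟪word⟫ arc (⟦ words L ⟧ μ))) (sym (⟦⟧-++ (word x y) (words L) μ)))

  ascending-words : ∀ L → All Arc L → AllPairs Laminar L → Ascending ε (words L)
  ascending-words []            []           []       = []
  ascending-words ((x , y) ∷ L) (arc ∷ arcs) (h ∷ hs) = Ascending-++ ε w ws ascending-w
      (Ascending-cong (σ arc ∙ ε) (ε ∙ ⟪ w ⟫) ws (λ μ → sym (⟪word⟫ arc μ))
        (Ascending-shift (σ arc) ε ws (λ _ → refl) (fixed L arcs h) (ascending-words L arcs hs)))
    where
      w ws : List (Fin n)
      w = word x y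
      ws = words L
      ascending-w : Ascending ε w
      ascending-w = ℓ-Ascending ε w (ℕₚ.≤-reflexive (trans (cong (ℕ._+ length w) ℓ-ε)
        (trans (sym (ℓ-σ arc)) (ℓ-cong (σ arc) (ε ∙ ⟪ w ⟫) (λ μ → sym (⟪word⟫ arc μ))))))
      fixed : ∀ M → All Arc M → All (Laminar (x , y)) M → All (Fixes (σ arc)) (words M)
      fixed []      []       []       = []
      fixed (B ∷ M) (a ∷ as) (l ∷ ls) = Allₚ.++⁺ (Laminar-fixes arc B (arc-bounded a) l) (fixed M as ls)

  ★-words : ∀ L (arcs : All Arc L) → AllPairs Laminar L → ε ★ words L ≈ ∏ (reflections arcs)
  ★-words L arcs lam μ = trans (Ascending-★ ε (words L) (ascending-words L arcs lam) μ) (sym (⟪words⟫ L arcs μ))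

  ℓ-∏ : ∀ L (arcs : All Arc L) → AllPairs Laminar L → ℓ (∏ (reflections arcs)) ≡ length (words L)
  ℓ-∏ L arcs lam = trans (ℓ-cong (∏ (reflections arcs)) (ε ∙ ⟪ words L ⟫) (⟪words⟫ L arcs))
    (trans (Ascending-ℓ ε (words L) (ascending-words L arcs lam)) (cong (ℕ._+ length (words L)) ℓ-ε))

  length-words-ℓ : ∀ L (arcs : All Arc L) → length (words L) ≡ sumℕ (λ i → ℓ (reflections arcs i))
  length-words-ℓ []            []           = refl
  length-words-ℓ ((x , y) ∷ L) (arc ∷ arcs) = trans (Listₚ.length-++ (word x y))
    (cong₂ ℕ._+_ (sym (ℓ-σ arc)) (length-words-ℓ L arcs))

  length-words-supp : ∀ L → All Arc L → length (words L) ≡ sumℕ (λ i → 2 * ∣ supp (roots L i) ∣ ∸ 1)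
  length-words-supp []            []           = refl
  length-words-supp ((x , y) ∷ L) (arc ∷ arcs) = trans (Listₚ.length-++ (word x y))
    (cong₂ ℕ._+_ (length-word arc) (length-words-supp L arcs))

  Compatible : Q → Q → Set
  Compatible β γ = Disconnected (supp β) (supp γ) ⊎ (β ⊥ γ × Comparable β γ)

  Compatible-sym : ∀ β γ → Compatible β γ → Compatible γ β
  Compatible-sym β γ (inj₁ h) = inj₁ λ i j i∈ j∈ → let (ne , far) = h j i j∈ i∈ in ne ∘ sym , far ∘ Adjacent-sym
  Compatible-sym β γ (inj₂ (orth , inj₁ p)) = inj₂ (trans (form-sym γ β) orth , inj₂ p)
  Compatible-sym β γ (inj₂ (orth , inj₂ p)) = inj₂ (trans (form-sym γ β) orth , inj₁ p)

  supp-In : ∀ x y i → i ∈ supp (ρ x y) → In x y (pos i)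
  supp-In x y i i∈ = cases (in? x y (pos i))
    where
      absurd : ¬ false ≡ true
      absurd ()
      cases : Dec (In x y (pos i)) → In x y (pos i)
      cases (yes p) = p
      cases (no ¬p) = contradiction (trans (sym (trans (Vecₚ.lookup-map i _ (ρ x y)) (cong (λ a → not (does (a ℤ.≟ 0ℤ)))
        (subst (λ j → lookup (ρ x y) j ≡ 0ℤ) (vertex-pos i) (ρ-out x y (pos<n i) ¬p))))) (Vecₚ.[]=⇒lookup i∈)) absurd

  -- The only edge of the cycle that does not raise the position by one leads into `base`, at
  -- position 0.
  Next-pos : ∀ {i j} → Next i j → 1 ℕ.≤ pos j → pos j ≡ suc (pos i)
  Next-pos {i} {j} nx 1≤pos = cases (ℕₚ.m≤n⇒m<n∨m≡n (pos<n i))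
    where
      eq : vertex (suc (pos i)) ≡ vertex (pos j)
      eq = trans (cong succ (vertex-pos i)) (trans (Next-functional (proj₂ (next i)) nx) (sym (vertex-pos j)))
      cases : suc (pos i) ℕ.< n ⊎ suc (pos i) ≡ n → pos j ≡ suc (pos i)
      cases (inj₁ p) = vertex-injective (pos<n j) p (sym eq)
      cases (inj₂ p) = contradiction (sym (vertex-injective (pos<n j) 0<n
        (trans (sym eq) (trans (cong vertex p) (walk-closed base))))) (ℕₚ.<⇒≢ 1≤pos)

  -- A gap on the line is a gap on the cycle, because the edge closing the cycle ends at `base`,
  -- which both arcs avoid.
  Apart-disconnected : ∀ {x y u v} → IsArc x y → IsArc u v → Apart (x , y) (u , v) → Disconnected (supp (ρ x y)) (supp (ρ u v))
  Apart-disconnected {x} {y} {u} {v} (1≤x , _) (1≤u , _) apart i j i∈ j∈ = ne , far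
    where
      p : In x y (pos i)
      p = supp-In x y i i∈
      q : In u v (pos j)
      q = supp-In u v j j∈
      gap : suc (pos i) ℕ.< pos j ⊎ suc (pos j) ℕ.< pos i
      gap = cases apart
        where
          cases : Apart (x , y) (u , v) → suc (pos i) ℕ.< pos j ⊎ suc (pos j) ℕ.< pos i
          cases (inj₁ v<x) = inj₂ (ℕₚ.<-≤-trans (ℕₚ.≤-<-trans (proj₂ q) v<x) (proj₁ p))
          cases (inj₂ y<u) = inj₁ (ℕₚ.<-≤-trans (ℕₚ.≤-<-trans (proj₂ p) y<u) (proj₁ q))
      <suc : ∀ {k} → k ℕ.< suc k
      <suc = ℕₚ.n<1+n _
      ne : i ≢ j
      ne refl = cases gap
        where
          cases : suc (pos i) ℕ.< pos i ⊎ suc (pos i) ℕ.< pos i → _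
          cases (inj₁ h) = ℕₚ.<-asym h <suc
          cases (inj₂ h) = ℕₚ.<-asym h <suc
      far : ¬ Adjacent i j
      far (inj₁ nx) = cases gap (Next-pos nx (ℕₚ.≤-trans 1≤u (proj₁ q)))
        where
          cases : suc (pos i) ℕ.< pos j ⊎ suc (pos j) ℕ.< pos i → pos j ≢ suc (pos i)
          cases (inj₁ h) e = ℕₚ.<⇒≢ h (sym e)
          cases (inj₂ h) e = ℕₚ.<-asym (ℕₚ.<-trans <suc h) (ℕₚ.≤-reflexive (sym e))
      far (inj₂ nx) = cases gap (Next-pos nx (ℕₚ.≤-trans 1≤x (proj₁ p)))
        where
          cases : suc (pos i) ℕ.< pos j ⊎ suc (pos j) ℕ.< pos i → pos i ≢ suc (pos j)
          cases (inj₁ h) e = ℕₚ.<-asym (ℕₚ.<-trans <suc h) (ℕₚ.≤-reflexive (sym e))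
          cases (inj₂ h) e = ℕₚ.<⇒≢ h (sym e)

  inside-⊥ : ∀ {x y u v} → IsArc x y → IsArc u v → x ℕ.< u → v ℕ.< y → ρ x y ⊥ ρ u v
  inside-⊥ {x} {y} {u} {v} (1≤x , _ , y≤n) (1≤u , _ , v≤n) x<u v<y =
      trans (form-expand (ρ x y) (ρ u v)) (trans (sum-cong-≗ term) (sum-replicate-zero n))
    where
      at : ∀ k → k ℕ.< n → Dec (In u v k) → ⟨ ρ x y , α (vertex k) ⟩ ℤ.* lookup (ρ u v) (vertex k) ≡ 0ℤ
      at k k<n (yes (p , q)) = trans (cong (ℤ._* lookup (ρ u v) (vertex k)) (form-ρ-0 x y k 1≤x y≤n (ℕₚ.≤-trans 1≤u p) k<n
        (inj₁ (ℕₚ.<-≤-trans x<u p , ℕₚ.≤-<-trans q v<y)))) (ℤₚ.*-zeroˡ (lookup (ρ u v) (vertex k)))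
      at k k<n (no ¬p) = trans (cong (⟨ ρ x y , α (vertex k) ⟩ ℤ.*_) (ρ-out u v k<n ¬p)) (ℤₚ.*-zeroʳ ⟨ ρ x y , α (vertex k) ⟩)
      term : ∀ i → ⟨ ρ x y , α i ⟩ ℤ.* lookup (ρ u v) i ≡ 0ℤ
      term i = subst (λ j → ⟨ ρ x y , α j ⟩ ℤ.* lookup (ρ u v) j ≡ 0ℤ) (vertex-pos i) (at (pos i) (pos<n i) (in? u v (pos i)))

  Laminar-compatible : ∀ {A B} → Arc A → Arc B → Laminar A B → Compatible (ρ′ A) (ρ′ B)
  Laminar-compatible {x , y} {u , v} a b (inj₁ (p , q)) = inj₂ (inside-⊥ a b p q ,
    inj₂ (ρ-mono u v x y λ k (r , t) → ℕₚ.≤-trans (ℕₚ.<⇒≤ p) r , ℕₚ.<-trans t q))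
  Laminar-compatible {x , y} {u , v} a b (inj₂ apart) = inj₁ (Apart-disconnected a b apart)

  compatible : ∀ L → All Arc L → AllPairs Laminar L → ∀ i j → i ≢ j → Compatible (roots L i) (roots L j)
  compatible (A ∷ L) _ _ zero zero ne = contradiction refl ne
  compatible (A ∷ L) (a ∷ as) (h ∷ hs) zero (suc j) _ =
    Laminar-compatible a (All.lookup as (∈-lookup j)) (All.lookup h (∈-lookup j))
  compatible (A ∷ L) (a ∷ as) (h ∷ hs) (suc i) zero _ = Compatible-sym (ρ′ A) (roots L i)
    (Laminar-compatible a (All.lookup as (∈-lookup i)) (All.lookup h (∈-lookup i)))
  compatible (A ∷ L) (a ∷ as) (h ∷ hs) (suc i) (suc j) ne = compatible L as hs i j (ne ∘ cong suc)

  Fits : Degree → Span → Set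
  Fits d A = Arc A × ρ′ A ≤Q fromDegree d

  -- Spans that are not apart overlap or touch, so their union is an arc. Its coefficients are at
  -- most 1 and each position lies in one of two arcs below d, so the union is below d as well.
  -- Maximality makes it equal to `ρ a b`, and its two extreme positions then give the inclusion.
  maximal-nested : ∀ d a b → IsArc a b → IsMaximalRoot d (ρ a b) → ∀ B → Fits d B → Nested (a , b) B
  maximal-nested d a b (1≤a , a<b , b≤n) γ-max (x , y) ((1≤x , x<y , y≤n) , ρ≤d) = cases (a ℕ.≤? y) (x ℕ.≤? b)
    where
      cases : Dec (a ℕ.≤ y) → Dec (x ℕ.≤ b) → Nested (a , b) (x , y)
      cases (no ¬p) _ = inj₂ (inj₁ (ℕₚ.≰⇒> ¬p))
      cases _ (no ¬q) = inj₂ (inj₂ (ℕₚ.≰⇒> ¬q))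
      cases (yes a≤y) (yes x≤b) = inj₁ (ℕₚ.≤-trans (proj₁ low-in) (ℕₚ.m⊓n≤n a x) , ℕₚ.≤-trans (ℕₚ.m≤n⊔m b y) (top (b ℕ.⊔ y) refl))
        where
          lo hi : ℕ
          lo = a ℕ.⊓ x
          hi = b ℕ.⊔ y
          lo<hi : lo ℕ.< hi
          lo<hi = ℕₚ.≤-<-trans (ℕₚ.m⊓n≤m a x) (ℕₚ.<-≤-trans a<b (ℕₚ.m≤m⊔n b y))
          hi≤n : hi ℕ.≤ n
          hi≤n = ℕₚ.⊔-lub b≤n y≤n
          union : IsArc lo hi
          union = ℕₚ.⊓-glb 1≤a 1≤x , lo<hi , hi≤n
          0≤d : ∀ i → 0ℤ ℤ.≤ lookup (fromDegree d) i
          0≤d i = subst (0ℤ ℤ.≤_) (sym (lookup-fromDegree d i)) (ℤ.+≤+ z≤n)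
          split : ∀ k → In lo hi k → In a b k ⊎ In x y k
          split k (p , q) = decide (a ℕ.≤? k) (k ℕ.<? b)
            where
              decide : Dec (a ℕ.≤ k) → Dec (k ℕ.< b) → In a b k ⊎ In x y k
              decide (yes r) (yes t) = inj₁ (r , t)
              decide (no ¬r) _       = inj₂ (right , ℕₚ.<-≤-trans (ℕₚ.≰⇒> ¬r) a≤y)
                where
                  right : x ℕ.≤ k
                  right = [ (λ e → contradiction (subst (ℕ._≤ k) e p) ¬r) , (λ e → subst (ℕ._≤ k) e p) ]′ (ℕₚ.⊓-sel a x)
              decide _ (no ¬t) = inj₂ (ℕₚ.≤-trans x≤b (ℕₚ.≮⇒≥ ¬t) , right)
                where
                  right : k ℕ.< y
                  right = [ (λ e → contradiction (subst (k ℕ.<_) e q) ¬t) , (λ e → subst (k ℕ.<_) e q) ]′ (ℕₚ.⊔-sel b y)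
          at : ∀ k → k ℕ.< n → Dec (In lo hi k) → lookup (ρ lo hi) (vertex k) ℤ.≤ lookup (fromDegree d) (vertex k)
          at k k<n (no ¬p) = ℤₚ.≤-trans (ℤₚ.≤-reflexive (ρ-out lo hi k<n ¬p)) (0≤d (vertex k))
          at k k<n (yes p) = ℤₚ.≤-trans (ℤₚ.≤-reflexive (ρ-in lo hi k<n p)) (one (split k p))
            where
              one : In a b k ⊎ In x y k → 1ℤ ℤ.≤ lookup (fromDegree d) (vertex k)
              one (inj₁ r) = ℤₚ.≤-trans (ℤₚ.≤-reflexive (sym (ρ-in a b k<n r))) (below γ-max (vertex k))
              one (inj₂ r) = ℤₚ.≤-trans (ℤₚ.≤-reflexive (sym (ρ-in x y k<n r))) (ρ≤d (vertex k))
          union≤d : ρ lo hi ≤Q fromDegree d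
          union≤d i = subst (λ j → lookup (ρ lo hi) j ℤ.≤ lookup (fromDegree d) j) (vertex-pos i) (at (pos i) (pos<n i) (in? lo hi (pos i)))
          union≡ : ρ lo hi ≡ ρ a b
          union≡ = maximal γ-max (ρ lo hi) (ρ-positive union) union≤d
            (ρ-mono a b lo hi λ k (r , t) → ℕₚ.≤-trans (ℕₚ.m⊓n≤m a x) r , ℕₚ.<-≤-trans t (ℕₚ.m≤m⊔n b y))
          back : ∀ k → k ℕ.< n → In lo hi k → In a b k
          back k k<n p = χ-1⇒in a b k (trans (sym (lookup-ρ a b k<n)) (trans (cong (λ t → lookup t (vertex k)) (sym union≡)) (ρ-in lo hi k<n p)))
          low-in : In a b lo
          low-in = back lo (ℕₚ.<-≤-trans lo<hi hi≤n) (ℕₚ.≤-refl , lo<hi)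
          -- The last position of the union is hi - 1, so hi has to be exposed as a successor.
          top : ∀ h → h ≡ hi → h ℕ.≤ b
          top zero    _ = z≤n
          top (suc h) e = proj₂ (back h (ℕₚ.≤-trans (ℕₚ.≤-reflexive e) hi≤n)
            (ℕₚ.≤-pred (ℕₚ.≤-trans lo<hi (ℕₚ.≤-reflexive (sym e))) , ℕₚ.≤-reflexive e))

  record Peeling (d : Degree) (w : W) : Set where
    field
      layers : List Span
      fit    : All (Fits d) layers
      nested : AllPairs Nested layers
      value  : w ≈ ε ★ words layers
  open Peeling

  peel : ∀ {d w} → IsZ d w → lookup d base ≡ 0 → Peeling d w
  peel (z-zero eq) _ = record { layers = [] ; fit = [] ; nested = [] ; value = eq }
  peel {d} {w} (z-step {e = e} {γ} {u} d≢0 γ-max e≡ z-u (is , (expr , len) , w≈)) d≡0 =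
      step (root-arc γ (positive γ-max) γ≤0)
    where
      γ≤0 : lookup γ base ℤ.≤ 0ℤ
      γ≤0 = ℤₚ.≤-trans (below γ-max base) (ℤₚ.≤-reflexive (trans (lookup-fromDegree d base) (cong +_ d≡0)))
      e-coordinate : ∀ i → lookup (fromDegree e) i ≡ lookup (fromDegree d) i ℤ.- lookup γ i
      e-coordinate i = trans (cong (λ t → lookup t i) e≡) (lookup-⊖ (fromDegree d) γ i)
      step : (∃₂ λ x y → IsArc x y × γ ≡ ρ x y) → Peeling d w
      step (a , b , arc , γ≡) = record
        { layers = (a , b) ∷ layers P
        ; fit    = (arc , subst (_≤Q fromDegree d) γ≡ (below γ-max)) ∷ fit′
        ; nested = All.map (λ {B} → maximal-nested d a b arc (subst (IsMaximalRoot d) γ≡ γ-max) B) fit′ ∷ nested P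
        ; value  = value′
        }
        where
          γ-base : lookup γ base ≡ 0ℤ
          γ-base = trans (cong (λ t → lookup t base) γ≡) (ρ-base a b (proj₁ arc))
          e≡0 : lookup e base ≡ 0
          e≡0 = ℤₚ.+-injective (trans (sym (lookup-fromDegree e base)) (trans (e-coordinate base)
            (cong₂ ℤ._-_ (trans (lookup-fromDegree d base) (cong +_ d≡0)) γ-base)))
          P : Peeling e u
          P = peel z-u e≡0
          e≤d : fromDegree e ≤Q fromDegree d
          e≤d i = ℤₚ.≤-trans (ℤₚ.≤-reflexive (e-coordinate i)) (ℤₚ.≤-trans
            (ℤₚ.+-monoʳ-≤ (lookup (fromDegree d) i) (ℤₚ.neg-mono-≤ (subst (λ t → 0ℤ ℤ.≤ lookup t i) (sym γ≡) (0≤ (Pos-ρ a b) i))))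
            (ℤₚ.≤-reflexive (ℤₚ.+-identityʳ (lookup (fromDegree d) i))))
          -- Layers of the smaller degree e are also below d; this is the form in which maximality
          -- of γ can be used against them.
          fit′ : All (Fits d) (layers P)
          fit′ = All.map (λ (arc′ , le) → arc′ , λ i → ℤₚ.≤-trans (le i) (e≤d i)) (fit P)
          -- The expression `is` is an arbitrary reduced one. Being reduced, it has u as its Hecke
          -- product on `ε`, hence by `★-ext` it may be exchanged for the words of the layers.
          ascending : Ascending ε is
          ascending = ℓ-Ascending ε is (ℕₚ.≤-reflexive (trans (cong (ℕ._+ length is) ℓ-ε)
            (trans len (ℓ-cong u (ε ∙ ⟪ is ⟫) expr))))
          same-hecke : ε ★ is ≈ ε ★ words (layers P)
          same-hecke μ = trans (Ascending-★ ε is ascending μ) (trans (sym (expr μ)) (value P μ))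
          s-γ : s (proj₁ (positive γ-max)) ≈ ε ★ word a b
          s-γ μ = trans (cong (λ t → reflect t μ) γ≡) (sym (★-word arc μ))
          value′ : w ≈ ε ★ words ((a , b) ∷ layers P)
          value′ μ = begin
              to w μ ≡⟨ w≈ μ ⟩
              to (s (proj₁ (positive γ-max)) ★ is) μ ≡⟨ ★-ext is (words (layers P)) same-hecke (s (proj₁ (positive γ-max))) μ ⟩
              to (s (proj₁ (positive γ-max)) ★ words (layers P)) μ ≡⟨ ★-cong (s (proj₁ (positive γ-max))) (ε ★ word a b) (words (layers P)) s-γ μ ⟩
              to (ε ★ word a b ★ words (layers P)) μ ≡⟨ sym (≡⇒≈ (★-++ ε (word a b) (words (layers P))) μ) ⟩
              to (ε ★ (word a b ++ words (layers P))) μ ∎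
            where open ≡-Reasoning

theorem3p2 : (n : ℕ) (3≤n : 3 ≤ n) → let open Affine n 3≤n in
    (d : Degree) → (∃ λ i → lookup d i ≡ 0) →
    (z : W) → IsZ d z →
    ∃ λ (r : ℕ) → ∃ λ (γ : Fin r → Q) → ∃ λ (pos : ∀ i → IsPositiveRealRoot (γ i)) →
    z ≈ ∏ (λ i → s (proj₁ (pos i))) ×
    (∀ i j → i ≢ j →
    Disconnected (supp (γ i)) (supp (γ j)) ⊎ (γ i ⊥ γ j × Comparable (γ i) (γ j))) ×
    ℓ z ≡ sumℕ (λ i → ℓ (s (proj₁ (pos i)))) ×
    ℓ z ≡ sumℕ (λ i → 2 * ∣ supp (γ i) ∣ ∸ 1)
theorem3p2 n 3≤n d (base , d≡0) z z-d =
    length (spans N) , roots (spans N) , roots-positive (arcs N) , z≈ ,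
    compatible (spans N) (arcs N) (laminar N) ,
    trans ℓ-z (length-words-ℓ (spans N) (arcs N)) , trans ℓ-z (length-words-supp (spans N) (arcs N))
  where
    open Affine n 3≤n
    open Hecke n 3≤n
    open Rewriting n 3≤n
    open Insertion n 3≤n base
    open Main n 3≤n base
    P : Peeling d z
    P = peel z-d d≡0
    N : Normal (Peeling.layers P)
    N = normalise _ (Peeling.layers P) refl (All.map (λ (arc , _) → arc-bounded arc) (Peeling.fit P)) (Peeling.nested P)
    z≈ : z ≈ ∏ (reflections (arcs N))
    z≈ μ = trans (Peeling.value P μ) (trans (same (same-z N) ε μ) (★-words (spans N) (arcs N) (laminar N) μ))
    ℓ-z : ℓ z ≡ length (words (spans N))
    ℓ-z = trans (ℓ-cong z (∏ (reflections (arcs N))) z≈) (ℓ-∏ (spans N) (arcs N) (laminar N))
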